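{- Let $P$ be a polyomino of width $w$ and height $h$ placed on the grid (all other pixels empty), with a single robot in the model described in the context. There is a robot strategy that builds a bounding box enclosing $P$. The strategy terminates after $\mathcal{O}(\max(w,h)\cdot wh)$ steps, using at most $\mathcal{O}(|\partial P|)$ auxiliary tiles and only $\mathcal{O}(w+h)$ additional space. The running time in the best case is $\mathcal{O}(wh)$.
   Context: Model: A single robot acts as a deterministic finite automaton (constant memory) on the infinite grid graph $G$ with vertex set $\mathbb{Z}^2$ and edges between nodes at unit distance; nodes are called pixels. Each pixel is either empty or occupied by a tile. In each step the robot, based on its state and the state of its current pixel, applies a transition function $\delta(p,b)=(q,c,d)$: it changes to state $q$, sets the current pixel to state $c$ (so it may create or remove a tile), and moves one step in direction $d\in\{\text{up},\text{down},\text{left},\text{right}\}$. A diagonal pair is a pair of pixels $(x_1,y_1),(x_2,y_2)$ with $|x_1-x_2|=|y_1-y_2|=1$. A polyomino is a connected set $P\subset\mathbb{Z}^2$ of tiles such that for every diagonal pair $p_1,p_2\in P$ there is a tile $p\in P$ adjacent to both. The boundary $\partial P$ is the set of tiles of $P$ adjacent to an empty pixel or forming a diagonal pair with an empty pixel. The width $w$ and height $h$ of $P$ are the dimensions of the smallest axis-parallel rectangle containing $P$. A bounding box of $P$ is a closed zig-zag ring of auxiliary tiles surrounding $P$ (consisting of an inner lane and an outer lane of tiles, consecutive tiles of the zig-zag touching only at corners) that encloses $P$ and does not touch $P$. Complexity measures: time complexity is the total number of steps until termination; space complexity (additional space) is the number of visited pixels outside the bounding rectangle of the input polyomino $P$;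 tile complexity (auxiliary tiles) is the maximum, over the execution, of the number of tiles on the grid minus the number of tiles of the input polyomino $P$. -}

module Defs where

open import Data.Bool using (Bool; true; false)
open import Data.Nat as ℕ using (ℕ; suc; _<_; _≤_)
open import Data.Integer as ℤ using (ℤ; +_; ∣_∣)
import Data.Integer.Properties as ℤP
open import Data.Fin using (Fin)
open import Data.Product using (Σ; ∃; _×_; _,_; proj₁; proj₂)
open import Data.Product.Properties using (≡-dec)
open import Data.Sum using (_⊎_)
open import Data.List using (List; []; _∷_; _++_; length)
open import Data.List.Membership.Propositional using (_∈_; _∉_)
open import Data.List.Relation.Unary.All using (All)
open import Data.List.Relation.Unary.Any using (Any)
open import Data.List.Relation.Unary.Linked using (Linked)
open import Data.List.Relation.Unary.Unique.Propositional using (Unique)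
open import Relation.Binary.PropositionalEquality using (_≡_; _≢_)
open import Relation.Nullary using (¬_; does)
open import Function using (_⇔_)

-- The grid: pixels are points of ℤ², a grid state says which pixels
-- carry a tile (true = tile, false = empty).

Pixel : Set
Pixel = ℤ × ℤ

Grid : Set
Grid = Pixel → Bool

data Dir : Set where
  up down left right : Dir

move : Dir → Pixel → Pixel
move up    (x , y) = (x , y ℤ.+ ℤ.1ℤ)
move down  (x , y) = (x , y ℤ.- ℤ.1ℤ)
move left  (x , y) = (x ℤ.- ℤ.1ℤ , y)
move right (x , y) = (x ℤ.+ ℤ.1ℤ , y)

Adj4 : Pixel → Pixel → Set
Adj4 p q = ∃ λ d → q ≡ move d p

data Horizontal : Dir → Set where
  hl : Horizontal left
  hr : Horizontal right

data Vertical : Dir → Set where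
  vu : Vertical up
  vd : Vertical down

DiagPair : Pixel → Pixel → Set
DiagPair p q = Σ Dir λ h → Σ Dir λ v → Horizontal h × Vertical v × (q ≡ move v (move h p))

data Walk : Pixel → Pixel → List Pixel → Set where
  here  : ∀ {p} → Walk p p (p ∷ [])
  there : ∀ {p q r xs} → Adj4 p q → Walk q r xs → Walk p r (p ∷ xs)

Connected : List Pixel → Set
Connected P = ∀ {p q} → p ∈ P → q ∈ P → ∃ λ xs → Walk p q xs × All (_∈ P) xs

DiagCondition : List Pixel → Set
DiagCondition P = ∀ {p₁ p₂} → p₁ ∈ P → p₂ ∈ P → DiagPair p₁ p₂ →
  ∃ λ p → p ∈ P × Adj4 p p₁ × Adj4 p p₂

record Polyomino (P : List Pixel) : Set where
  field
    unique    : Unique P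
    nonempty  : ∃ λ p → p ∈ P
    connected : Connected P
    diagonal  : DiagCondition P

IsBoundary : List Pixel → Pixel → Set
IsBoundary P p = p ∈ P × ∃ λ q → q ∉ P × (Adj4 p q ⊎ DiagPair p q)

-- Bd is a duplicate-free enumeration of ∂P  (so |∂P| = length Bd)
BoundaryList : List Pixel → List Pixel → Set
BoundaryList P Bd = Unique Bd × (∀ p → (p ∈ Bd) ⇔ IsBoundary P p)

BoundingRect : List Pixel → ℤ → ℤ → ℤ → ℤ → Set
BoundingRect P x0 x1 y0 y1 =
  All (λ p → (x0 ℤ.≤ proj₁ p × proj₁ p ℤ.≤ x1) × (y0 ℤ.≤ proj₂ p × proj₂ p ℤ.≤ y1)) P ×
  Any (λ p → proj₁ p ≡ x0) P × Any (λ p → proj₁ p ≡ x1) P ×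
  Any (λ p → proj₂ p ≡ y0) P × Any (λ p → proj₂ p ≡ y1) P

extent : ℤ → ℤ → ℕ
extent a b = suc ∣ b ℤ.- a ∣

InRect : ℤ → ℤ → ℤ → ℤ → Pixel → Set
InRect x0 x1 y0 y1 (x , y) = (x0 ℤ.≤ x × x ℤ.≤ x1) × (y0 ℤ.≤ y × y ℤ.≤ y1)

OnRectBoundary : ℤ → ℤ → ℤ → ℤ → Pixel → Set
OnRectBoundary x0 x1 y0 y1 (x , y) =
  InRect x0 x1 y0 y1 (x , y) × (x ≡ x0 ⊎ x ≡ x1 ⊎ y ≡ y0 ⊎ y ≡ y1)

_≟ₚ_ : (p q : Pixel) → Relation.Nullary.Dec (p ≡ q)
_≟ₚ_ = ≡-dec ℤ._≟_ ℤ._≟_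

open import Data.List.Membership.DecPropositional _≟ₚ_ using (_∈?_)

gridOf : List Pixel → Grid
gridOf P q = does (q ∈? P)

-- Bounding box: a closed zig-zag ring b ∷ bs of distinct tiles,
-- consecutive tiles (cyclically) forming diagonal pairs, lying on an
-- inner lane (boundary of the rectangle [a0,a1]×[c0,c1]) and an outer
-- lane (boundary of [a0-1,a1+1]×[c0-1,c1+1]); it encloses P (every
-- walk from a tile of P to a pixel beyond the outer lane meets the
-- ring) and does not touch P (no ring tile equals, or is edge- or
-- corner-adjacent to, a tile of P).

record IsBoundingBox (P : List Pixel) (B : List Pixel) : Set where
  field
    ring        : Σ Pixel λ b → Σ (List Pixel) λ bs →
                    B ≡ b ∷ bs × Linked DiagPair (b ∷ bs ++ b ∷ [])
    distinct    : Unique B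
    a0 a1 c0 c1 : ℤ
    lanes       : All (λ b → OnRectBoundary a0 a1 c0 c1 b ⊎
                    OnRectBoundary (a0 ℤ.- ℤ.1ℤ) (a1 ℤ.+ ℤ.1ℤ) (c0 ℤ.- ℤ.1ℤ) (c1 ℤ.+ ℤ.1ℤ) b) B
    encloses    : ∀ {p q xs} → p ∈ P →
                    ¬ InRect (a0 ℤ.- ℤ.1ℤ) (a1 ℤ.+ ℤ.1ℤ) (c0 ℤ.- ℤ.1ℤ) (c1 ℤ.+ ℤ.1ℤ) q →
                    Walk p q xs → Any (_∈ B) xs
    noTouch     : ∀ {b p} → b ∈ B → p ∈ P → b ≢ p × ¬ Adj4 b p × ¬ DiagPair b p

record Robot : Set where
  field
    n       : ℕ
    start   : Fin n
    halting : Fin n → Bool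
    δ       : Fin n → Bool → Fin n × Bool × Dir

record Conf (R : Robot) : Set where
  constructor conf
  field
    state : Fin (Robot.n R)
    grid  : Grid
    pos   : Pixel

set : Grid → Pixel → Bool → Grid
set g p c q with does (q ≟ₚ p)
... | true  = c
... | false = g q

step : (R : Robot) → Conf R → Conf R
step R (conf s g p) with Robot.δ R s (g p)
... | (q , c , d) = conf q (set g p c) (move d p)

run : (R : Robot) → Conf R → ℕ → Conf R
run R c ℕ.zero    = c
run R c (suc t)   = step R (run R c t)

initial : (R : Robot) → List Pixel → Pixel → Conf R
initial R P s = conf (Robot.start R) (gridOf P) s

HaltsAt : (R : Robot) → Conf R → ℕ → Set
HaltsAt R c T = Robot.halting R (Conf.state (run R c T)) ≡ true ×
                (∀ t → t < T → Robot.halting R (Conf.state (run R c t)) ≡ false)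

BuildsBoundingBox : List Pixel → Grid → Set
BuildsBoundingBox P g = ∃ λ B → IsBoundingBox P B ×
  (∀ q → (g q ≡ true) ⇔ (q ∈ P ⊎ q ∈ B))

TilesBounded : (R : Robot) → Conf R → ℕ → ℕ → ℕ → Set
TilesBounded R c T sizeP k = ∀ t → t ≤ T → ∀ L → Unique L →
  All (λ q → Conf.grid (run R c t) q ≡ true) L → length L ℕ.≤ sizeP ℕ.+ k

SpaceBounded : (R : Robot) → Conf R → ℕ → ℤ → ℤ → ℤ → ℤ → ℕ → Set
SpaceBounded R c T x0 x1 y0 y1 k = ∀ L → Unique L →
  All (λ q → ¬ InRect x0 x1 y0 y1 q × ∃ λ t → t ≤ T × Conf.pos (run R c t) ≡ q) L →
  length L ℕ.≤ k

{-# OPTIONS --safe #-}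
-- The robot grows a rectangle Q, at first the start pixel alone, until no tile of P is adjacent to it; as P is
-- connected, Q is then the bounding rectangle.  To find the ends of a side of Q it overwrites a 2 × 2 block
-- diagonally outside each corner of Q with the pattern "tile on the diagonal, empty elsewhere", which by the
-- diagonal condition occurs nowhere in P, and keeps the 16 overwritten pixels in its finite memory.  It walks
-- along a side; if the adjacent row contains a tile, both markers of the side move outwards, otherwise it turns to
-- the next side, and four misses in a row end the search.  There are O(w + h) walks of length O(w + h), and
-- (w + h)² = O(max(w,h) · wh).  On a full rectangle each side is exhausted the first time it is met, so that the
-- walks along it cost O(wh) altogether.  Around Q the pixels of one colour of the checkerboard in the lanes at
-- distance 2 and 3, without the outer corners, form the zig-zag ring: a step from the inner to the outer lane
-- changes the colour and therefore hits it.
--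
-- All four sides are treated in one local frame, the frame being part of the state of the robot.

module Submission where

open import Defs
open import Data.Bool using (Bool; true; false; not; _∧_; _∨_; _xor_; if_then_else_)
open import Data.Bool.Properties using (not-involutive)
open import Data.Empty using (⊥; ⊥-elim)
open import Data.Fin as Fin using (Fin)
open import Data.Fin.Patterns
import Data.Fin.Properties as FinP
open import Data.Integer.Tactic.RingSolver using (solve-∀)
open import Data.Integer as ℤ using (ℤ; +_; -[1+_]; -≤-; -≤+; +≤+)
import Data.Integer.Properties as ℤP
open import Data.List using (List; []; _∷_; _++_; length; map; cartesianProduct; cartesianProductWith; applyUpTo; upTo)
open import Data.List.Membership.DecPropositional _≟ₚ_ using (_∈?_)
open import Data.List.Membership.Propositional using (_∈_; _∉_; find; lose)
open import Data.List.Membership.Propositional.Properties using (∈-map⁺; ∈-map⁻; ∈-++⁺ˡ; ∈-++⁺ʳ; ∈-++⁻; ∈-∃++; ∈-cartesianProduct⁺; ∈-cartesianProduct⁻; ∈-cartesianProductWith⁺; ∈-applyUpTo⁺; ∈-upTo⁺; ∈-upTo⁻)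
open import Data.List.Properties using (length-map; length-++; map-++; ++-assoc; length-applyUpTo)
open import Data.List.Relation.Unary.All as All using (All; []; _∷_)
open import Data.List.Relation.Unary.AllPairs using ([]; _∷_)
open import Data.List.Relation.Unary.Any using (Any; here; there)
open import Data.List.Relation.Unary.Linked as Linked using (Linked; []; [-]; _∷_)
import Data.List.Relation.Unary.Linked.Properties as LinkedP
open import Data.List.Relation.Unary.Unique.Propositional using (Unique)
import Data.List.Relation.Unary.Unique.Propositional.Properties as UniqueP
open import Data.Nat as ℕ using (ℕ; zero; suc; z≤n; s≤s; _+_; _*_; _∸_; _⊔_; _≤_; _<_)
import Data.Nat.Properties as ℕP
open import Data.Nat.Tactic.RingSolver using () renaming (solve-∀ to solveℕ-∀)
open import Data.Product using (Σ; ∃; _×_; _,_; proj₁; proj₂)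
open import Data.Sum using (_⊎_; inj₁; inj₂)
open import Data.Unit using (⊤; tt)
open import Function using (_∘_; id; mk⇔; Equivalence)
open import Relation.Binary.PropositionalEquality
open import Relation.Nullary using (¬_; Dec; yes; no; does)
open import Relation.Nullary.Decidable using (dec-true; dec-false; from-yes)

-- Isometries of the grid

-- A finite automaton cannot count the length of a side, so the ends of the side must be readable
-- from a grid that may already carry unknown tiles of P there. A side advances only over a row that
-- contains a tile, so the rectangle never leaves the bounding rectangle and the robot never goes
-- further than distance 3 from it; this is the space bound. Auxiliary tiles are at most the 16
-- marker cells and the ring, hence O(w + h), and this is O(|∂P|) because every column and row of
-- the bounding rectangle contains a boundary tile. The state of the robot determines only the
-- directions of the local frame. Where the frame lies on the grid is known to the proof alone,
-- which therefore pairs a configuration with an isometry and with the gaps L, R, T, B between the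
-- rectangle and the bounding rectangle. `Ev` records the invariant of every configuration passed,
-- so that time, space and tiles come from one traversal of the program.

opp : Dir → Dir
opp up = down
opp down = up
opp left = right
opp right = left

-- The direction seen as d in a frame whose `right` is f and whose `down` is o.
act : Dir → Dir → Dir → Dir
act f o right = f
act f o left = opp f
act f o down = o
act f o up = opp o

opp-involutive : ∀ d → opp (opp d) ≡ d
opp-involutive up = refl
opp-involutive down = refl
opp-involutive left = refl
opp-involutive right = refl

act-opp : ∀ f o d → act f o (opp d) ≡ opp (act f o d)
act-opp f o up = sym (opp-involutive o)
act-opp f o down = refl
act-opp f o left = sym (opp-involutive f)
act-opp f o right = refl

act-∘ : ∀ f o f′ o′ d → act (act f o f′) (act f o o′) d ≡ act f o (act f′ o′ d)
act-∘ f o f′ o′ up = sym (act-opp f o o′)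
act-∘ f o f′ o′ down = refl
act-∘ f o f′ o′ left = sym (act-opp f o f′)
act-∘ f o f′ o′ right = refl

Perpendicular : Dir → Dir → Set
Perpendicular a b = Horizontal a × Vertical b ⊎ Vertical a × Horizontal b

horizontal-opp : ∀ {d} → Horizontal d → Horizontal (opp d)
horizontal-opp hl = hr
horizontal-opp hr = hl

vertical-opp : ∀ {d} → Vertical d → Vertical (opp d)
vertical-opp vu = vd
vertical-opp vd = vu

perp-sym : ∀ {a b} → Perpendicular a b → Perpendicular b a
perp-sym (inj₁ (h , v)) = inj₂ (v , h)
perp-sym (inj₂ (v , h)) = inj₁ (h , v)

perp-oppˡ : ∀ {a b} → Perpendicular a b → Perpendicular (opp a) b
perp-oppˡ (inj₁ (h , v)) = inj₁ (horizontal-opp h , v)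
perp-oppˡ (inj₂ (v , h)) = inj₂ (vertical-opp v , h)

act-hv : ∀ {f o h v} → Perpendicular f o → Horizontal h → Vertical v →
         Perpendicular (act f o h) (act f o v)
act-hv p hr vd = p
act-hv p hl vd = perp-oppˡ p
act-hv p hr vu = perp-sym (perp-oppˡ (perp-sym p))
act-hv p hl vu = perp-oppˡ (perp-sym (perp-oppˡ (perp-sym p)))

act-perp : ∀ {f o a b} → Perpendicular f o → Perpendicular a b →
           Perpendicular (act f o a) (act f o b)
act-perp p (inj₁ (h , v)) = act-hv p h v
act-perp p (inj₂ (v , h)) = perp-sym (act-hv p h v)

record Iso : Set where
  field
    to from   : Pixel → Pixel
    fwd out   : Dir
    perp      : Perpendicular fwd out
    unact     : Dir → Dir
    act-unact : ∀ d → act fwd out (unact d) ≡ d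
    to-move   : ∀ d p → to (move d p) ≡ move (act fwd out d) (to p)
    from-to   : ∀ p → from (to p) ≡ p
    to-from   : ∀ p → to (from p) ≡ p

  to-injective : ∀ {p q} → to p ≡ to q → p ≡ q
  to-injective {p} {q} e = trans (sym (from-to p)) (trans (cong from e) (from-to q))

  from-move : ∀ d p → from (move d p) ≡ move (unact d) (from p)
  from-move d p = to-injective (begin
    to (from (move d p))                       ≡⟨ to-from _ ⟩
    move d p                                   ≡⟨ cong₂ move (sym (act-unact d)) (sym (to-from p)) ⟩
    move (act fwd out (unact d)) (to (from p)) ≡⟨ to-move (unact d) (from p) ⟨
    to (move (unact d) (from p))               ∎)
    where open ≡-Reasoning

open Iso public

infixr 9 _∘ᵢ_
_∘ᵢ_ : Iso → Iso → Iso
ψ ∘ᵢ κ = record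
  { to = to ψ ∘ to κ
  ; from = from κ ∘ from ψ
  ; fwd = act (fwd ψ) (out ψ) (fwd κ)
  ; out = act (fwd ψ) (out ψ) (out κ)
  ; perp = act-perp (perp ψ) (perp κ)
  ; unact = unact κ ∘ unact ψ
  ; act-unact = λ d → trans (act-∘ (fwd ψ) (out ψ) (fwd κ) (out κ) (unact κ (unact ψ d)))
      (trans (cong (act (fwd ψ) (out ψ)) (act-unact κ (unact ψ d))) (act-unact ψ d))
  ; to-move = λ d p → trans (cong (to ψ) (to-move κ d p))
      (trans (to-move ψ _ _) (cong (λ e → move e (to ψ (to κ p)))
        (sym (act-∘ (fwd ψ) (out ψ) (fwd κ) (out κ) d))))
  ; from-to = λ p → trans (cong (from κ) (from-to ψ _)) (from-to κ p)
  ; to-from = λ p → trans (cong (to ψ) (to-from κ _)) (to-from ψ p)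
  }

-- `DiagPair` lists the horizontal step before the vertical one; in the other order the two steps
-- commute definitionally.
diagPair-move : ∀ {a b} → Perpendicular a b → ∀ p → DiagPair p (move b (move a p))
diagPair-move (inj₁ (h , v)) p = _ , _ , h , v , refl
diagPair-move (inj₂ (vu , hl)) p = _ , _ , hl , vu , refl
diagPair-move (inj₂ (vu , hr)) p = _ , _ , hr , vu , refl
diagPair-move (inj₂ (vd , hl)) p = _ , _ , hl , vd , refl
diagPair-move (inj₂ (vd , hr)) p = _ , _ , hr , vd , refl

diagPair-to : ∀ ψ {p q} → DiagPair p q → DiagPair (to ψ p) (to ψ q)
diagPair-to ψ {p} (h , v , hh , vv , refl) =
  subst (DiagPair (to ψ p))
    (sym (trans (to-move ψ v (move h p)) (cong (move _) (to-move ψ h p))))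
    (diagPair-move (act-perp (perp ψ) (inj₁ (hh , vv))) (to ψ p))

cancel₁ : ∀ c x → c ℤ.+ (x ℤ.- c) ≡ x
cancel₁ = solve-∀
cancel₂ : ∀ c x → (c ℤ.+ x) ℤ.- c ≡ x
cancel₂ = solve-∀
cancel₃ : ∀ c x → ℤ.- c ℤ.- (ℤ.- c ℤ.- x) ≡ x
cancel₃ = solve-∀
assoc-suc : ∀ c x → c ℤ.+ (x ℤ.+ ℤ.1ℤ) ≡ c ℤ.+ x ℤ.+ ℤ.1ℤ
assoc-suc = solve-∀
assoc-pred : ∀ c x → c ℤ.+ (x ℤ.- ℤ.1ℤ) ≡ c ℤ.+ x ℤ.- ℤ.1ℤ
assoc-pred = solve-∀
neg-suc : ∀ x → ℤ.- (x ℤ.+ ℤ.1ℤ) ≡ ℤ.- x ℤ.- ℤ.1ℤ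
neg-suc = solve-∀
neg-pred : ∀ x → ℤ.- (x ℤ.- ℤ.1ℤ) ≡ ℤ.- x ℤ.+ ℤ.1ℤ
neg-pred = solve-∀
minus-suc : ∀ c x → c ℤ.- (x ℤ.+ ℤ.1ℤ) ≡ c ℤ.- x ℤ.- ℤ.1ℤ
minus-suc = solve-∀
minus-pred : ∀ c x → c ℤ.- (x ℤ.- ℤ.1ℤ) ≡ c ℤ.- x ℤ.+ ℤ.1ℤ
minus-pred = solve-∀

translate : ℤ → ℤ → Iso
translate a b = record
  { to = λ { (x , y) → (a ℤ.+ x , b ℤ.+ y) }
  ; from = λ { (x , y) → (x ℤ.- a , y ℤ.- b) }
  ; fwd = right
  ; out = down
  ; perp = inj₁ (hr , vd)
  ; unact = id
  ; act-unact = λ { up → refl ; down → refl ; left → refl ; right → refl }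
  ; to-move = λ
      { up (x , y) → cong (_ ,_) (assoc-suc b y)
      ; down (x , y) → cong (_ ,_) (assoc-pred b y)
      ; left (x , y) → cong (_, _) (assoc-pred a x)
      ; right (x , y) → cong (_, _) (assoc-suc a x) }
  ; from-to = λ { (x , y) → cong₂ _,_ (cancel₂ a x) (cancel₂ b y) }
  ; to-from = λ { (x , y) → cong₂ _,_ (cancel₁ a x) (cancel₁ b y) }
  }

-- The frame of the next side: the origin is always the end corner of the side under inspection, and the
-- rectangle is [-n,-1] × [1,m], so the outside of the inspected side lies towards `down`.
quarter : ℕ → Iso
quarter m = record
  { to = λ { (x , y) → (ℤ.- y , + suc m ℤ.+ x) }
  ; from = λ { (x , y) → (y ℤ.- + suc m , ℤ.- x) }
  ; fwd = up
  ; out = right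
  ; perp = inj₂ (vu , hr)
  ; unact = λ { up → right ; down → left ; left → up ; right → down }
  ; act-unact = λ { up → refl ; down → refl ; left → refl ; right → refl }
  ; to-move = λ
      { up (x , y) → cong (_, _) (neg-suc y)
      ; down (x , y) → cong (_, _) (neg-pred y)
      ; left (x , y) → cong (_ ,_) (assoc-pred (+ suc m) x)
      ; right (x , y) → cong (_ ,_) (assoc-suc (+ suc m) x) }
  ; from-to = λ { (x , y) → cong₂ _,_ (cancel₂ (+ suc m) x) (ℤP.neg-involutive y) }
  ; to-from = λ { (x , y) → cong₂ _,_ (ℤP.neg-involutive x) (cancel₁ (+ suc m) y) }
  }

-- Columns `0` and `-[1+ n ]` are exchanged, so the corner where the walk began becomes the end
-- corner at the origin, and the way back is again a walk to the right.
mirror : ℕ → Iso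
mirror n = record
  { to = λ { (x , y) → (-[1+ n ] ℤ.- x , y) }
  ; from = λ { (x , y) → (-[1+ n ] ℤ.- x , y) }
  ; fwd = left
  ; out = down
  ; perp = inj₁ (hl , vd)
  ; unact = λ { up → up ; down → down ; left → right ; right → left }
  ; act-unact = λ { up → refl ; down → refl ; left → refl ; right → refl }
  ; to-move = λ
      { up (x , y) → refl
      ; down (x , y) → refl
      ; left (x , y) → cong (_, _) (minus-pred -[1+ n ] x)
      ; right (x , y) → cong (_, _) (minus-suc -[1+ n ] x) }
  ; from-to = λ { (x , y) → cong (_, _) (cancel₃ (+ suc n) x) }
  ; to-from = λ { (x , y) → cong (_, _) (cancel₃ (+ suc n) x) }
  }

-- Finite types as robot states

-- A retract of `Fin size`: codes outside the image of `enc` are states that the robot never enters,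
-- as `start` and `δ` produce only values of `enc`.
record Finite (A : Set) : Set where
  field
    size    : ℕ
    enc     : A → Fin size
    dec     : Fin size → A
    dec-enc : ∀ a → dec (enc a) ≡ a

open Finite

finite-retract : ∀ {A B : Set} → Finite B → (f : A → B) (g : B → A) → (∀ a → g (f a) ≡ a) → Finite A
finite-retract F f g gf = record
  { size = size F ; enc = enc F ∘ f ; dec = g ∘ dec F
  ; dec-enc = λ a → trans (cong g (dec-enc F (f a))) (gf a) }

finite-Fin : ∀ n → Finite (Fin n)
finite-Fin n = record { size = n ; enc = id ; dec = id ; dec-enc = λ _ → refl }

finite-× : ∀ {A B : Set} → Finite A → Finite B → Finite (A × B)
finite-× F G = record
  { size = size F * size G
  ; enc = λ { (a , b) → Fin.combine (enc F a) (enc G b) }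
  ; dec = λ i → dec F (proj₁ (Fin.remQuot (size G) i)) , dec G (proj₂ (Fin.remQuot {size F} (size G) i))
  ; dec-enc = λ { (a , b) → trans
      (cong (λ { (i , j) → dec F i , dec G j }) (FinP.remQuot-combine (enc F a) (enc G b)))
      (cong₂ _,_ (dec-enc F a) (dec-enc G b)) }
  }

finite-⊎ : ∀ {A B : Set} → Finite A → Finite B → Finite (A ⊎ B)
finite-⊎ F G = record
  { size = size F + size G
  ; enc = λ s → Fin.join (size F) (size G) (Data.Sum.map (enc F) (enc G) s)
  ; dec = λ i → Data.Sum.map (dec F) (dec G) (Fin.splitAt (size F) i)
  ; dec-enc = λ s → trans
      (cong (Data.Sum.map (dec F) (dec G)) (FinP.splitAt-join (size F) (size G) (Data.Sum.map (enc F) (enc G) s)))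
      (lemma s)
  }
  where
  lemma : ∀ s → Data.Sum.map (dec F) (dec G) (Data.Sum.map (enc F) (enc G) s) ≡ s
  lemma (inj₁ a) = cong inj₁ (dec-enc F a)
  lemma (inj₂ b) = cong inj₂ (dec-enc G b)

finite-Bool : Finite Bool
finite-Bool = finite-retract (finite-Fin 2)
  (λ { false → 0F ; true → 1F }) (λ { 0F → false ; 1F → true }) (λ { false → refl ; true → refl })

finite-Dir : Finite Dir
finite-Dir = finite-retract (finite-Fin 4)
  (λ { up → 0F ; down → 1F ; left → 2F ; right → 3F })
  (λ { 0F → up ; 1F → down ; 2F → left ; 3F → right })
  (λ { up → refl ; down → refl ; left → refl ; right → refl })

-- The robot

-- Four positions along an axis: far and near cell of the low corner, near and far cell of the high one.
data Ix : Set where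
  lf ln hn hf : Ix

flip : Ix → Ix
flip lf = hf
flip ln = hn
flip hn = ln
flip hf = lf

near : Ix → Bool
near lf = false
near ln = true
near hn = true
near hf = false

-- The equivalence of `near i` and `near j`: symmetric in its indices and invariant under `flip`, so
-- a marker looks the same after every change of frame.
mark : Ix → Ix → Bool
mark i j = if near i then near j else not (near j)

Quad : Set → Set
Quad A = A × A × A × A

get : ∀ {A} → Quad A → Ix → A
get (a , b , c , d) lf = a
get (a , b , c , d) ln = b
get (a , b , c , d) hn = c
get (a , b , c , d) hf = d

quad : ∀ {A} → (Ix → A) → Quad A
quad f = f lf , f ln , f hn , f hf

get-quad : ∀ {A} (f : Ix → A) i → get (quad f) i ≡ f i
get-quad f lf = refl
get-quad f ln = refl
get-quad f hn = refl
get-quad f hf = refl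

Memory : Set
Memory = Quad (Quad Bool)

recall : Memory → Ix → Ix → Bool
recall r i j = get (get r i) j

memory : (Ix → Ix → Bool) → Memory
memory f = quad (λ i → quad (f i))

recall-memory : ∀ f i j → recall (memory f) i j ≡ f i j
recall-memory f i j =
  trans (cong (λ r → get r j) (get-quad (λ i → quad (f i)) i)) (get-quad (f i) j)

_≟ᵢ_ : (i j : Ix) → Dec (i ≡ j)
lf ≟ᵢ lf = yes refl
lf ≟ᵢ ln = no λ ()
lf ≟ᵢ hn = no λ ()
lf ≟ᵢ hf = no λ ()
ln ≟ᵢ lf = no λ ()
ln ≟ᵢ ln = yes refl
ln ≟ᵢ hn = no λ ()
ln ≟ᵢ hf = no λ ()
hn ≟ᵢ lf = no λ ()
hn ≟ᵢ ln = no λ ()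
hn ≟ᵢ hn = yes refl
hn ≟ᵢ hf = no λ ()
hf ≟ᵢ lf = no λ ()
hf ≟ᵢ ln = no λ ()
hf ≟ᵢ hn = no λ ()
hf ≟ᵢ hf = yes refl

put : Ix → Ix → Bool → Memory → Memory
put i j b r = memory λ i′ j′ → if does (i′ ≟ᵢ i) ∧ does (j′ ≟ᵢ j) then b else recall r i′ j′

recall-put : ∀ i j b r → recall (put i j b r) i j ≡ b
recall-put i j b r rewrite recall-memory (λ i′ j′ → if does (i′ ≟ᵢ i) ∧ does (j′ ≟ᵢ j) then b else recall r i′ j′) i j
  | dec-true (i ≟ᵢ i) refl | dec-true (j ≟ᵢ j) refl = refl

recall-put-other : ∀ i j b r i′ j′ → (i′ , j′) ≢ (i , j) → recall (put i j b r) i′ j′ ≡ recall r i′ j′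
recall-put-other i j b r i′ j′ ne
  rewrite recall-memory (λ i′ j′ → if does (i′ ≟ᵢ i) ∧ does (j′ ≟ᵢ j) then b else recall r i′ j′) i′ j′
  with i′ ≟ᵢ i | j′ ≟ᵢ j
... | yes refl | yes refl = ⊥-elim (ne refl)
... | yes refl | no _ = refl
... | no _ | _ = refl

mirrored : Memory → Memory
mirrored r = memory (λ i j → recall r (flip i) j)

quartered : Memory → Memory
quartered r = memory (λ i j → recall r (flip j) i)

data Errand : Set where
  initially outbound homebound : Errand

-- approach, plant, retreat : put a marker at the end corner (initially at all four corners in turn);
-- depart, low, high, judge : walk to the end corner two rows wide, remembering the previous column (pl , ph);
-- pull, hoist, plant, sink : move the marker of the end corner one row outwards;
-- enter, lane              : draw the ring, column by column.
-- `ret` means that the other end of an extended side is being fetched, `hit` that the side touches a tile.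
data Ctrl : Set where
  approach retreat : Bool → Ctrl
  plant  : Errand → Fin 4 → Ctrl
  depart : (ret : Bool) → Ctrl
  low    : (ret hit pl ph : Bool) → Ctrl
  high   : (ret hit pl ph lo : Bool) → Ctrl
  judge  : (ret hit pl ph lo hi : Bool) → Ctrl
  pull   : (ret : Bool) → Fin 4 → Ctrl
  hoist  : (ret : Bool) → Ctrl
  sink enter done : Ctrl
  lane   : (kind stage : Fin 5) (k : Bool) → Ctrl

data Turn : Set where
  straight quarterly back : Turn

turn : Turn → Dir × Dir → Dir × Dir
turn straight fo = fo
turn quarterly (f , o) = opp o , f
turn back (f , o) = opp f , o

-- The counter counts planted corners, then consecutive sides found empty, then finished sides of the ring.
Local : Set
Local = Memory × Fin 4 × Ctrl

-- `pl` and `lo` come from row 0 next to the rectangle, `ph` and `hi` from row -1. The pattern is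
-- complete only in its second column, hence a walk ends at abscissa 1.
marker? : (pl ph lo hi : Bool) → Bool
marker? true false false true = true
marker? _ _ _ _ = false

next : Fin 4 → Fin 4
next 0F = 1F
next 1F = 2F
next _ = 3F

arrive : Memory → Fin 4 → (ret hit : Bool) → Local × Turn
arrive r j true _ = (r , j , pull true 0F) , straight
arrive r j false true = (r , j , pull false 0F) , straight
arrive r 3F false false = (quartered r , 0F , enter) , quarterly
arrive r j false false = (quartered r , next j , depart false) , quarterly

planted : Errand → Fin 4 → Memory → Local × Turn
planted initially 3F r = (quartered r , 0F , depart false) , quarterly
planted initially j r = (r , j , retreat false) , straight
planted outbound j r = (r , j , sink) , straight
planted homebound j r = (mirrored r , 0F , depart false) , back

errand : Bool → Errand
errand true = homebound
errand false = outbound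

-- Kinds of columns along one side of the ring: `0F` and `1F` are the two columns of the start
-- corner, whose pixels in row 0 may carry marker or ring tiles and are passed over unchanged; `2F`
-- are the columns up to the end corner; `3F` and `4F` are the two columns of the end corner.
advance : Fin 5 → Fin 5
advance 0F = 1F
advance 1F = 2F
advance 2F = 2F
advance _ = 4F

rounded : Memory → Fin 4 → Bool → Local
rounded r 3F k = r , 3F , done
-- The bit is passed on unchanged: the inner pixel of the last column is also the inner pixel of the
-- first column of the next side, and is written twice with the same value.
rounded r j k = r , next j , lane 0F 0F k

Action : Set
Action = Local × Turn × Bool × Dir

judgement : Memory → Fin 4 → (ret hit pl lo hi found b : Bool) → Action
judgement r j ret hit pl lo hi true b =
  proj₁ (arrive r j ret hit) , proj₂ (arrive r j ret hit) , b , left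
-- `hit` lags one column behind, taking up `pl` instead of `lo`: the tile read in column 0 belongs
-- to the marker and must not count as a hit.
judgement r j ret hit pl lo hi false b = (r , j , low ret (hit ∨ pl) lo hi) , straight , b , right

δL : Local → Bool → Action
δL (r , j , approach false) b = (r , j , approach true) , straight , b , right
δL (r , j , approach true) b = (r , j , plant initially 0F) , straight , b , down
δL (r , j , plant e 0F) b = (put hn ln b r , j , plant e 1F) , straight , true , down
δL (r , j , plant e 1F) b = (put hn lf b r , j , plant e 2F) , straight , false , right
δL (r , j , plant e 2F) b = (put hf lf b r , j , plant e 3F) , straight , true , up
δL (r , j , plant e 3F) b =
  proj₁ (planted e j (put hf ln b r)) , proj₂ (planted e j (put hf ln b r)) , false , left
δL (r , j , retreat false) b = (r , j , retreat true) , straight , b , up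
δL (r , j , retreat true) b = (quartered r , next j , approach false) , quarterly , b , left
δL (r , j , depart ret) b = (r , j , low ret false false false) , straight , b , right
δL (r , j , low ret hit pl ph) b = (r , j , high ret hit pl ph b) , straight , b , down
δL (r , j , high ret hit pl ph lo) b = (r , j , judge ret hit pl ph lo b) , straight , b , up
δL (r , j , judge ret hit pl ph lo hi) b = judgement r j ret hit pl lo hi (marker? pl ph lo hi) b
δL (r , j , pull ret 0F) b = (r , j , pull ret 1F) , straight , recall r hn ln , down
δL (r , j , pull ret 1F) b = (r , j , pull ret 2F) , straight , recall r hn lf , right
δL (r , j , pull ret 2F) b = (r , j , pull ret 3F) , straight , recall r hf lf , up
δL (r , j , pull ret 3F) b = (r , j , hoist ret) , straight , recall r hf ln , left
δL (r , j , hoist ret) b = (r , j , plant (errand ret) 0F) , straight , b , down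
δL (r , j , sink) b = (mirrored r , j , depart true) , back , b , up
δL (r , j , enter) b = (r , j , lane 0F 0F true) , straight , b , left
-- Row 0 beside the finished rectangle is free of tiles of P, so a tile met there is the near cell
-- of the end marker; it is erased in passing.
δL (r , j , lane 2F 0F k) true = (r , j , lane 3F 1F k) , straight , false , down
δL (r , j , lane i 0F k) b = (r , j , lane i 1F k) , straight , b , down
δL (r , j , lane i 1F k) b = (r , j , lane i 2F k) , straight , k , down
δL (r , j , lane i 2F k) b = (r , j , lane i 3F k) , straight , not k , up
δL (r , j , lane 4F 3F k) b = rounded r j k , quarterly , b , left
δL (r , j , lane i 3F k) b = (r , j , lane i 4F k) , straight , b , up
δL (r , j , lane i 4F k) b = (r , j , lane (advance i) 0F (not k)) , straight , b , right
δL (r , j , done) b = (r , j , done) , straight , b , up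

finite-Errand : Finite Errand
finite-Errand = finite-retract (finite-Fin 3)
  (λ { initially → 0F ; outbound → 1F ; homebound → 2F })
  (λ { 0F → initially ; 1F → outbound ; 2F → homebound })
  (λ { initially → refl ; outbound → refl ; homebound → refl })

finite-Ctrl : Finite Ctrl
finite-Ctrl = finite-retract
  (finite-⊎ B
    (finite-⊎ B
    (finite-⊎ (finite-× finite-Errand (finite-Fin 4))
    (finite-⊎ B
    (finite-⊎ B4
    (finite-⊎ (finite-× B4 B)
    (finite-⊎ (finite-× B4 B2)
    (finite-⊎ (finite-× B (finite-Fin 4))
    (finite-⊎ B
    (finite-⊎ (finite-Fin 1)
    (finite-⊎ (finite-Fin 1)
    (finite-⊎ (finite-Fin 1) (finite-× (finite-Fin 5) (finite-× (finite-Fin 5) B))))))))))))))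
  (λ { (approach r) → inj₁ r
     ; (retreat r) → inj₂ (inj₁ r)
     ; (plant e i) → inj₂ (inj₂ (inj₁ (e , i)))
     ; (depart r) → inj₂ (inj₂ (inj₂ (inj₁ r)))
     ; (low r h p q) → inj₂ (inj₂ (inj₂ (inj₂ (inj₁ ((r , h) , (p , q))))))
     ; (high r h p q l) → inj₂ (inj₂ (inj₂ (inj₂ (inj₂ (inj₁ (((r , h) , (p , q)) , l))))))
     ; (judge r h p q l m) → inj₂ (inj₂ (inj₂ (inj₂ (inj₂ (inj₂ (inj₁ (((r , h) , (p , q)) , (l , m))))))))
     ; (pull r i) → inj₂ (inj₂ (inj₂ (inj₂ (inj₂ (inj₂ (inj₂ (inj₁ (r , i))))))))
     ; (hoist r) → inj₂ (inj₂ (inj₂ (inj₂ (inj₂ (inj₂ (inj₂ (inj₂ (inj₁ r))))))))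
     ; sink → inj₂ (inj₂ (inj₂ (inj₂ (inj₂ (inj₂ (inj₂ (inj₂ (inj₂ (inj₁ 0F)))))))))
     ; enter → inj₂ (inj₂ (inj₂ (inj₂ (inj₂ (inj₂ (inj₂ (inj₂ (inj₂ (inj₂ (inj₁ 0F))))))))))
     ; done → inj₂ (inj₂ (inj₂ (inj₂ (inj₂ (inj₂ (inj₂ (inj₂ (inj₂ (inj₂ (inj₂ (inj₁ 0F)))))))))))
     ; (lane i s k) → inj₂ (inj₂ (inj₂ (inj₂ (inj₂ (inj₂ (inj₂ (inj₂ (inj₂ (inj₂ (inj₂ (inj₂ ((i , s , k))))))))))))) })
  (λ { (inj₁ r) → approach r
     ; (inj₂ (inj₁ r)) → retreat r
     ; (inj₂ (inj₂ (inj₁ (e , i)))) → plant e i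
     ; (inj₂ (inj₂ (inj₂ (inj₁ r)))) → depart r
     ; (inj₂ (inj₂ (inj₂ (inj₂ (inj₁ ((r , h) , (p , q))))))) → low r h p q
     ; (inj₂ (inj₂ (inj₂ (inj₂ (inj₂ (inj₁ (((r , h) , (p , q)) , l))))))) → high r h p q l
     ; (inj₂ (inj₂ (inj₂ (inj₂ (inj₂ (inj₂ (inj₁ (((r , h) , (p , q)) , (l , m))))))))) → judge r h p q l m
     ; (inj₂ (inj₂ (inj₂ (inj₂ (inj₂ (inj₂ (inj₂ (inj₁ (r , i))))))))) → pull r i
     ; (inj₂ (inj₂ (inj₂ (inj₂ (inj₂ (inj₂ (inj₂ (inj₂ (inj₁ r))))))))) → hoist r
     ; (inj₂ (inj₂ (inj₂ (inj₂ (inj₂ (inj₂ (inj₂ (inj₂ (inj₂ (inj₁ 0F)))))))))) → sink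
     ; (inj₂ (inj₂ (inj₂ (inj₂ (inj₂ (inj₂ (inj₂ (inj₂ (inj₂ (inj₂ (inj₁ 0F))))))))))) → enter
     ; (inj₂ (inj₂ (inj₂ (inj₂ (inj₂ (inj₂ (inj₂ (inj₂ (inj₂ (inj₂ (inj₂ (inj₁ 0F)))))))))))) → done
     ; (inj₂ (inj₂ (inj₂ (inj₂ (inj₂ (inj₂ (inj₂ (inj₂ (inj₂ (inj₂ (inj₂ (inj₂ ((i , s , k)))))))))))))) → lane i s k })
  (λ { (approach r) → refl
     ; (retreat r) → refl
     ; (plant e i) → refl
     ; (depart r) → refl
     ; (low r h p q) → refl
     ; (high r h p q l) → refl
     ; (judge r h p q l m) → refl
     ; (pull r i) → refl
     ; (hoist r) → refl
     ; sink → refl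
     ; enter → refl
     ; done → refl
     ; (lane i s k) → refl })
  where
  B = finite-Bool
  B2 = finite-× B B
  B4 = finite-× B2 B2

State : Set
State = (Dir × Dir) × Local

abstract
  -- Kept abstract because the number of states has no readable normal form; `dec-enc` is all that
  -- the proof uses of the coding.
  finite-State : Finite State
  finite-State = finite-× (finite-× finite-Dir finite-Dir)
    (finite-× (four (four finite-Bool)) (finite-× (finite-Fin 4) finite-Ctrl))
    where
    four : ∀ {A} → Finite A → Finite (Quad A)
    four F = finite-× F (finite-× F (finite-× F F))

halted : Local → Bool
halted (_ , _ , done) = true
halted _ = false

perform : State → Bool → State × Bool × Dir
perform ((f , o) , l) b with δL l b
... | l′ , τ , c , d = (turn τ (f , o) , l′) , c , act f o d

blank : Memory
blank = memory (λ _ _ → false)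

robot : Robot
robot = record
  { n = size finite-State
  ; start = enc finite-State ((right , down) , blank , 0F , approach false)
  ; halting = λ i → halted (proj₂ (dec finite-State i))
  ; δ = λ i b → enc finite-State (proj₁ (perform (dec finite-State i) b)) , proj₂ (perform (dec finite-State i) b)
  }

-- Local views of configurations

set-hit : ∀ g p b → set g p b p ≡ b
set-hit g p b with does (p ≟ₚ p) in e
... | true = refl
... | false with () ← trans (sym (dec-true (p ≟ₚ p) refl)) e

set-miss : ∀ g p b {q} → q ≢ p → set g p b q ≡ g q
set-miss g p b {q} q≢p with does (q ≟ₚ p) in e
... | false = refl
... | true with () ← trans (sym (dec-false (q ≟ₚ p) q≢p)) e

pixel-case : ∀ {A : Set} (q p : Pixel) → (q ≡ p → A) → (q ≢ p → A) → A
pixel-case q p f h with q ≟ₚ p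
... | yes e = f e
... | no ne = h ne

set-keep : ∀ g p q → set g p (g p) q ≡ g q
set-keep g p q = pixel-case q p
  (λ { refl → set-hit g p (g p) }) (λ q≢p → set-miss g p (g p) q≢p)

-- `p` and `g` are in the coordinates of `ψ`, so that a transition can be computed without reference
-- to the place of the frame on the grid.
record View (ψ : Iso) (l : Local) (g : Grid) (p : Pixel) (c : Conf robot) : Set where
  constructor view
  field
    state≡ : Conf.state c ≡ enc finite-State ((fwd ψ , out ψ) , l)
    pos≡   : Conf.pos c ≡ to ψ p
    grid≡  : ∀ q → Conf.grid c (to ψ q) ≡ g q

open View public

set-to : ∀ ψ g g′ p b → (∀ q → g (to ψ q) ≡ g′ q) → ∀ q → set g (to ψ p) b (to ψ q) ≡ set g′ p b q
set-to ψ g g′ p b e q = pixel-case q p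
  (λ { refl → trans (set-hit g (to ψ p) b) (sym (set-hit g′ p b)) })
  (λ q≢p → trans (set-miss g (to ψ p) b (q≢p ∘ to-injective ψ))
             (trans (e q) (sym (set-miss g′ p b q≢p))))

module _ {ψ : Iso} {l : Local} {g : Grid} {p : Pixel} {c : Conf robot} {l′ : Local} {τ : Turn} {b : Bool} {d : Dir}
  (v : View ψ l g p c) (e : δL l (g p) ≡ (l′ , τ , b , d)) where

  private
    f = fwd ψ
    o = out ψ

    eq : Robot.δ robot (Conf.state c) (Conf.grid c (Conf.pos c)) ≡
         (enc finite-State (turn τ (f , o) , l′) , b , act f o d)
    eq rewrite state≡ v | pos≡ v | grid≡ v p | dec-enc finite-State ((f , o) , l)
             | e = refl

    step-eq : step robot c ≡ conf (enc finite-State (turn τ (f , o) , l′))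
                               (set (Conf.grid c) (Conf.pos c) b) (move (act f o d) (Conf.pos c))
    step-eq = cong (λ (q , w , d) → conf q (set (Conf.grid c) (Conf.pos c) w) (move d (Conf.pos c))) eq

  step-grid : ∀ q → Conf.grid (step robot c) (to ψ q) ≡ set g p b q
  step-grid q = trans (cong (λ c′ → Conf.grid c′ (to ψ q)) step-eq)
    (trans (cong (λ r → set (Conf.grid c) r b (to ψ q)) (pos≡ v)) (set-to ψ (Conf.grid c) g p b (grid≡ v) q))

  step-pos : Conf.pos (step robot c) ≡ to ψ (move d p)
  step-pos = trans (cong Conf.pos step-eq) (trans (cong (move (act f o d)) (pos≡ v)) (sym (to-move ψ d p)))

  step-state : Conf.state (step robot c) ≡ enc finite-State (turn τ (f , o) , l′)
  step-state = cong Conf.state step-eq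

view-step : ∀ {ψ l g p c l′ b d} → View ψ l g p c → δL l (g p) ≡ (l′ , straight , b , d) →
            View ψ l′ (set g p b) (move d p) (step robot c)
view-step v e = view (step-state v e) (step-pos v e) (step-grid v e)

-- Quantifying over `f` and `o` makes this applicable in every frame `ψ` in which the turn takes
-- place, with `ψ ∘ᵢ κ` as the new frame.
Turns : Turn → Iso → Set
Turns τ κ = ∀ f o → turn τ (f , o) ≡ (act f o (fwd κ) , act f o (out κ))

view-turn : ∀ {ψ l g p c l′ τ b d} (κ : Iso) (p′ : Pixel) → Turns τ κ → move d p ≡ to κ p′ →
            View ψ l g p c → δL l (g p) ≡ (l′ , τ , b , d) →
            View (ψ ∘ᵢ κ) l′ (set g p b ∘ to κ) p′ (step robot c)
view-turn {ψ} κ p′ t m v e = view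
  (trans (step-state v e) (cong (λ fo → enc finite-State (fo , _)) (t (fwd ψ) (out ψ))))
  (trans (step-pos v e) (cong (to ψ) m))
  (λ q → step-grid v e (to κ q))

-- Corner markers

Cells : Set
Cells = Ix → Ix → Pixel

-- dn tells which marker cells are in place; r keeps the tiles of h that they hide.
record Marked (C : Cells) (dn : Memory) (g h : Grid) (r : Memory) : Set where
  field
    marks : ∀ i j → recall dn i j ≡ true → g (C i j) ≡ mark i j
    saved : ∀ i j → recall dn i j ≡ true → recall r i j ≡ h (C i j)
    rest  : ∀ q → (∀ i j → recall dn i j ≡ true → q ≢ C i j) → g q ≡ h q

open Marked public

InjectiveCells : Cells → Set
InjectiveCells C = ∀ i j i′ j′ → C i j ≡ C i′ j′ → (i , j) ≡ (i′ , j′)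

_≟ᵢᵢ_ : (p q : Ix × Ix) → Dec (p ≡ q)
(i , j) ≟ᵢᵢ (i′ , j′) with i ≟ᵢ i′ | j ≟ᵢ j′
... | yes refl | yes refl = yes refl
... | no ne | _ = no λ { refl → ne refl }
... | yes _ | no ne = no λ { refl → ne refl }

ix-case : ∀ {A : Set} (p q : Ix × Ix) → (p ≡ q → A) → (p ≢ q → A) → A
ix-case p q f h with p ≟ᵢᵢ q
... | yes e = f e
... | no ne = h ne

marked-regrid : ∀ {C dn g g′ h r} → (∀ q → g q ≡ g′ q) → Marked C dn g h r → Marked C dn g′ h r
marked-regrid e M = record
  { marks = λ i j d → trans (sym (e _)) (marks M i j d)
  ; saved = saved M
  ; rest = λ q f → trans (sym (e q)) (rest M q f)
  }

module _ {C : Cells} {dn : Memory} {g h : Grid} {r : Memory} (inj : InjectiveCells C) (M : Marked C dn g h r) (i j : Ix) where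

  private
    old : ∀ {v b i′ j′} → (i′ , j′) ≢ (i , j) →
          recall (put i j v dn) i′ j′ ≡ true → recall dn i′ j′ ≡ true × set g (C i j) b (C i′ j′) ≡ g (C i′ j′)
    old {v} {b} {i′} {j′} ne d =
      trans (sym (recall-put-other i j v dn i′ j′ ne)) d ,
      set-miss g (C i j) b (λ e → ne (inj i′ j′ i j e))

  -- By injectivity the cell coincides with no cell already in place, so the tile read there is the
  -- original one and is the right value to save.
  marked-plant : recall dn i j ≡ false →
    Marked C (put i j true dn) (set g (C i j) (mark i j)) h (put i j (g (C i j)) r)
  marked-plant d₀ = record
    { marks = λ i′ j′ d → ix-case (i′ , j′) (i , j)
        (λ { refl → set-hit g (C i j) (mark i j) })
        (λ ne → trans (proj₂ (old ne d)) (marks M i′ j′ (proj₁ (old {b = true} ne d))))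
    ; saved = λ i′ j′ d → ix-case (i′ , j′) (i , j)
        (λ { refl → trans (recall-put i j (g (C i j)) r) (rest M (C i j) fresh) })
        (λ ne → trans (recall-put-other i j (g (C i j)) r i′ j′ ne) (saved M i′ j′ (proj₁ (old {b = true} ne d))))
    ; rest = λ q f →
        trans (set-miss g (C i j) (mark i j) (f i j (recall-put i j true dn)))
          (rest M q (λ i′ j′ d → ix-case (i′ , j′) (i , j)
            (λ { refl → f i j (recall-put i j true dn) })
            (λ ne → f i′ j′ (trans (recall-put-other i j true dn i′ j′ ne) d))))
    }
    where
    fresh : ∀ i′ j′ → recall dn i′ j′ ≡ true → C i j ≢ C i′ j′
    fresh i′ j′ d e with refl ← inj i j i′ j′ e with () ← trans (sym d₀) d

  marked-pull : recall dn i j ≡ true →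
    Marked C (put i j false dn) (set g (C i j) (recall r i j)) h r
  marked-pull d₀ = record
    { marks = λ i′ j′ d → ix-case (i′ , j′) (i , j)
        (λ { refl → gone d })
        (λ ne → trans (proj₂ (old ne d)) (marks M i′ j′ (proj₁ (old {b = true} ne d))))
    ; saved = λ i′ j′ d → ix-case (i′ , j′) (i , j)
        (λ { refl → gone d })
        (λ ne → saved M i′ j′ (proj₁ (old {b = true} ne d)))
    ; rest = λ q f → pixel-case q (C i j)
        (λ { refl → trans (set-hit g (C i j) (recall r i j)) (saved M i j d₀) })
        (λ ne → trans (set-miss g (C i j) (recall r i j) ne)
          (rest M q (λ i′ j′ d → ix-case (i′ , j′) (i , j)
            (λ { refl → ne })
            (λ ne′ → f i′ j′ (trans (recall-put-other i j false dn i′ j′ ne′) d)))))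
    }
    where
    gone : ∀ {A : Set} → recall (put i j false dn) i j ≡ true → A
    gone d with () ← trans (sym (recall-put i j false dn)) d

-- Only cells in place are constrained; cells that have been lifted may be renamed at will. This is
-- how a corner passes from its old row to the next.
marked-relocate : ∀ {C C′ dn g h r} → (∀ i j → recall dn i j ≡ true → C i j ≡ C′ i j) →
                  Marked C dn g h r → Marked C′ dn g h r
marked-relocate {g = g} {h} e M = record
  { marks = λ i j d → trans (cong g (sym (e i j d))) (marks M i j d)
  ; saved = λ i j d → trans (saved M i j d) (cong h (e i j d))
  ; rest = λ q f → rest M q (λ i j d qC → f i j d (trans qC (e i j d)))
  }

-- `s` is the permutation of the marker cells caused by the change of frame. The memory is permuted
-- along with it, because its entries are addressed by local cells. The pattern must be invariant
-- under `s`, hence the symmetries of `mark`.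
marked-transport : ∀ (κ : Iso) (s s⁻ : Ix → Ix → Ix × Ix) {C C′ dn g h r} →
  let open Data.Product using (uncurry) in
  (∀ i j → uncurry s⁻ (s i j) ≡ (i , j)) →
  (∀ i j → uncurry s (s⁻ i j) ≡ (i , j)) →
  (∀ i j → uncurry mark (s i j) ≡ mark i j) →
  (∀ i j → to κ (C′ i j) ≡ uncurry C (s i j)) →
  Marked C dn g h r →
  Marked C′ (memory (λ i j → uncurry (recall dn) (s i j))) (g ∘ to κ) (h ∘ to κ)
    (memory (λ i j → uncurry (recall r) (s i j)))
marked-transport κ s s⁻ {C} {C′} {dn} {g} {h} {r} s⁻s ss⁻ ms e M = record
  { marks = λ i j d → trans (cong g (e i j)) (trans (marks M _ _ (dn′ i j d)) (ms i j))
  ; saved = λ i j d → trans (recall-memory (λ i j → recall r (proj₁ (s i j)) (proj₂ (s i j))) i j) (trans (saved M _ _ (dn′ i j d)) (cong h (sym (e i j))))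
  ; rest = λ q f → rest M (to κ q) λ i j d qC →
      f (proj₁ (s⁻ i j)) (proj₂ (s⁻ i j))
        (trans (recall-memory (λ i j → recall dn (proj₁ (s i j)) (proj₂ (s i j))) (proj₁ (s⁻ i j)) (proj₂ (s⁻ i j)))
          (trans (cong (λ (a , b) → recall dn a b) (ss⁻ i j)) d))
        (to-injective κ (trans qC
          (sym (trans (e (proj₁ (s⁻ i j)) (proj₂ (s⁻ i j))) (cong (λ (a , b) → C a b) (ss⁻ i j))))))
  }
  where
  dn′ : ∀ i j → recall (memory (λ i j → recall dn (proj₁ (s i j)) (proj₂ (s i j)))) i j ≡ true →
        recall dn (proj₁ (s i j)) (proj₂ (s i j)) ≡ true
  dn′ i j d = trans (sym (recall-memory (λ i j → recall dn (proj₁ (s i j)) (proj₂ (s i j))) i j)) d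

-- Around an n × m rectangle [-n,-1] × [1,m]; a and b tell whether the two outer (low y) corners
-- have already been moved one row outwards.

abscissa : ℕ → Ix → ℤ
abscissa n lf = -[1+ suc n ]
abscissa n ln = -[1+ n ]
abscissa n hn = + 0
abscissa n hf = + 1

ordinate : ℕ → Bool → Ix → ℤ
ordinate m false lf = -[1+ 0 ]
ordinate m false ln = + 0
ordinate m true lf = -[1+ 1 ]
ordinate m true ln = -[1+ 0 ]
ordinate m _ hn = + suc m
ordinate m _ hf = + suc (suc m)

side : Bool → Bool → Ix → Bool
side a b lf = a
side a b ln = a
side a b hn = b
side a b hf = b

side-same : ∀ a i → side a a i ≡ a
side-same a lf = refl
side-same a ln = refl
side-same a hn = refl
side-same a hf = refl

cells : ℕ → ℕ → Bool → Bool → Cells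
cells n m a b i j = abscissa n i , ordinate m (side a b i) j

abscissa-injective : ∀ n i j → abscissa n i ≡ abscissa n j → i ≡ j
abscissa-injective n lf lf e = refl
abscissa-injective n ln ln e = refl
abscissa-injective n hn hn e = refl
abscissa-injective n hf hf e = refl
abscissa-injective n lf ln e = ⊥-elim (ℕP.1+n≢n (ℤP.-[1+-injective e))
abscissa-injective n ln lf e = ⊥-elim (ℕP.1+n≢n (sym (ℤP.-[1+-injective e)))

ordinate-injective : ∀ m a i j → ordinate m a i ≡ ordinate m a j → i ≡ j
ordinate-injective m false lf lf e = refl
ordinate-injective m true lf lf e = refl
ordinate-injective m false ln ln e = refl
ordinate-injective m true ln ln e = refl
ordinate-injective m false hn hn e = refl
ordinate-injective m true hn hn e = refl
ordinate-injective m false hf hf e = refl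
ordinate-injective m true hf hf e = refl
ordinate-injective m false hn hf e = ⊥-elim (ℕP.1+n≢n (sym (ℤP.+-injective e)))
ordinate-injective m true hn hf e = ⊥-elim (ℕP.1+n≢n (sym (ℤP.+-injective e)))
ordinate-injective m false hf hn e = ⊥-elim (ℕP.1+n≢n (ℤP.+-injective e))
ordinate-injective m true hf hn e = ⊥-elim (ℕP.1+n≢n (ℤP.+-injective e))

cells-injective : ∀ n m a b → InjectiveCells (cells n m a b)
cells-injective n m a b i j i′ j′ e with refl ← abscissa-injective n i i′ (cong proj₁ e) =
  cong (i ,_) (ordinate-injective m (side a b i) j j′ (cong proj₂ e))

full : Memory
full = memory (λ _ _ → true)

full-true : ∀ i j → recall full i j ≡ true
full-true = recall-memory (λ _ _ → true)

mirror-cells : ∀ n m a b i j → to (mirror n) (cells n m a b i j) ≡ cells n m b a (flip i) j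
mirror-cells n m a b i j = cong₂ _,_ (lem i) (cong (λ c → ordinate m c j) (sd i))
  where
  l₁ : ∀ N → ℤ.- (+ 1 ℤ.+ N) ℤ.- (ℤ.- (+ 2 ℤ.+ N)) ≡ + 1
  l₁ = solve-∀
  l₂ : ∀ N → ℤ.- (+ 1 ℤ.+ N) ℤ.- (ℤ.- (+ 1 ℤ.+ N)) ≡ + 0
  l₂ = solve-∀
  l₃ : ∀ N → ℤ.- (+ 1 ℤ.+ N) ℤ.- + 1 ≡ ℤ.- (+ 2 ℤ.+ N)
  l₃ = solve-∀
  lem : ∀ i → -[1+ n ] ℤ.- abscissa n i ≡ abscissa n (flip i)
  lem lf = l₁ (+ n)
  lem ln = l₂ (+ n)
  lem hn = refl
  lem hf = l₃ (+ n)
  sd : ∀ i → side a b i ≡ side b a (flip i)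
  sd lf = refl
  sd ln = refl
  sd hn = refl
  sd hf = refl

quarter-cells : ∀ n m i j → to (quarter m) (cells m n false false i j) ≡ cells n m false false (flip j) i
quarter-cells n m i j = cong₂ _,_ (lx i j) (ly i j)
  where
  l₁ : ∀ N → (+ 1 ℤ.+ N) ℤ.+ (ℤ.- (+ 2 ℤ.+ N)) ≡ ℤ.- (+ 1)
  l₁ = solve-∀
  l₂ : ∀ N → (+ 1 ℤ.+ N) ℤ.+ (ℤ.- (+ 1 ℤ.+ N)) ≡ + 0
  l₂ = solve-∀
  l₃ : ∀ N → (+ 1 ℤ.+ N) ℤ.+ + 0 ≡ + 1 ℤ.+ N
  l₃ = solve-∀
  l₄ : ∀ N → (+ 1 ℤ.+ N) ℤ.+ + 1 ≡ + 2 ℤ.+ N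
  l₄ = solve-∀
  lx′ : ∀ j → ℤ.- ordinate n false j ≡ abscissa n (flip j)
  lx′ lf = refl
  lx′ ln = refl
  lx′ hn = refl
  lx′ hf = refl
  lx : ∀ i j → ℤ.- ordinate n (side false false i) j ≡ abscissa n (flip j)
  lx i j = trans (cong (λ c → ℤ.- ordinate n c j) (side-same false i)) (lx′ j)
  ly′ : ∀ i → + suc m ℤ.+ abscissa m i ≡ ordinate m false i
  ly′ lf = l₁ (+ m)
  ly′ ln = l₂ (+ m)
  ly′ hn = l₃ (+ m)
  ly′ hf = l₄ (+ m)
  ly : ∀ i j → + suc m ℤ.+ abscissa m i ≡ ordinate m (side false false (flip j)) i
  ly i j = trans (ly′ i) (cong (λ c → ordinate m c i) (sym (side-same false (flip j))))

-- Markers moved out at both corners are the unmoved markers of a rectangle with one more row, once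
-- the origin follows its corner outwards.
raise-cells : ∀ n m i j → to (translate (+ 0) -[1+ 0 ]) (cells n (suc m) false false i j) ≡ cells n m true true i j
raise-cells n m i j = cong₂ _,_ (ℤP.+-identityˡ _) (ly i j)
  where
  ly′ : ∀ j → -[1+ 0 ] ℤ.+ ordinate (suc m) false j ≡ ordinate m true j
  ly′ lf = refl
  ly′ ln = refl
  ly′ hn = refl
  ly′ hf = refl
  ly : ∀ i j → -[1+ 0 ] ℤ.+ ordinate (suc m) (side false false i) j ≡ ordinate m (side true true i) j
  ly i j = trans (cong (λ c → -[1+ 0 ] ℤ.+ ordinate (suc m) c j) (side-same false i))
    (trans (ly′ j) (cong (λ c → ordinate m c j) (sym (side-same true i))))

flip-flip : ∀ i → flip (flip i) ≡ i
flip-flip lf = refl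
flip-flip ln = refl
flip-flip hn = refl
flip-flip hf = refl

near-flip : ∀ i → near (flip i) ≡ near i
near-flip lf = refl
near-flip ln = refl
near-flip hn = refl
near-flip hf = refl

mark-sym : ∀ i j → mark i j ≡ mark j i
mark-sym i j with near i | near j
... | true | true = refl
... | true | false = refl
... | false | true = refl
... | false | false = refl

mark-flip : ∀ i j → mark (flip i) j ≡ mark i j
mark-flip i j = cong (λ b → if b then near j else not (near j)) (near-flip i)

marked-mirror : ∀ {n m a b dn g h r} → Marked (cells n m a b) dn g h r →
  Marked (cells n m b a) (mirrored dn) (g ∘ to (mirror n)) (h ∘ to (mirror n)) (mirrored r)
marked-mirror {n} {m} {a} {b} = marked-transport (mirror n) (λ i j → flip i , j) (λ i j → flip i , j)
  (λ i j → cong (_, j) (flip-flip i)) (λ i j → cong (_, j) (flip-flip i)) mark-flip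
  (mirror-cells n m b a)

marked-quarter : ∀ {n m dn g h r} → Marked (cells n m false false) dn g h r →
  Marked (cells m n false false) (quartered dn) (g ∘ to (quarter m)) (h ∘ to (quarter m)) (quartered r)
marked-quarter {n} {m} = marked-transport (quarter m) (λ i j → flip j , i) (λ i j → j , flip i)
  (λ i j → cong (i ,_) (flip-flip j)) (λ i j → cong (_, j) (flip-flip i))
  (λ i j → trans (mark-flip j i) (mark-sym j i))
  (quarter-cells n m)

marked-raise : ∀ {n m g h r} → Marked (cells n m true true) full g h r →
  Marked (cells n (suc m) false false) full (g ∘ to (translate (+ 0) -[1+ 0 ]))
    (h ∘ to (translate (+ 0) -[1+ 0 ])) r
marked-raise {n} {m} M = marked-transport (translate (+ 0) -[1+ 0 ]) _,_ _,_
  (λ _ _ → refl) (λ _ _ → refl) (λ _ _ → refl) (raise-cells n m) M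

indices : List Ix
indices = lf ∷ ln ∷ hn ∷ hf ∷ []

∈-indices : ∀ i → i ∈ indices
∈-indices lf = here refl
∈-indices ln = there (here refl)
∈-indices hn = there (there (here refl))
∈-indices hf = there (there (there (here refl)))

cellList : Cells → List Pixel
cellList C = cartesianProductWith C indices indices

∈-cellList : ∀ C i j → C i j ∈ cellList C
∈-cellList C i j = ∈-cartesianProductWith⁺ C (∈-indices i) (∈-indices j)

marked-tiles : ∀ {C dn g h r} → Marked C dn g h r → ∀ q → g q ≡ true → h q ≡ true ⊎ q ∈ cellList C
marked-tiles {C} M q e with q ∈? cellList C
... | yes q∈ = inj₂ q∈
... | no q∉ = inj₁ (trans (sym (rest M q (λ { i j _ refl → q∉ (∈-cellList C i j) }))) e)

gridOf⁺ : ∀ {P q} → q ∈ P → gridOf P q ≡ true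
gridOf⁺ {P} {q} q∈ = dec-true (q ∈? P) q∈

gridOf⁻ : ∀ {P q} → gridOf P q ≡ true → q ∈ P
gridOf⁻ {P} {q} e with q ∈? P
... | yes q∈ = q∈

gridOf-false : ∀ {P q} → q ∉ P → gridOf P q ≡ false
gridOf-false {P} {q} q∉ = dec-false (q ∈? P) q∉

0≤+ : ∀ {i j} → + 0 ℤ.≤ i → + 0 ℤ.≤ j → + 0 ℤ.≤ i ℤ.+ j
0≤+ p q = ℤP.+-mono-≤ p q

0≤diff : ∀ {i j} → i ℤ.≤ j → + 0 ℤ.≤ j ℤ.- i
0≤diff = ℤP.i≤j⇒0≤j-i

apart : ∀ {a b : ℤ} z → a ℤ.- b ≡ z → z ≢ + 0 → a ≢ b
apart {a} z e ne refl = ne (trans (sym e) (ℤP.+-inverseʳ a))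

-- The marker pattern does not occur in a polyomino

CheckerFree : Grid → Set
CheckerFree h = ∀ p → h p ≡ true → h (move right p) ≡ false → h (move down p) ≡ false →
  h (move down (move right p)) ≡ true → ⊥

private
  unmove : ∀ d p → move (opp d) (move d p) ≡ p
  unmove up (x , y) = cong (x ,_) (lem y)
    where lem : ∀ z → z ℤ.+ ℤ.1ℤ ℤ.- ℤ.1ℤ ≡ z
          lem = solve-∀
  unmove down (x , y) = cong (x ,_) (lem y)
    where lem : ∀ z → z ℤ.- ℤ.1ℤ ℤ.+ ℤ.1ℤ ≡ z
          lem = solve-∀
  unmove left (x , y) = cong (_, y) (lem x)
    where lem : ∀ z → z ℤ.- ℤ.1ℤ ℤ.+ ℤ.1ℤ ≡ z
          lem = solve-∀
  unmove right (x , y) = cong (_, y) (lem x)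
    where lem : ∀ z → z ℤ.+ ℤ.1ℤ ℤ.- ℤ.1ℤ ≡ z
          lem = solve-∀

  e₁ : ∀ z → z ℤ.- ℤ.1ℤ ℤ.- (z ℤ.+ ℤ.1ℤ) ≡ -[1+ 1 ]
  e₁ = solve-∀
  e₂ : ∀ z → z ℤ.- ℤ.1ℤ ℤ.- ℤ.1ℤ ℤ.- (z ℤ.+ ℤ.1ℤ) ≡ -[1+ 2 ]
  e₂ = solve-∀
  e₃ : ∀ z → z ℤ.- ℤ.1ℤ ℤ.+ ℤ.1ℤ ℤ.- (z ℤ.+ ℤ.1ℤ) ≡ -[1+ 0 ]
  e₃ = solve-∀
  e₄ : ∀ z → z ℤ.+ ℤ.1ℤ ℤ.+ ℤ.1ℤ ℤ.- (z ℤ.- ℤ.1ℤ) ≡ + 3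
  e₄ = solve-∀
  e₅ : ∀ z → z ℤ.+ ℤ.1ℤ ℤ.- ℤ.1ℤ ℤ.- (z ℤ.- ℤ.1ℤ) ≡ + 1
  e₅ = solve-∀
  e₆ : ∀ z → z ℤ.+ ℤ.1ℤ ℤ.- (z ℤ.- ℤ.1ℤ) ≡ + 2
  e₆ = solve-∀

  no-left : ∀ p e → move e (move left p) ≢ move down (move right p)
  no-left (x , y) up q = apart _ (e₁ x) (λ ()) (cong proj₁ q)
  no-left (x , y) down q = apart _ (e₁ x) (λ ()) (cong proj₁ q)
  no-left (x , y) left q = apart _ (e₂ x) (λ ()) (cong proj₁ q)
  no-left (x , y) right q = apart _ (e₃ x) (λ ()) (cong proj₁ q)

  no-up : ∀ p e → move e (move up p) ≢ move down (move right p)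
  no-up (x , y) up q = apart _ (e₄ y) (λ ()) (cong proj₂ q)
  no-up (x , y) down q = apart _ (e₅ y) (λ ()) (cong proj₂ q)
  no-up (x , y) left q = apart _ (e₆ y) (λ ()) (cong proj₂ q)
  no-up (x , y) right q = apart _ (e₆ y) (λ ()) (cong proj₂ q)

move-opp : ∀ {d p q} → q ≡ move d p → p ≡ move (opp d) q
move-opp {d} {p} refl = sym (unmove d p)

-- The condition gives a tile adjacent to both ends of the diagonal. Among the neighbours of `p` it
-- cannot be the right or lower one, which are empty, nor the left or upper one, which are not
-- adjacent to the opposite cell.
checkerFree : ∀ {P} → DiagCondition P → ∀ ψ → CheckerFree (gridOf P ∘ to ψ)
checkerFree {P} dc ψ p e₀₀ e₁₀ e₀₁ e₁₁ with dc (gridOf⁻ e₀₀) (gridOf⁻ e₁₁)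
  (diagPair-to ψ {p} (right , down , hr , vd , refl))
... | r , r∈P , (d , dr) , (e , er) = go (opp d′) r′≡ er′
  where
  r′ = from ψ r
  d′ = unact ψ d
  e′ = unact ψ e
  r′≡ : r′ ≡ move (opp d′) p
  r′≡ = move-opp (trans (sym (from-to ψ p)) (trans (cong (from ψ) dr) (from-move ψ d r)))
  er′ : move down (move right p) ≡ move e′ r′
  er′ = trans (sym (from-to ψ _)) (trans (cong (from ψ) er) (from-move ψ e r))
  tile : gridOf P (to ψ r′) ≡ true
  tile = trans (cong (gridOf P) (to-from ψ r)) (gridOf⁺ r∈P)
  clash : ∀ {q} → gridOf P (to ψ q) ≡ false → r′ ≡ q → ⊥
  clash f e with () ← trans (sym f) (trans (cong (gridOf P ∘ to ψ) (sym e)) tile)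
  go : ∀ s → r′ ≡ move s p → move down (move right p) ≡ move e′ r′ → ⊥
  go right e _ = clash e₁₀ e
  go down e _ = clash e₀₁ e
  go left e f = no-left p e′ (sym (trans f (cong (move e′) e)))
  go up e f = no-up p e′ (sym (trans f (cong (move e′) e)))

-- Placement of the rectangle inside the bounding rectangle

module Run (P : List Pixel) (x0 x1 y0 y1 : ℤ) (N : ℕ) where

  -- Distance at most `k` from the bounding rectangle in the maximum norm, written with signs of
  -- integers so that changes of coordinates reduce to ring identities.
  Within : ℕ → Pixel → Set
  Within k (x , y) =
    (+ 0 ℤ.≤ x ℤ.- x0 ℤ.+ + k × + 0 ℤ.≤ x1 ℤ.- x ℤ.+ + k) ×
    (+ 0 ℤ.≤ y ℤ.- y0 ℤ.+ + k × + 0 ℤ.≤ y1 ℤ.- y ℤ.+ + k)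

  -- Signed distances to the four sides of the bounding rectangle, named from a local frame.
  record Edges : Set where
    field
      west east north south : Pixel → ℤ
      within⁺ : ∀ k q → + 0 ℤ.≤ west q ℤ.+ + k → + 0 ℤ.≤ east q ℤ.+ + k →
                + 0 ℤ.≤ north q ℤ.+ + k → + 0 ℤ.≤ south q ℤ.+ + k → Within k q
      within⁻ : ∀ k q → Within k q →
                (+ 0 ℤ.≤ west q ℤ.+ + k × + 0 ℤ.≤ east q ℤ.+ + k) ×
                (+ 0 ℤ.≤ north q ℤ.+ + k × + 0 ℤ.≤ south q ℤ.+ + k)
      touch   : ((∃ λ p → p ∈ P × west p ≡ + 0) × (∃ λ p → p ∈ P × east p ≡ + 0)) ×
                ((∃ λ p → p ∈ P × north p ≡ + 0) × (∃ λ p → p ∈ P × south p ≡ + 0))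

  gapW gapE gapN gapS : ℕ → ℕ → Pixel → ℤ
  gapW n L (x , y) = x ℤ.+ (+ n ℤ.+ + L)
  gapE _ R (x , y) = + R ℤ.- + 1 ℤ.- x
  gapN _ T (x , y) = y ℤ.- + 1 ℤ.+ + T
  gapS m B (x , y) = + m ℤ.+ + B ℤ.- y

  -- `L`, `R`, `T`, `B` are the numbers of columns and rows missing on the four sides, `T` on the
  -- inspected one. Being natural numbers, they also confine the rectangle to the bounding
  -- rectangle.
  record Placed (φ : Pixel → Pixel) (n m L R T B : ℕ) : Set where
    field
      edges  : Edges
    open Edges edges public
    field
      west≡  : ∀ q → west (φ q) ≡ gapW n L q
      east≡  : ∀ q → east (φ q) ≡ gapE n R q
      north≡ : ∀ q → north (φ q) ≡ gapN m T q
      south≡ : ∀ q → south (φ q) ≡ gapS m B q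

  quarter-west : ∀ n m L q → gapW n L (to (quarter m) q) ≡ gapS n L q
  quarter-west n m L (x , y) = lem y (+ n) (+ L)
    where lem : ∀ Y N L → ℤ.- Y ℤ.+ (N ℤ.+ L) ≡ N ℤ.+ L ℤ.- Y
          lem = solve-∀
  quarter-east : ∀ n m R q → gapE n R (to (quarter m) q) ≡ gapN n R q
  quarter-east n m R (x , y) = lem y (+ R)
    where lem : ∀ Y R → R ℤ.- + 1 ℤ.- (ℤ.- Y) ≡ Y ℤ.- + 1 ℤ.+ R
          lem = solve-∀
  quarter-north : ∀ m T q → gapN m T (to (quarter m) q) ≡ gapW m T q
  quarter-north m T (x , y) = lem x (+ m) (+ T)
    where lem : ∀ X M T → + 1 ℤ.+ M ℤ.+ X ℤ.- + 1 ℤ.+ T ≡ X ℤ.+ (M ℤ.+ T)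
          lem = solve-∀
  quarter-south : ∀ m B q → gapS m B (to (quarter m) q) ≡ gapE m B q
  quarter-south m B (x , y) = lem x (+ m) (+ B)
    where lem : ∀ X M B → M ℤ.+ B ℤ.- (+ 1 ℤ.+ M ℤ.+ X) ≡ B ℤ.- + 1 ℤ.- X
          lem = solve-∀

  placed-quarter : ∀ {φ n m L R T B} → Placed φ n m L R T B → Placed (φ ∘ to (quarter m)) m n T B R L
  placed-quarter {n = n} {m} {L} {R} {T} {B} pl = record
    { edges = record
      { west = north ; east = south ; north = east ; south = west
      ; within⁺ = λ k q w e n s → within⁺ k q s n w e
      ; within⁻ = λ k q h → let ((w , e) , (n , s)) = within⁻ k q h in (n , s) , (e , w)
      ; touch = let ((w , e) , (n , s)) = touch in (n , s) , (e , w) }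
    ; west≡ = λ q → trans (north≡ _) (quarter-north m T q)
    ; east≡ = λ q → trans (south≡ _) (quarter-south m B q)
    ; north≡ = λ q → trans (east≡ _) (quarter-east n m R q)
    ; south≡ = λ q → trans (west≡ _) (quarter-west n m L q)
    }
    where open Placed pl

  placed-mirror : ∀ {φ n m L R T B} → Placed φ n m L R T B → Placed (φ ∘ to (mirror n)) n m R L T B
  placed-mirror {n = n} {m} {L} {R} {T} {B} pl = record
    { edges = record
      { west = east ; east = west ; north = north ; south = south
      ; within⁺ = λ k q w e n s → within⁺ k q e w n s
      ; within⁻ = λ k q h → let ((w , e) , (n , s)) = within⁻ k q h in (e , w) , (n , s)
      ; touch = let ((w , e) , (n , s)) = touch in (e , w) , (n , s) }
    ; west≡ = λ { (x , y) → trans (east≡ _) (l₁ x (+ n) (+ R)) }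
    ; east≡ = λ { (x , y) → trans (west≡ _) (l₂ x (+ n) (+ L)) }
    ; north≡ = λ q → north≡ _
    ; south≡ = λ q → south≡ _
    }
    where
    open Placed pl
    l₁ : ∀ X N R → R ℤ.- + 1 ℤ.- (ℤ.- (+ 1 ℤ.+ N) ℤ.- X) ≡ X ℤ.+ (N ℤ.+ R)
    l₁ = solve-∀
    l₂ : ∀ X N L → ℤ.- (+ 1 ℤ.+ N) ℤ.- X ℤ.+ (N ℤ.+ L) ≡ L ℤ.- + 1 ℤ.- X
    l₂ = solve-∀

  placed-raise : ∀ {φ n m L R T B} → Placed φ n m L R (suc T) B →
    Placed (φ ∘ to (translate (+ 0) -[1+ 0 ])) n (suc m) L R T B
  placed-raise {n = n} {m} {L} {R} {T} {B} pl = record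
    { edges = edges
    ; west≡ = λ { (x , y) → trans (west≡ _) (cong (ℤ._+ (+ n ℤ.+ + L)) (ℤP.+-identityˡ x)) }
    ; east≡ = λ { (x , y) → trans (east≡ _) (cong (λ z → + R ℤ.- + 1 ℤ.- z) (ℤP.+-identityˡ x)) }
    ; north≡ = λ { (x , y) → trans (north≡ _) (l₁ y (+ T)) }
    ; south≡ = λ { (x , y) → trans (south≡ _) (l₂ y (+ m) (+ B)) }
    }
    where
    open Placed pl
    l₁ : ∀ Y T → ℤ.- (+ 1) ℤ.+ Y ℤ.- + 1 ℤ.+ (+ 1 ℤ.+ T) ≡ Y ℤ.- + 1 ℤ.+ T
    l₁ = solve-∀
    l₂ : ∀ Y M B → M ℤ.+ B ℤ.- (ℤ.- (+ 1) ℤ.+ Y) ≡ + 1 ℤ.+ M ℤ.+ B ℤ.- Y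
    l₂ = solve-∀

  -- The origin of the constant 3: moved markers and the outer lane reach row -2, which is three
  -- steps away from row 1 of the rectangle.
  nearby : ∀ {φ n m L R T B} → Placed φ n m L R T B → ∀ {x y} → -[1+ suc n ] ℤ.≤ x → x ℤ.≤ + 1 →
           -[1+ 1 ] ℤ.≤ y → y ℤ.≤ + 1 → Within 3 (φ (x , y))
  nearby {φ} {n} {m} {L} {R} {T} {B} pl {x} {y} a b c d = within⁺ 3 _
    (subst (+ 0 ℤ.≤_) (sym (trans (cong (ℤ._+ + 3) (west≡ _)) (l₁ x (+ n) (+ L))))
      (0≤+ (0≤diff a) (+≤+ z≤n)))
    (subst (+ 0 ℤ.≤_) (sym (trans (cong (ℤ._+ + 3) (east≡ _)) (l₂ x (+ R))))
      (0≤+ (0≤diff b) (+≤+ z≤n)))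
    (subst (+ 0 ℤ.≤_) (sym (trans (cong (ℤ._+ + 3) (north≡ _)) (l₃ y (+ T))))
      (0≤+ (0≤diff c) (+≤+ z≤n)))
    (subst (+ 0 ℤ.≤_) (sym (trans (cong (ℤ._+ + 3) (south≡ _)) (l₄ y (+ m) (+ B))))
      (0≤+ (0≤diff d) (+≤+ z≤n)))
    where
    open Placed pl
    l₁ : ∀ X N L → X ℤ.+ (N ℤ.+ L) ℤ.+ + 3 ≡ (X ℤ.- (ℤ.- (+ 2 ℤ.+ N))) ℤ.+ (+ 1 ℤ.+ L)
    l₁ = solve-∀
    l₂ : ∀ X R → R ℤ.- + 1 ℤ.- X ℤ.+ + 3 ≡ (+ 1 ℤ.- X) ℤ.+ (+ 1 ℤ.+ R)
    l₂ = solve-∀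
    l₃ : ∀ Y T → Y ℤ.- + 1 ℤ.+ T ℤ.+ + 3 ≡ (Y ℤ.- (ℤ.- (+ 2))) ℤ.+ T
    l₃ = solve-∀
    l₄ : ∀ Y M B → M ℤ.+ B ℤ.- Y ℤ.+ + 3 ≡ (+ 1 ℤ.- Y) ℤ.+ (+ 2 ℤ.+ (M ℤ.+ B))
    l₄ = solve-∀

  -- `D` may list more pixels than carry tiles; the marker cells or the whole ring can thus be named
  -- at once, without following which of them are currently set.
  record Ok (c : Conf robot) : Set where
    field
      running : Robot.halting robot (Conf.state c) ≡ false
      inside  : Within 3 (Conf.pos c)
      tiles   : ∃ λ D → length D ≤ N × (∀ q → Conf.grid c q ≡ true → q ∈ P ⊎ q ∈ D)

  -- The index is only an upper bound on the number of steps, because `now` accepts any.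
  data Ev (Φ : Conf robot → Set) : ℕ → Conf robot → Set where
    now   : ∀ {k c} → Φ c → Ev Φ k c
    later : ∀ {k c} → Ok c → Ev Φ k (step robot c) → Ev Φ (suc k) c

  ev-weaken : ∀ {Φ k k′ c} → k ≤ k′ → Ev Φ k c → Ev Φ k′ c
  ev-weaken le (now x) = now x
  ev-weaken (s≤s le) (later o e) = later o (ev-weaken le e)

  ev-bind : ∀ {Φ Ψ k k′ c} → Ev Φ k c → (∀ c → Φ c → Ev Ψ k′ c) → Ev Ψ (k + k′) c
  ev-bind {k = k} {k′} (now x) f = ev-weaken (ℕP.m≤n+m k′ k) (f _ x)
  ev-bind (later o e) f = later o (ev-bind e f)

  view-ok : ∀ {ψ l g p c} → View ψ l g p c → halted l ≡ false → Within 3 (to ψ p) →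
    (D : List Pixel) → length D ≤ N → (∀ q → g q ≡ true → gridOf P (to ψ q) ≡ true ⊎ q ∈ D) → Ok c
  view-ok {ψ} {l} {g} {p} {c} v h w D len f = record
    { running = trans (cong (λ s → halted (proj₂ (dec finite-State s))) (state≡ v))
        (trans (cong (halted ∘ proj₂) (dec-enc finite-State _)) h)
    ; inside = subst (Within 3) (sym (pos≡ v)) w
    ; tiles = map (to ψ) D , subst (ℕ._≤ N) (sym (length-map (to ψ) D)) len , cover
    }
    where
    cover : ∀ q → Conf.grid c q ≡ true → q ∈ P ⊎ q ∈ map (to ψ) D
    cover q e with f (from ψ q) (trans (sym (grid≡ v (from ψ q)))
      (trans (cong (Conf.grid c) (to-from ψ q)) e))
    ... | inj₁ t = inj₁ (subst (_∈ P) (to-from ψ q) (gridOf⁻ t))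
    ... | inj₂ i = inj₂ (subst (_∈ map (to ψ) D) (to-from ψ q) (∈-map⁺ (to ψ) i))

  record Site (ψ : Iso) (C : Cells) (dn r : Memory) (j : Fin 4) (k : Ctrl) (p : Pixel) (c : Conf robot) : Set where
    constructor site
    field
      sees   : View ψ (r , j , k) (Conf.grid c ∘ to ψ) p c
      marked : Marked C dn (Conf.grid c ∘ to ψ) (gridOf P ∘ to ψ) r

  open Site public

  module Growth (16≤N : 16 ≤ N) where

    site-ok : ∀ {ψ C dn r j k p c} → Site ψ C dn r j k p c → halted (r , j , k) ≡ false →
              Within 3 (to ψ p) → Ok c
    site-ok {C = C} s h w = view-ok (sees s) h w (cellList C) 16≤N (marked-tiles (marked s))

    -- One step in continuation form: the next configuration is a bound variable described by its
    -- `Site`, so that the proofs can follow the program line by line without a growing iterate of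
    -- `step`.
    go : ∀ {Φ K ψ C dn r j k p c C′ dn′ r′ j′ k′ b d} →
      Site ψ C dn r j k p c → halted (r , j , k) ≡ false → Within 3 (to ψ p) →
      δL (r , j , k) (Conf.grid c (to ψ p)) ≡ ((r′ , j′ , k′) , straight , b , d) →
      Marked C′ dn′ (set (Conf.grid c ∘ to ψ) p b) (gridOf P ∘ to ψ) r′ →
      (∀ c′ → (∀ q → Conf.grid c′ (to ψ q) ≡ set (Conf.grid c ∘ to ψ) p b q) →
              Site ψ C′ dn′ r′ j′ k′ (move d p) c′ → Ev Φ K c′) →
      Ev Φ (suc K) c
    go s h w e M cont with view-step (sees s) e
    ... | view s′ p′ g′ = later (site-ok s h w)
      (cont _ g′ (site (view s′ p′ (λ q → refl)) (marked-regrid (sym ∘ g′) M)))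

    swing : ∀ {Φ K ψ C dn r j k p c C′ dn′ r′ j′ k′ τ b d} (κ : Iso) (p′ : Pixel) →
      Turns τ κ → move d p ≡ to κ p′ →
      Site ψ C dn r j k p c → halted (r , j , k) ≡ false → Within 3 (to ψ p) →
      δL (r , j , k) (Conf.grid c (to ψ p)) ≡ ((r′ , j′ , k′) , τ , b , d) →
      Marked C′ dn′ (set (Conf.grid c ∘ to ψ) p b ∘ to κ) (gridOf P ∘ to ψ ∘ to κ) r′ →
      (∀ c′ → Site (ψ ∘ᵢ κ) C′ dn′ r′ j′ k′ p′ c′ → Ev Φ K c′) →
      Ev Φ (suc K) c
    swing κ p′ t m s h w e M cont with view-turn κ p′ t m (sees s) e
    ... | view s′ q′ g′ = later (site-ok s h w)
      (cont _ (site (view s′ q′ (λ q → refl)) (marked-regrid (sym ∘ g′) M)))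

    keep : ∀ {ψ C dn r j k p c} → Site ψ C dn r j k p c →
      Marked C dn (set (Conf.grid c ∘ to ψ) p (Conf.grid c (to ψ p))) (gridOf P ∘ to ψ) r
    keep {ψ} {p = p} {c} s = marked-regrid (λ q → sym (set-keep (Conf.grid c ∘ to ψ) p q)) (marked s)

-- The abscissae at which a side is inspected, counted down to the end corner.
column : ℕ → ℤ
column zero = + 0
column (suc i) = -[1+ i ]

column-next : ∀ i → -[1+ i ] ℤ.+ ℤ.1ℤ ≡ column i
column-next zero = refl
column-next (suc i) = refl

-- Walks along a side and the moving of its markers

module Scan (P : List Pixel) (x0 x1 y0 y1 : ℤ) (N : ℕ) (16≤N : 16 ≤ N) (dc : DiagCondition P) where

  open Run P x0 x1 y0 y1 N
  open Growth 16≤N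

  at : ∀ {ψ C dn r j k p p′ c} → p ≡ p′ → Site ψ C dn r j k p c → Site ψ C dn r j k p′ c
  at refl s = s

  nomarker : ∀ pl ph lo hi → (pl ≡ true → ph ≡ false → lo ≡ false → hi ≡ true → ⊥) → marker? pl ph lo hi ≡ false
  nomarker true false false true f = ⊥-elim (f refl refl refl refl)
  nomarker false _ _ _ f = refl
  nomarker true true _ _ f = refl
  nomarker true false true _ f = refl
  nomarker true false false false f = refl

  anyStrip : Grid → ℕ → Bool → Bool
  anyStrip h zero acc = acc
  anyStrip h (suc i) acc = anyStrip h i (acc ∨ h (-[1+ i ] , + 0))

  -- Three steps for each column, three for column 0 and two for the reading of column 1. `K` stands
  -- innermost so that each step peels off one `suc` definitionally.
  walkCost : ℕ → ℕ → ℕ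
  walkCost zero K = 5 + K
  walkCost (suc i) K = 3 + walkCost i K

  module _ {ψ : Iso} {n m : ℕ} {a : Bool} {r : Memory} {j : Fin 4} {L R T B : ℕ} (pl : Placed (to ψ) n m L R T B) where

    private
      h : Grid
      h = gridOf P ∘ to ψ

    -- No marker cell has an abscissa between -n and -1; between the corners the robot therefore
    -- reads the polyomino itself.
    strip-read : ∀ {k p c i y} → Site ψ (cells n m a false) full r j k p c → i < n →
                 Conf.grid c (to ψ (-[1+ i ] , y)) ≡ h (-[1+ i ] , y)
    strip-read {i = i} s i<n = rest (marked s) _ λ i′ j′ _ e → off i′ (cong proj₁ e)
      where
      off : ∀ i′ → -[1+ i ] ≢ abscissa n i′
      off lf e = ℕP.<-irrefl (ℤP.-[1+-injective e) (ℕP.m<n⇒m<1+n i<n)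
      off ln e = ℕP.<-irrefl (ℤP.-[1+-injective e) i<n

    corner-read : ∀ {k p c} i′ j′ → Site ψ (cells n m a false) full r j k p c →
                  Conf.grid c (to ψ (cells n m a false i′ j′)) ≡ mark i′ j′
    corner-read i′ j′ s = marks (marked s) i′ j′ (full-true i′ j′)

    private
      on : ∀ {i y} → i ≤ n → -[1+ 1 ] ℤ.≤ y → y ℤ.≤ + 1 → Within 3 (to ψ (-[1+ i ] , y))
      on i≤n = nearby pl (-≤- (ℕP.m≤n⇒m≤1+n i≤n)) -≤+

      off : ∀ {i y} → i ≤ 1 → -[1+ 1 ] ℤ.≤ y → y ℤ.≤ + 1 → Within 3 (to ψ (+ i , y))
      off i≤1 = nearby pl -≤+ (+≤+ i≤1)

      y₀ : -[1+ 1 ] ℤ.≤ + 0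
      y₀ = -≤+
      y₀′ : + 0 ℤ.≤ + 1
      y₀′ = +≤+ z≤n
      y₁ : -[1+ 1 ] ℤ.≤ -[1+ 0 ]
      y₁ = -≤- z≤n
      y₁′ : -[1+ 0 ] ℤ.≤ + 1
      y₁′ = -≤+

      low→high : ∀ {ret hit pl ph b} v → b ≡ v → δL (r , j , low ret hit pl ph) b ≡
        ((r , j , high ret hit pl ph v) , straight , b , down)
      low→high v refl = refl

      high→judge : ∀ {ret hit pl ph lo b} v → b ≡ v → δL (r , j , high ret hit pl ph lo) b ≡
        ((r , j , judge ret hit pl ph lo v) , straight , b , up)
      high→judge v refl = refl

      judge→low : ∀ {ret hit pl ph lo hi} b → marker? pl ph lo hi ≡ false →
        δL (r , j , judge ret hit pl ph lo hi) b ≡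
        ((r , j , low ret (hit ∨ pl) lo hi) , straight , b , right)
      judge→low {ret} {hit} {pl} {ph} {lo} {hi} b e = cong (λ f → judgement r j ret hit pl lo hi f b) e

    -- There is no false alarm: inside the strip both columns show P, which is free of the pattern,
    -- and in column 0 the near marker cell makes `lo` true. The hypothesis on `pl` and `ph` carries
    -- over what the preceding column contains.
    walkLoop : ∀ {Φ K ret} i {hit pl ph c} → i ≤ n →
      Site ψ (cells n m a false) full r j (low ret hit pl ph) (column i , + 0) c →
      (pl ≡ true → ph ≡ false → h (-[1+ i ] , + 0) ≡ true × h (-[1+ i ] , -[1+ 0 ]) ≡ false) →
      (∀ c′ → Site ψ (cells n m a false) full r j
                (judge ret (anyStrip h i (hit ∨ pl)) true false false true) (+ 1 , + 0) c′ → Ev Φ K c′) →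
      Ev Φ (walkCost i K) c
    walkLoop zero {hit} {pl} {ph} _ s prev cont =
      go s refl (off z≤n y₀ y₀′) (low→high true (corner-read hn ln s)) (keep s) λ _ _ s →
      go s refl (off z≤n y₁ y₁′) (high→judge false (corner-read hn lf s)) (keep s) λ _ _ s →
      go s refl (off z≤n y₀ y₀′) (judge→low {pl = pl} {ph} {true} {false} _ (nomarker pl ph true false λ _ _ ())) (keep s) λ _ _ s →
      go s refl (off (s≤s z≤n) y₀ y₀′) (low→high false (corner-read hf ln s)) (keep s) λ _ _ s →
      go s refl (off (s≤s z≤n) y₁ y₁′) (high→judge true (corner-read hf lf s)) (keep s) λ _ _ s →
      cont _ s
    walkLoop (suc i) {hit} {pl} {ph} i<n s prev cont =
      go s refl (on i≤n y₀ y₀′) (low→high lo (strip-read s i<n)) (keep s) λ _ _ s →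
      go s refl (on i≤n y₁ y₁′) (high→judge hi (strip-read s i<n)) (keep s) λ _ _ s →
      go s refl (on i≤n y₀ y₀′) (judge→low {pl = pl} {ph} {lo} {hi} _ (nomarker pl ph lo hi λ p q u v →
            let (e₁ , e₂) = prev p q in checkerFree dc ψ (-[1+ suc i ] , + 0) e₁ u e₂ v)) (keep s) λ _ _ s →
      walkLoop i i≤n (at (cong (_, + 0) (column-next i)) s) (λ p q → p , q) cont
      where
      i≤n : i ≤ n
      i≤n = ℕP.<⇒≤ i<n
      lo hi : Bool
      lo = h (-[1+ i ] , + 0)
      hi = h (-[1+ i ] , -[1+ 0 ])

    walk : ∀ {Φ K ret c} → Site ψ (cells n m a false) full r j (depart ret) (-[1+ n ] , + 0) c →
      (∀ c′ → Site ψ (cells n m a false) full r j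
                (judge ret (anyStrip h n false) true false false true) (+ 1 , + 0) c′ → Ev Φ K c′) →
      Ev Φ (suc (walkCost n K)) c
    walk s cont = go s refl (on ℕP.≤-refl y₀ y₀′) refl (keep s) λ _ _ s →
      -- `depart` clears `pl`, so the hypothesis about the preceding column, which here holds the
      -- start marker, is vacuous.
      walkLoop n ℕP.≤-refl (at (cong (_, + 0) (column-next n)) s) (λ ()) cont

  endCorner : Bool → Memory → Memory
  endCorner v dn = put hf ln v (put hf lf v (put hn lf v (put hn ln v dn)))

  module _ {ψ : Iso} {n m : ℕ} {a : Bool} {L R T B : ℕ} (pl : Placed (to ψ) n m L R T B) where

    private
      inside₀ : ∀ b {x} → x ≤ 1 → Within 3 (to ψ (+ x , ordinate m b ln))
      inside₀ false le = nearby pl -≤+ (+≤+ le) -≤+ (+≤+ z≤n)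
      inside₀ true le = nearby pl -≤+ (+≤+ le) (-≤- z≤n) -≤+
      inside₂ : ∀ b {x} → x ≤ 1 → Within 3 (to ψ (+ x , ordinate m b lf))
      inside₂ false le = nearby pl -≤+ (+≤+ le) (-≤- z≤n) -≤+
      inside₂ true le = nearby pl -≤+ (+≤+ le) (-≤- ℕP.≤-refl) -≤+
      dn₁ : ∀ b → ordinate m b ln ℤ.- ℤ.1ℤ ≡ ordinate m b lf
      dn₁ false = refl
      dn₁ true = refl
      up₁ : ∀ b → ordinate m b lf ℤ.+ ℤ.1ℤ ≡ ordinate m b ln
      up₁ false = refl
      up₁ true = refl

    -- Stops before the fourth cell, because the transition there already depends on the errand.
    plantCorner : ∀ {Φ K b dn r j e c} →
      Site ψ (cells n m a b) dn r j (plant e 0F) (+ 0 , ordinate m b ln) c →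
      recall dn hn ln ≡ false → recall dn hn lf ≡ false → recall dn hf lf ≡ false →
      (∀ r′ c′ → Site ψ (cells n m a b) (put hf lf true (put hn lf true (put hn ln true dn))) r′ j
         (plant e 3F) (+ 1 , ordinate m b ln) c′ → Ev Φ K c′) →
      Ev Φ (3 + K) c
    plantCorner {b = b} s d₁ d₂ d₃ cont =
      go s refl (inside₀ b z≤n) refl (marked-plant (cells-injective n m a b) (marked s) hn ln d₁) λ _ _ s →
      go (at (cong (+ 0 ,_) (dn₁ b)) s) refl (inside₂ b z≤n) refl
        (marked-plant (cells-injective n m a b) (marked s) hn lf d₂) λ _ _ s →
      go s refl (inside₂ b (s≤s z≤n)) refl
        (marked-plant (cells-injective n m a b) (marked s) hf lf d₃) λ _ _ s →
      cont _ _ (at (cong (+ 1 ,_) (up₁ b)) s)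

    pullCorner : ∀ {Φ K r j ret c} →
      Site ψ (cells n m a false) full r j (pull ret 0F) (+ 0 , + 0) c →
      (∀ c′ → Site ψ (cells n m a true) (endCorner false full) r j
         (plant (errand ret) 0F) (+ 0 , -[1+ 0 ]) c′ → Ev Φ K c′) →
      Ev Φ (5 + K) c
    pullCorner s cont =
      go s refl (inside₀ false z≤n) refl (marked-pull (cells-injective n m a false) (marked s) hn ln refl) λ _ _ s →
      go s refl (inside₂ false z≤n) refl (marked-pull (cells-injective n m a false) (marked s) hn lf refl) λ _ _ s →
      go s refl (inside₂ false (s≤s z≤n)) refl (marked-pull (cells-injective n m a false) (marked s) hf lf refl) λ _ _ s →
      go s refl (inside₀ false (s≤s z≤n)) refl (marked-pull (cells-injective n m a false) (marked s) hf ln refl) λ _ _ s →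
      -- All four cells of this corner are lifted now, so its flag can switch to the outer position
      -- without touching the grid.
      go s refl (inside₀ false z≤n) refl (marked-relocate same (keep s)) λ _ _ s →
      cont _ s
      where
      same : ∀ i j → recall (endCorner false full) i j ≡ true → cells n m a false i j ≡ cells n m a true i j
      same lf j _ = refl
      same ln j _ = refl
      same hn hn _ = refl
      same hn hf _ = refl
      same hf hn _ = refl
      same hf hf _ = refl

  reverse : ∀ {Φ K ψ n m L R T B r j c} → Placed (to ψ) n m L R T B →
    Site ψ (cells n m false false) full r j (pull false 0F) (+ 0 , + 0) c →
    (∀ r′ c′ → Site (ψ ∘ᵢ mirror n) (cells n m true false) full r′ j (depart true) (-[1+ n ] , + 0) c′ → Ev Φ K c′) →
    Ev Φ (10 + K) c
  reverse {n = n} {m} pl s cont =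
    pullCorner pl s λ _ s →
    plantCorner pl s refl refl refl λ _ _ s →
    go s refl (nearby pl -≤+ (+≤+ ℕP.≤-refl) (-≤- z≤n) -≤+) refl
      (marked-plant (cells-injective n m false true) (marked s) hf ln refl) λ _ _ s →
    swing (mirror n) (-[1+ n ] , + 0) (λ f o → refl) (cong (_, + 0) (sym (ℤP.+-inverseʳ -[1+ n ]))) s refl
      (nearby pl -≤+ (+≤+ z≤n) (-≤- z≤n) -≤+) refl (marked-mirror (keep s)) λ _ s →
    cont _ _ s

  -- A translation leaves no trace in the state, so the single turn `back` realises both the
  -- reflection and the outward move of the origin.
  expand : ∀ {Φ K ψ n m L R T B r j c} → Placed (to ψ) n m L R T B →
    Site ψ (cells n m true false) full r j (pull true 0F) (+ 0 , + 0) c →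
    (∀ r′ c′ → Site (ψ ∘ᵢ (mirror n ∘ᵢ translate (+ 0) -[1+ 0 ])) (cells n (suc m) false false) full r′ 0F
       (depart false) (-[1+ n ] , + 0) c′ → Ev Φ K c′) →
    Ev Φ (9 + K) c
  expand {n = n} {m} pl s cont =
    pullCorner pl s λ _ s →
    plantCorner pl s refl refl refl λ _ _ s →
    swing (mirror n ∘ᵢ translate (+ 0) -[1+ 0 ]) (-[1+ n ] , + 0) (λ f o → refl)
      (cong (_, -[1+ 0 ]) (sym (ℤP.+-inverseʳ -[1+ n ]))) s refl
      (nearby pl -≤+ (+≤+ ℕP.≤-refl) (-≤- z≤n) -≤+) refl
      (marked-raise (marked-mirror {a = true} {true}
        (marked-plant (cells-injective n m true true) (marked s) hf ln refl))) λ _ s →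
    cont _ _ s

-- One inspection of a side and its outcome

module Expedition (P : List Pixel) (x0 x1 y0 y1 : ℤ) (N : ℕ) (16≤N : 16 ≤ N) (dc : DiagCondition P)
  (inR : ∀ {q} → q ∈ P → Run.Within P x0 x1 y0 y1 N 0 q) where

  open Run P x0 x1 y0 y1 N
  open Growth 16≤N
  open Scan P x0 x1 y0 y1 N 16≤N dc

  -- The row just outside a side: `a` is the signed distance to that side, and `b`, `c` limit the
  -- row to the length of the side. Corner pixels are left out, which suffices because walks inside
  -- P use edge steps only.
  EmptyBeyond : Grid → (a b c : Pixel → ℤ) → Set
  EmptyBeyond h a b c = ∀ q → a q ≡ -[1+ 0 ] → + 0 ℤ.≤ b q → + 0 ℤ.≤ c q → h q ≡ false

  ClearW ClearE ClearN ClearS : Grid → ℕ → ℕ → Set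
  ClearW h n m = EmptyBeyond h (gapW n 0) (gapN m 0) (gapS m 0)
  ClearE h n m = EmptyBeyond h (gapE n 0) (gapN m 0) (gapS m 0)
  ClearN h n m = EmptyBeyond h (gapN m 0) (gapW n 0) (gapE n 0)
  ClearS h n m = EmptyBeyond h (gapS m 0) (gapW n 0) (gapE n 0)

  -- Turning to the next side renames the inspected side N to W, W to S and S to E.
  Cleared : Grid → ℕ → ℕ → Fin 4 → Set
  Cleared h n m 0F = ⊤
  Cleared h n m 1F = ClearW h n m
  Cleared h n m 2F = ClearW h n m × ClearS h n m
  Cleared h n m 3F = ClearW h n m × ClearS h n m × ClearE h n m

  InQ : ℕ → ℕ → Pixel → Set
  InQ n m q = (+ 0 ℤ.≤ gapW n 0 q × + 0 ℤ.≤ gapE n 0 q) × (+ 0 ℤ.≤ gapN m 0 q × + 0 ℤ.≤ gapS m 0 q)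

  -- A tile inside the rectangle, initially the start pixel, from which connectivity spreads once
  -- all four sides have been found clear.
  Home : (Pixel → Pixel) → ℕ → ℕ → Set
  Home φ n m = ∃ λ q → gridOf P (φ q) ≡ true × InQ n m q

  home-∘ : ∀ {φ n m n′ m′} κ → (∀ q → InQ n m (to κ q) → InQ n′ m′ q) → Home φ n m → Home (φ ∘ to κ) n′ m′
  home-∘ {φ} {n} {m} κ f (q , t , i) = from κ q ,
    trans (cong (gridOf P ∘ φ) (to-from κ q)) t , f (from κ q) (subst (InQ n m) (sym (to-from κ q)) i)

  private
    via : ∀ {a b} → a ≡ b → + 0 ℤ.≤ a → + 0 ℤ.≤ b
    via refl p = p

  inQ-quarter : ∀ {n m} q → InQ n m (to (quarter m) q) → InQ m n q
  inQ-quarter {n} {m} q ((w , e) , (u , s)) =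
    (via (quarter-north m 0 q) u , via (quarter-south m 0 q) s) ,
    (via (quarter-east n m 0 q) e , via (quarter-west n m 0 q) w)

  inQ-mirror : ∀ {n m} q → InQ n m (to (mirror n) q) → InQ n m q
  inQ-mirror {n} (x , y) ((w , e) , (u , s)) = (via (l₁ x (+ n)) e , via (l₂ x (+ n)) w) , (u , s)
    where
    l₁ : ∀ X N → + 0 ℤ.- + 1 ℤ.- (ℤ.- (+ 1 ℤ.+ N) ℤ.- X) ≡ X ℤ.+ (N ℤ.+ + 0)
    l₁ = solve-∀
    l₂ : ∀ X N → ℤ.- (+ 1 ℤ.+ N) ℤ.- X ℤ.+ (N ℤ.+ + 0) ≡ + 0 ℤ.- + 1 ℤ.- X
    l₂ = solve-∀

  inQ-raise : ∀ {n m} q → InQ n m (to (translate (+ 0) -[1+ 0 ]) q) → InQ n (suc m) q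
  inQ-raise {n} {m} (x , y) ((w , e) , (u , s)) =
    (via (cong (ℤ._+ (+ n ℤ.+ + 0)) (ℤP.+-identityˡ x)) w ,
     via (cong (λ z → + 0 ℤ.- + 1 ℤ.- z) (ℤP.+-identityˡ x)) e) ,
    (via (l₁ y) (0≤+ u (+≤+ z≤n)) , via (l₂ y (+ m)) s)
    where
    l₁ : ∀ Y → ℤ.- (+ 1) ℤ.+ Y ℤ.- + 1 ℤ.+ + 0 ℤ.+ + 1 ≡ Y ℤ.- + 1 ℤ.+ + 0
    l₁ = solve-∀
    l₂ : ∀ Y M → M ℤ.+ + 0 ℤ.- (ℤ.- (+ 1) ℤ.+ Y) ≡ + 1 ℤ.+ M ℤ.+ + 0 ℤ.- Y
    l₂ = solve-∀

  module _ {h : Grid} {n m : ℕ} where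

    quarter-clearN : ClearN h n m → ClearW (h ∘ to (quarter m)) m n
    quarter-clearN f q a b c = f (to (quarter m) q) (trans (quarter-north m 0 q) a)
      (via (sym (quarter-west n m 0 q)) c) (via (sym (quarter-east n m 0 q)) b)

    quarter-clearW : ClearW h n m → ClearS (h ∘ to (quarter m)) m n
    quarter-clearW f q a b c = f (to (quarter m) q) (trans (quarter-west n m 0 q) a)
      (via (sym (quarter-north m 0 q)) b) (via (sym (quarter-south m 0 q)) c)

    quarter-clearS : ClearS h n m → ClearE (h ∘ to (quarter m)) m n
    quarter-clearS f q a b c = f (to (quarter m) q) (trans (quarter-south m 0 q) a)
      (via (sym (quarter-west n m 0 q)) c) (via (sym (quarter-east n m 0 q)) b)

    quarter-clearE : ClearE h n m → ClearN (h ∘ to (quarter m)) m n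
    quarter-clearE f q a b c = f (to (quarter m) q) (trans (quarter-east n m 0 q) a)
      (via (sym (quarter-north m 0 q)) b) (via (sym (quarter-south m 0 q)) c)

  anyStrip-true : ∀ h i acc → anyStrip h i acc ≡ true →
    acc ≡ true ⊎ ∃ λ k → k < i × h (-[1+ k ] , + 0) ≡ true
  anyStrip-true h zero acc e = inj₁ e
  anyStrip-true h (suc i) acc e with anyStrip-true h i _ e
  ... | inj₂ (k , k<i , t) = inj₂ (k , ℕP.m<n⇒m<1+n k<i , t)
  ... | inj₁ o with acc
  ...   | true = inj₁ refl
  ...   | false = inj₂ (i , ℕP.≤-refl , o)

  anyStrip-false : ∀ h i acc → anyStrip h i acc ≡ false →
    acc ≡ false × (∀ k → k < i → h (-[1+ k ] , + 0) ≡ false)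
  anyStrip-false h zero acc e = e , λ _ ()
  anyStrip-false h (suc i) acc e with anyStrip-false h i _ e
  anyStrip-false h (suc i) false e | o , f = refl , λ k k<1+i → split k (ℕP.m<1+n⇒m<n∨m≡n k<1+i)
    where
    split : ∀ k → k < i ⊎ k ≡ i → h (-[1+ k ] , + 0) ≡ false
    split k (inj₁ k<i) = f k k<i
    split k (inj₂ refl) = o

  strip-clearN : ∀ {h n m} → (∀ k → k < n → h (-[1+ k ] , + 0) ≡ false) → ClearN h n m
  strip-clearN {h} {n} f (x , y) a b c with y≡0
    where
    l : ∀ Y → Y ≡ Y ℤ.- + 1 ℤ.+ + 0 ℤ.+ + 1
    l = solve-∀
    y≡0 : y ≡ + 0
    y≡0 = trans (l y) (cong (ℤ._+ + 1) a)
  strip-clearN {h} {n} f (+ zero , y) a b () | _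
  strip-clearN {h} {n} f (+ suc x , y) a b () | _
  strip-clearN {h} {n} f (-[1+ i ] , y) a b c | refl = f i (ℤP.drop‿+≤+ (via′ b))
    where
    l : ∀ X N → ℤ.- X ℤ.+ (N ℤ.+ + 0) ≡ N ℤ.- X
    l = solve-∀
    via′ : + 0 ℤ.≤ -[1+ i ] ℤ.+ (+ n ℤ.+ + 0) → + suc i ℤ.≤ + n
    via′ p = ℤP.0≤i-j⇒j≤i (via (l (+ suc i) (+ n)) p)

  Solid : Set
  Solid = ∀ q → Within 0 q → q ∈ P

  record Stage (n m L R T B : ℕ) (j : Fin 4) (c : Conf robot) : Set where
    constructor stage
    field
      {ψ}     : Iso
      {r}     : Memory
      stand   : Site ψ (cells n m false false) full r j (depart false) (-[1+ n ] , + 0) c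
      placed  : Placed (to ψ) n m L R T B
      home    : Home (to ψ) n m
      proper  : 1 ≤ n × 1 ≤ m
      cleared : Cleared (gridOf P ∘ to ψ) n m j

  record Finished (n m L R T B : ℕ) (c : Conf robot) : Set where
    constructor finished
    field
      {ψ}    : Iso
      {r}    : Memory
      stand  : Site ψ (cells n m false false) full r 0F enter (-[1+ n ] , + 0) c
      placed : Placed (to ψ) n m L R T B
      home   : Home (to ψ) n m
      clear  : (ClearW (gridOf P ∘ to ψ) n m × ClearE (gridOf P ∘ to ψ) n m) ×
               (ClearN (gridOf P ∘ to ψ) n m × ClearS (gridOf P ∘ to ψ) n m)

  -- The implications from `Solid` serve the best case, where a single miss shows that nothing is
  -- missing on that side.
  data Outcome (n m L R T B : ℕ) (j : Fin 4) (c : Conf robot) : Set where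
    grown  : ∀ {T′} → T ≡ suc T′ → Stage n (suc m) L R T′ B 0F c → Outcome n m L R T B j c
    turned : j ≢ 3F → (Solid → T ≡ 0) → Stage m n T B R L (next j) c → Outcome n m L R T B j c
    ended  : (Solid → T ≡ 0) → Finished m n T B R L c → Outcome n m L R T B j c

  -- The dearer outcome, an extension: a walk out, ten steps to move the end marker, a walk back,
  -- ten steps to judge and to move the other marker. A miss stops after the first walk.
  scanCost : ℕ → ℕ
  scanCost n = suc (walkCost n (suc (10 + suc (walkCost n 10))))

  module _ {ψ : Iso} {n m L R T B : ℕ} (pl : Placed (to ψ) n m L R T B) where
    private
      h = gridOf P ∘ to ψ

    -- The strip has signed distance `T - 1` to the side of the bounding rectangle, and its tiles
    -- lie in that rectangle, so `T` is positive: an extension never leaves the bounding rectangle.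
    hit-grows : anyStrip h n false ≡ true → ∃ λ T′ → T ≡ suc T′
    hit-grows e with anyStrip-true h n false e
    ... | inj₂ (k , k<n , t) = positive T (via (cong (ℤ._+ + 0) (Placed.north≡ pl (-[1+ k ] , + 0)))
            (proj₁ (proj₂ (Placed.within⁻ pl 0 _ (inR (gridOf⁻ t))))))
      where
      positive : ∀ T → + 0 ℤ.≤ -[1+ 0 ] ℤ.+ + T ℤ.+ + 0 → ∃ λ T′ → T ≡ suc T′
      positive (suc T) _ = T , refl

    -- If `T` were positive, the pixel (-1, 0) of the strip would lie in the bounding rectangle and
    -- be a tile.
    miss-solid : 1 ≤ n → ClearN h n m → Solid → T ≡ 0
    miss-solid 1≤n cl so = zeroT T (Placed.north≡ pl (-[1+ 0 ] , + 0))
      where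
      l₁ : ∀ N → N ℤ.- + 1 ≡ ℤ.- (+ 1) ℤ.+ (N ℤ.+ + 0)
      l₁ = solve-∀
      l₂ : ∀ N L → ℤ.- (+ 1) ℤ.+ (N ℤ.+ L) ℤ.+ + 0 ≡ N ℤ.- + 1 ℤ.+ L
      l₂ = solve-∀
      l₃ : ∀ R → R ℤ.- + 1 ℤ.- (ℤ.- (+ 1)) ℤ.+ + 0 ≡ R
      l₃ = solve-∀
      l₄ : ∀ T → ℤ.- (+ 1) ℤ.+ (+ 1 ℤ.+ T) ℤ.+ + 0 ≡ T
      l₄ = solve-∀
      l₅ : ∀ M B → M ℤ.+ B ℤ.- + 0 ℤ.+ + 0 ≡ M ℤ.+ B
      l₅ = solve-∀
      zeroT : ∀ T → Placed.north pl (to ψ (-[1+ 0 ] , + 0)) ≡ -[1+ 0 ] ℤ.+ + T → T ≡ 0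
      zeroT zero _ = refl
      zeroT (suc T) e with () ← trans (sym (cl (-[1+ 0 ] , + 0) refl
        (via (l₁ (+ n)) (0≤diff (+≤+ 1≤n))) (+≤+ z≤n)))
        (gridOf⁺ (so _ (Placed.within⁺ pl 0 _
          (via (sym (trans (cong (ℤ._+ + 0) (Placed.west≡ pl _)) (l₂ (+ n) (+ L)))) (0≤+ (0≤diff (+≤+ 1≤n)) (+≤+ z≤n)))
          (via (sym (trans (cong (ℤ._+ + 0) (Placed.east≡ pl _)) (l₃ (+ R)))) (+≤+ z≤n))
          (via (sym (trans (cong (ℤ._+ + 0) e) (l₄ (+ T)))) (+≤+ z≤n))
          (via (sym (trans (cong (ℤ._+ + 0) (Placed.south≡ pl _)) (l₅ (+ m) (+ B)))) (+≤+ z≤n)))))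

  scan : ∀ {n m L R T B j c} → Stage n m L R T B j c → Ev (Outcome n m L R T B j) (scanCost n) c
  scan {n} {m} {L} {R} {T} {B} {j} (stage {ψ} {r} st pl ho (1≤n , 1≤m) cl) =
    walk pl st λ c s → verdict (anyStrip h n false) refl c s
    where
    h = gridOf P ∘ to ψ

    far : Within 3 (to ψ (+ 1 , + 0))
    far = nearby pl -≤+ (+≤+ ℕP.≤-refl) -≤+ (+≤+ z≤n)

    arrived : to (quarter m) (-[1+ m ] , + 0) ≡ (+ 0 , + 0)
    arrived = cong (+ 0 ,_) (ℤP.+-inverseʳ (+ suc m))

    leave : ∀ {Φ K j j′ k′} c →
      δL (r , j , judge false false true false false true) (Conf.grid c (to ψ (+ 1 , + 0))) ≡
        ((quartered r , j′ , k′) , quarterly , Conf.grid c (to ψ (+ 1 , + 0)) , left) →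
      Site ψ (cells n m false false) full r j (judge false false true false false true) (+ 1 , + 0) c →
      (∀ c′ → Site (ψ ∘ᵢ quarter m) (cells m n false false) full (quartered r) j′ k′ (-[1+ m ] , + 0) c′ → Ev Φ K c′) →
      Ev Φ (suc K) c
    leave c e s cont = swing (quarter m) (-[1+ m ] , + 0) (λ _ _ → refl) (sym arrived) s refl far e
      (marked-quarter (keep s)) cont

    miss : ∀ j → Cleared h n m j → ClearN h n m → ∀ {K} c →
      Site ψ (cells n m false false) full r j (judge false false true false false true) (+ 1 , + 0) c →
      Ev (Outcome n m L R T B j) (suc K) c
    miss j cl clN c s = go′ j cl s
      where
      pl′ = placed-quarter pl
      ho′ = home-∘ (quarter m) inQ-quarter ho
      so = miss-solid {ψ = ψ} pl 1≤n clN
      cn = quarter-clearN {n = n} clN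
      go′ : ∀ {K} j → Cleared h n m j →
        Site ψ (cells n m false false) full r j (judge false false true false false true) (+ 1 , + 0) c →
        Ev (Outcome n m L R T B j) (suc K) c
      go′ 0F _ s = leave c refl s λ _ s → now (turned (λ ()) so (stage s pl′ ho′ (1≤m , 1≤n) cn))
      go′ 1F cw s = leave c refl s λ _ s →
        now (turned (λ ()) so (stage s pl′ ho′ (1≤m , 1≤n) (cn , quarter-clearW {n = n} cw)))
      go′ 2F (cw , cs) s = leave c refl s λ _ s →
        now (turned (λ ()) so (stage s pl′ ho′ (1≤m , 1≤n) (cn , quarter-clearW {n = n} cw , quarter-clearS {n = n} cs)))
      go′ 3F (cw , cs , ce) s = leave c refl s λ _ s →
        now (ended so (finished s pl′ ho′ ((cn , quarter-clearS {n = n} cs) , (quarter-clearE {n = n} ce , quarter-clearW {n = n} cw))))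

    hit : ∀ {T′} → T ≡ suc T′ → ∀ c →
      Site ψ (cells n m false false) full r j (judge false true true false false true) (+ 1 , + 0) c →
      Ev (Outcome n m L R T B j) (suc (10 + suc (walkCost n 10))) c
    hit refl c s =
      go s refl far refl (keep s) λ _ _ s →
      reverse pl s λ _ _ s →
      walk (placed-mirror pl) s λ _ s →
      go s refl (nearby (placed-mirror pl) -≤+ (+≤+ ℕP.≤-refl) -≤+ (+≤+ z≤n)) refl (keep s) λ _ _ s →
      expand (placed-mirror pl) s λ _ _ s →
      now (grown refl (stage s (placed-raise (placed-mirror (placed-mirror pl)))
        (home-∘ {to ψ ∘ to (mirror n) ∘ to (mirror n)} (translate (+ 0) -[1+ 0 ]) inQ-raise
          (home-∘ {to ψ ∘ to (mirror n)} (mirror n) inQ-mirror (home-∘ {to ψ} (mirror n) inQ-mirror ho)))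
        (1≤n , s≤s z≤n) tt))

    verdict : ∀ b → anyStrip h n false ≡ b → ∀ c →
      Site ψ (cells n m false false) full r j (judge false (anyStrip h n false) true false false true) (+ 1 , + 0) c →
      Ev (Outcome n m L R T B j) (suc (10 + suc (walkCost n 10))) c
    verdict true e c s = hit (proj₂ (hit-grows {ψ = ψ} pl e)) c
      (subst (λ b → Site ψ (cells n m false false) full r j (judge false b true false false true) (+ 1 , + 0) c) e s)
    verdict false e c s = miss j cl (strip-clearN {n = n} {m} (proj₂ (anyStrip-false h n false e))) c
      (subst (λ b → Site ψ (cells n m false false) full r j (judge false b true false false true) (+ 1 , + 0) c) e s)

boundingRect-within : ∀ {P x0 x1 y0 y1} N → BoundingRect P x0 x1 y0 y1 → ∀ {q} → q ∈ P → Run.Within P x0 x1 y0 y1 N 0 q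
boundingRect-within N (all , _) {x , y} q∈ with All.lookup all q∈
... | (a , b) , (c , d) = (f a , f b) , (f c , f d)
  where
  f : ∀ {i j} → i ℤ.≤ j → + 0 ℤ.≤ j ℤ.- i ℤ.+ + 0
  f le = 0≤+ (0≤diff le) (+≤+ z≤n)

-- Termination and duration of the search

module Journey (P : List Pixel) (x0 x1 y0 y1 : ℤ) (N : ℕ) (16≤N : 16 ≤ N) (dc : DiagCondition P)
  (br : BoundingRect P x0 x1 y0 y1) where

  open Run P x0 x1 y0 y1 N
  open Growth 16≤N
  open Scan P x0 x1 y0 y1 N 16≤N dc
  open Expedition P x0 x1 y0 y1 N 16≤N dc (boundingRect-within N br)

  globalEdges : Edges
  globalEdges = record
    { west = λ { (x , y) → x ℤ.- x0 }
    ; east = λ { (x , y) → x1 ℤ.- x }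
    ; north = λ { (x , y) → y ℤ.- y0 }
    ; south = λ { (x , y) → y1 ℤ.- y }
    ; within⁺ = λ { k (x , y) a b c d → (a , b) , (c , d) }
    ; within⁻ = λ { k (x , y) h → h }
    ; touch = let (_ , w , e , n , s) = br in
        ((let (p , p∈ , e) = find w in p , p∈ , zero-diff e) , (let (p , p∈ , e) = find e in p , p∈ , zero-diff (sym e))) ,
        ((let (p , p∈ , e) = find n in p , p∈ , zero-diff e) , (let (p , p∈ , e) = find s in p , p∈ , zero-diff (sym e)))
    }
    where
    zero-diff : ∀ {a b} → a ≡ b → a ℤ.- b ≡ + 0
    zero-diff {a} refl = ℤP.+-inverseʳ a

  placed-start : ∀ {sx sy L R T B} → + L ≡ sx ℤ.- x0 → + R ≡ x1 ℤ.- sx → + T ≡ sy ℤ.- y0 → + B ≡ y1 ℤ.- sy →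
    Placed (to (translate (sx ℤ.+ + 1) (sy ℤ.- + 1))) 1 1 L R T B
  placed-start {sx} {sy} eL eR eT eB = record
    { edges = globalEdges
    ; west≡ = λ { (x , y) → trans (l₁ sx x x0) (cong (λ z → x ℤ.+ (+ 1 ℤ.+ z)) (sym eL)) }
    ; east≡ = λ { (x , y) → trans (l₂ sx x x1) (cong (λ z → z ℤ.- + 1 ℤ.- x) (sym eR)) }
    ; north≡ = λ { (x , y) → trans (l₃ sy y y0) (cong (λ z → y ℤ.- + 1 ℤ.+ z) (sym eT)) }
    ; south≡ = λ { (x , y) → trans (l₄ sy y y1) (cong (λ z → + 1 ℤ.+ z ℤ.- y) (sym eB)) }
    }
    where
    l₁ : ∀ S X X0 → S ℤ.+ + 1 ℤ.+ X ℤ.- X0 ≡ X ℤ.+ (+ 1 ℤ.+ (S ℤ.- X0))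
    l₁ = solve-∀
    l₂ : ∀ S X X1 → X1 ℤ.- (S ℤ.+ + 1 ℤ.+ X) ≡ X1 ℤ.- S ℤ.- + 1 ℤ.- X
    l₂ = solve-∀
    l₃ : ∀ S Y Y0 → S ℤ.- + 1 ℤ.+ Y ℤ.- Y0 ≡ Y ℤ.- + 1 ℤ.+ (S ℤ.- Y0)
    l₃ = solve-∀
    l₄ : ∀ S Y Y1 → Y1 ℤ.- (S ℤ.- + 1 ℤ.+ Y) ≡ + 1 ℤ.+ (Y1 ℤ.- S) ℤ.- Y
    l₄ = solve-∀

  round : ∀ {Φ K ψ dn r j c L R T B} → Placed (to ψ) 1 1 L R T B →
    Site ψ (cells 1 1 false false) dn r j (approach false) (-[1+ 0 ] , + 1) c →
    recall dn hn ln ≡ false → recall dn hn lf ≡ false → recall dn hf lf ≡ false →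
    (∀ r′ c′ → Site ψ (cells 1 1 false false) (put hf lf true (put hn lf true (put hn ln true dn))) r′ j
         (plant initially 3F) (+ 1 , + 0) c′ → Ev Φ K c′) →
    Ev Φ (5 + K) c
  round pl s d₁ d₂ d₃ cont =
    go s refl (nearby pl (-≤- z≤n) -≤+ -≤+ (+≤+ ℕP.≤-refl)) refl (keep s) λ _ _ s →
    go s refl (nearby pl -≤+ (+≤+ z≤n) -≤+ (+≤+ ℕP.≤-refl)) refl (keep s) λ _ _ s →
    plantCorner pl s d₁ d₂ d₃ cont

  round-on : ∀ {Φ K ψ dn r j c L R T B} → (∀ r → planted initially j r ≡ ((r , j , retreat false) , straight)) →
    Placed (to ψ) 1 1 L R T B →
    Site ψ (cells 1 1 false false) dn r j (approach false) (-[1+ 0 ] , + 1) c →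
    recall dn hn ln ≡ false → recall dn hn lf ≡ false → recall dn hf lf ≡ false → recall dn hf ln ≡ false →
    (∀ r′ c′ → Site (ψ ∘ᵢ quarter 1) (cells 1 1 false false) (quartered (endCorner true dn)) r′ (next j)
         (approach false) (-[1+ 0 ] , + 1) c′ → Ev Φ K c′) →
    Ev Φ (8 + K) c
  round-on e pl s d₁ d₂ d₃ d₄ cont = round pl s d₁ d₂ d₃ λ _ _ s →
    go s refl (nearby pl -≤+ (+≤+ ℕP.≤-refl) -≤+ (+≤+ z≤n)) (cong (λ (l , τ) → l , τ , false , left) (e _))
      (marked-plant (cells-injective 1 1 false false) (marked s) hf ln d₄) λ _ _ s →
    go s refl (nearby pl -≤+ (+≤+ z≤n) -≤+ (+≤+ z≤n)) refl (keep s) λ _ _ s →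
    swing (quarter 1) (-[1+ 0 ] , + 1) (λ _ _ → refl) refl s refl
      (nearby pl -≤+ (+≤+ z≤n) -≤+ (+≤+ ℕP.≤-refl)) refl (marked-quarter (keep s)) λ _ s →
    cont _ _ s

  round-off : ∀ {Φ K ψ dn r c L R T B} → Placed (to ψ) 1 1 L R T B →
    Site ψ (cells 1 1 false false) dn r 3F (approach false) (-[1+ 0 ] , + 1) c →
    recall dn hn ln ≡ false → recall dn hn lf ≡ false → recall dn hf lf ≡ false → recall dn hf ln ≡ false →
    (∀ r′ c′ → Site (ψ ∘ᵢ quarter 1) (cells 1 1 false false) (quartered (endCorner true dn)) r′ 0F
         (depart false) (-[1+ 1 ] , + 0) c′ → Ev Φ K c′) →
    Ev Φ (6 + K) c
  round-off pl s d₁ d₂ d₃ d₄ cont = round pl s d₁ d₂ d₃ λ _ _ s →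
    swing (quarter 1) (-[1+ 1 ] , + 0) (λ _ _ → refl) refl s refl
      (nearby pl -≤+ (+≤+ ℕP.≤-refl) -≤+ (+≤+ z≤n)) refl
      (marked-quarter (marked-plant (cells-injective 1 1 false false) (marked s) hf ln d₄)) λ _ s →
    cont _ _ s

  -- 30 = 8 + 8 + 8 + 6: the fourth corner saves the two steps back to the start pixel, since the
  -- walk departs from that corner.
  setup : ∀ {sx sy L R T B} → (sx , sy) ∈ P →
    + L ≡ sx ℤ.- x0 → + R ≡ x1 ℤ.- sx → + T ≡ sy ℤ.- y0 → + B ≡ y1 ℤ.- sy →
    Ev (Stage 1 1 L R T B 0F) 30 (initial robot P (sx , sy))
  setup {sx} {sy} s∈P eL eR eT eB =
    round-on (λ _ → refl) p₀ s₀ refl refl refl refl λ _ _ s →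
    round-on (λ _ → refl) p₁ s refl refl refl refl λ _ _ s →
    round-on (λ _ → refl) p₂ s refl refl refl refl λ _ _ s →
    round-off p₃ s refl refl refl refl λ _ _ s →
    now (stage s (placed-quarter p₃)
      ((-[1+ 0 ] , + 1) , trans (cong (gridOf P) centre) (gridOf⁺ s∈P) ,
        ((+≤+ z≤n , +≤+ z≤n) , (+≤+ z≤n , +≤+ z≤n)))
      (ℕP.≤-refl , ℕP.≤-refl) tt)
    where
    ψ₀ = translate (sx ℤ.+ + 1) (sy ℤ.- + 1)
    p₀ = placed-start eL eR eT eB
    p₁ = placed-quarter p₀
    p₂ = placed-quarter p₁
    p₃ = placed-quarter p₂
    centre : to ψ₀ (-[1+ 0 ] , + 1) ≡ (sx , sy)
    centre = cong₂ _,_ (l₁ sx) (l₂ sy)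
      where
      l₁ : ∀ S → S ℤ.+ + 1 ℤ.+ (ℤ.- (+ 1)) ≡ S
      l₁ = solve-∀
      l₂ : ∀ S → S ℤ.- + 1 ℤ.+ + 1 ≡ S
      l₂ = solve-∀
    s₀ : Site ψ₀ (cells 1 1 false false) blank blank 0F (approach false) (-[1+ 0 ] , + 1) (initial robot P (sx , sy))
    s₀ = site (view refl (sym centre) (λ q → refl)) (record
      { marks = λ i j d → ⊥-elim (absurd i j d) ; saved = λ i j d → ⊥-elim (absurd i j d) ; rest = λ q _ → refl })
      where
      absurd : ∀ i j → recall blank i j ≡ true → ⊥
      absurd i j d with () ← trans (sym (recall-memory (λ _ _ → false) i j)) d

  Settled : ℕ → Conf robot → Set
  Settled S c = ∃ λ n → ∃ λ m → ∃ λ L → ∃ λ R → ∃ λ T → ∃ λ B →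
    Finished n m L R T B c × (n + L + R) + (m + T + B) ≡ S

  walkCost≡ : ∀ n K → walkCost n K ≡ n * 3 + (5 + K)
  walkCost≡ zero K = refl
  walkCost≡ (suc n) K = cong (3 ℕ.+_) (walkCost≡ n K)

  scanCost-linear : ∀ {n} → 1 ≤ n → scanCost n ≤ 39 * n
  scanCost-linear {n} 1≤n = begin
    scanCost n ≡⟨ cong suc (walkCost≡ n _) ⟩
    1 + (n * 3 + (5 + (12 + walkCost n 10))) ≡⟨ cong (λ z → 1 + (n * 3 + (5 + (12 + z)))) (walkCost≡ n 10) ⟩
    1 + (n * 3 + (5 + (12 + (n * 3 + 15)))) ≡⟨ lem n ⟩
    6 * n + 33 * 1 ≤⟨ ℕP.+-monoʳ-≤ (6 * n) (ℕP.*-monoʳ-≤ 33 1≤n) ⟩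
    6 * n + 33 * n ≡⟨ lem′ n ⟩
    39 * n ∎
    where
    open ℕP.≤-Reasoning
    lem : ∀ n → 1 + (n * 3 + (5 + (12 + (n * 3 + 15)))) ≡ 6 * n + 33 * 1
    lem = solveℕ-∀
    lem′ : ∀ n → 6 * n + 33 * n ≡ 39 * n
    lem′ = solveℕ-∀

  -- Four misses end the search, so each missing line is worth four scans: an extension gains four,
  -- which pays for resetting a counter of at most three misses.
  measure : (L R T B : ℕ) → Fin 4 → ℕ
  measure L R T B j = 4 * (L + R + (T + B)) + (3 ∸ Fin.toℕ j)

  measure-grown : ∀ L R T B j → suc (measure L R T B 0F) ≤ measure L R (suc T) B j
  measure-grown L R T B j = ℕP.≤-trans (ℕP.≤-reflexive (lem L R T B)) (ℕP.m≤m+n _ (3 ∸ Fin.toℕ j))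
    where
    lem : ∀ L R T B → 1 + (4 * (L + R + (T + B)) + 3) ≡ 4 * (L + R + (1 + T + B))
    lem = solveℕ-∀

  measure-turned : ∀ L R T B j → j ≢ 3F → suc (measure T B R L (next j)) ≡ measure L R T B j
  measure-turned L R T B j j≢3 = trans (sym (ℕP.+-suc _ _)) (cong₂ ℕ._+_ (cong (4 ℕ.*_) (lem L R T B)) (step-j j j≢3))
    where
    lem : ∀ L R T B → T + B + (R + L) ≡ L + R + (T + B)
    lem = solveℕ-∀
    step-j : ∀ j → j ≢ 3F → suc (3 ∸ Fin.toℕ (next j)) ≡ 3 ∸ Fin.toℕ j
    step-j 0F _ = refl
    step-j 1F _ = refl
    step-j 2F _ = refl
    step-j 3F ne = ⊥-elim (ne refl)

  sum-grown : ∀ n m L R T B → (n + L + R) + (suc m + T + B) ≡ (n + L + R) + (m + suc T + B)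
  sum-grown = solveℕ-∀

  sum-turned : ∀ n m L R T B → (m + T + B) + (n + R + L) ≡ (n + L + R) + (m + T + B)
  sum-turned = solveℕ-∀

  loop : ∀ {S} fuel {n m L R T B j c} → Stage n m L R T B j c → measure L R T B j ≤ fuel →
    (n + L + R) + (m + T + B) ≡ S → Ev (Settled S) (suc fuel * (39 * S)) c
  loop {S} fuel {n} {m} {L} {R} {T} {B} {j} st le eq =
    ev-weaken (ℕP.+-monoˡ-≤ (fuel * (39 * S))
      (ℕP.≤-trans (scanCost-linear (proj₁ (Stage.proper st))) (ℕP.*-monoʳ-≤ 39 n≤S)))
      (ev-bind (scan st) (λ c o → after fuel le o))
    where
    n≤S : n ≤ S
    n≤S = ℕP.≤-trans (ℕP.m≤m+n n L) (ℕP.≤-trans (ℕP.m≤m+n _ R) (ℕP.≤-trans (ℕP.m≤m+n _ (m + T + B)) (ℕP.≤-reflexive eq)))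
    after : ∀ fuel {c} → measure L R T B j ≤ fuel → Outcome n m L R T B j c → Ev (Settled S) (fuel * (39 * S)) c
    after fuel le (ended _ f) = now (_ , _ , _ , _ , _ , _ , f , trans (sum-turned n m L R T B) eq)
    after zero le (grown {T′} refl st′) with () ← ℕP.≤-trans (measure-grown L R T′ B j) le
    after (suc fuel) le (grown {T′} refl st′) =
      loop fuel st′ (ℕP.≤-pred (ℕP.≤-trans (measure-grown L R T′ B j) le)) (trans (sum-grown n m L R T′ B) eq)
    after zero le (turned j≢3 _ st′) with () ← ℕP.≤-trans (ℕP.≤-reflexive (measure-turned L R T B j j≢3)) le
    after (suc fuel) le (turned j≢3 _ st′) =
      loop fuel st′ (ℕP.≤-pred (ℕP.≤-trans (ℕP.≤-reflexive (measure-turned L R T B j j≢3)) le))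
        (trans (sum-turned n m L R T B) eq)

  module _ (solid : Solid) (S A : ℕ) where

    Sizes : (n m L R T B : ℕ) → Set
    Sizes n m L R T B = (n + L + R) + (m + T + B) ≡ S × (n + L + R) * (m + T + B) ≡ A

    Reached : (n m L R T B : ℕ) → Conf robot → Set
    Reached n m L R T B c = Settled S c ⊎ ∃ (λ j → Stage n m L R T B j c) × Sizes n m L R T B

    sizes-turned : ∀ {n m L R T B} → Sizes n m L R T B → Sizes m n T B R L
    sizes-turned {n} {m} {L} {R} {T} {B} (s , a) = trans (sum-turned n m L R T B) s , trans (lem n m L R T B) a
      where
      lem : ∀ n m L R T B → (m + T + B) * (n + R + L) ≡ (n + L + R) * (m + T + B)
      lem = solveℕ-∀

    sizes-grown : ∀ {n m L R T B} → Sizes n m L R (suc T) B → Sizes n (suc m) L R T B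
    sizes-grown {n} {m} {L} {R} {T} {B} (s , a) = trans (sum-grown n m L R T B) s ,
      trans (cong (λ z → (n + L + R) * (z + B)) (sym (ℕP.+-suc m T))) a

    -- All extensions across one side of a solid rectangle, and the final miss.
    phase : ∀ T {n m L R B j c} → Stage n m L R T B j c → Sizes n m L R T B →
      Ev (Reached (m + T) n 0 B R L) (suc T * scanCost n) c
    phase T {n} {m} {L} {R} {B} st sz = ev-bind (scan st) (λ c → after T sz)
      where
      after : ∀ T {j c} → Sizes n m L R T B → Outcome n m L R T B j c →
        Ev (Reached (m + T) n 0 B R L) (T * scanCost n) c
      after T (s , _) (ended z f) = now (inj₁ (_ , _ , _ , _ , _ , _ , f , trans (sum-turned n m L R T B) s))
      after T sz (turned _ z st′) with refl ← z solid =
        now (inj₂ ((_ , subst (λ k → Stage k n 0 B R L _ _) (sym (ℕP.+-identityʳ m)) st′) ,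
          subst (λ k → Sizes k n 0 B R L) (sym (ℕP.+-identityʳ m)) (sizes-turned {n} {m} {L} {R} {0} {B} sz)))
      after (suc T) {c = c} sz (grown refl st′) =
        subst (λ k → Ev (Reached k n 0 B R L) (suc T * scanCost n) c) (sym (ℕP.+-suc m T))
          (phase T st′ (sizes-grown {n} {m} {L} {R} {T} {B} sz))

    -- The walks have length `n`, at most one side of the bounding rectangle, and there are `1 + T`
    -- of them, at most the other side because `m` is positive.
    phase-cost : ∀ {n m L R T B} → 1 ≤ n → 1 ≤ m → Sizes n m L R T B → suc T * scanCost n ≤ 39 * A
    phase-cost {n} {m} {L} {R} {T} {B} 1≤n 1≤m (_ , refl) = begin
      suc T * scanCost n ≤⟨ ℕP.*-monoʳ-≤ (suc T) (scanCost-linear 1≤n) ⟩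
      suc T * (39 * n) ≡⟨ lem T n ⟩
      39 * (n * (1 + T)) ≤⟨ ℕP.*-monoʳ-≤ 39 (ℕP.*-mono-≤
          (ℕP.≤-trans (ℕP.m≤m+n n L) (ℕP.m≤m+n _ R))
          (ℕP.≤-trans (ℕP.+-monoˡ-≤ T 1≤m) (ℕP.m≤m+n _ B))) ⟩
      39 * ((n + L + R) * (m + T + B)) ∎
      where
      open ℕP.≤-Reasoning
      lem : ∀ T n → (1 + T) * (39 * n) ≡ 39 * (n * (1 + T))
      lem = solveℕ-∀

    phase′ : ∀ {n m L R T B c} → Reached n m L R T B c → Ev (Reached (m + T) n 0 B R L) (39 * A) c
    phase′ (inj₁ f) = now (inj₁ f)
    phase′ {n} {m} {L} {R} {T} {B} (inj₂ ((_ , st) , sz)) =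
      ev-weaken (phase-cost {n} {m} {L} {R} {T} {B} (proj₁ (Stage.proper st)) (proj₂ (Stage.proper st)) sz) (phase _ st sz)

    -- Nothing is missing any more, so every scan is a miss and at most four remain.
    tail : ∀ k {n m j c} → Stage n m 0 0 0 0 j c → 3 ∸ Fin.toℕ j ≤ k → Sizes n m 0 0 0 0 →
      Ev (Settled S) (suc k * (39 * A)) c
    tail k {n} {m} {j} st le sz@(s , _) =
      ev-weaken (ℕP.+-monoˡ-≤ (k * (39 * A))
        (ℕP.≤-trans (ℕP.≤-reflexive (sym (ℕP.+-identityʳ _)))
          (phase-cost {n} {m} {0} {0} {0} {0} (proj₁ (Stage.proper st)) (proj₂ (Stage.proper st)) sz)))
        (ev-bind (scan st) (λ c o → after k le o))
      where
      after : ∀ k {c} → 3 ∸ Fin.toℕ j ≤ k → Outcome n m 0 0 0 0 j c → Ev (Settled S) (k * (39 * A)) c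
      after k le (ended _ f) = now (_ , _ , _ , _ , _ , _ , f , trans (sum-turned n m 0 0 0 0) s)
      after k le (grown () _)
      after zero le (turned j≢3 _ st′) with () ← ℕP.≤-trans (ℕP.≤-reflexive (measure-turned 0 0 0 0 j j≢3)) le
      after (suc k) le (turned j≢3 _ st′) =
        tail k st′ (ℕP.≤-pred (ℕP.≤-trans (ℕP.≤-reflexive (measure-turned 0 0 0 0 j j≢3)) le))
          (sizes-turned {n} {m} {0} {0} {0} {0} sz)

    -- One phase turns the missing counts (L, R, T, B) into (0, B, R, L), so four phases clear all
    -- of them.
    solid-loop : ∀ {n m L R T B j c} → Stage n m L R T B j c → Sizes n m L R T B →
      Ev (Settled S) (39 * A + (39 * A + (39 * A + (39 * A + 4 * (39 * A))))) c
    solid-loop st sz =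
      ev-bind (phase′ (inj₂ ((_ , st) , sz))) λ _ x →
      ev-bind (phase′ x) λ _ x →
      ev-bind (phase′ x) λ _ x →
      ev-bind (phase′ x) λ { _ (inj₁ f) → now f ; _ (inj₂ ((j , st) , sz)) → tail 3 st (ℕP.m∸n≤m 3 (Fin.toℕ j)) sz }

-- Colours

evenℕ : ℕ → Bool
evenℕ zero = true
evenℕ (suc n) = not (evenℕ n)

even : ℤ → Bool
even (+ n) = evenℕ n
even -[1+ n ] = not (evenℕ n)

even-suc : ∀ z → even (z ℤ.+ ℤ.1ℤ) ≡ not (even z)
even-suc (+ n) = cong evenℕ (ℕP.+-comm n 1)
even-suc -[1+ zero ] = refl
even-suc -[1+ suc n ] = sym (not-involutive _)

even-pred : ∀ z → even (z ℤ.- ℤ.1ℤ) ≡ not (even z)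
even-pred z = trans (sym (not-involutive _)) (cong not (trans (sym (even-suc (z ℤ.- ℤ.1ℤ))) (cong even (lem z))))
  where
  lem : ∀ z → z ℤ.- ℤ.1ℤ ℤ.+ ℤ.1ℤ ≡ z
  lem = solve-∀

Alternating : (Pixel → Bool) → Set
Alternating cl = ∀ d p → cl (move d p) ≡ not (cl p)

colour : Bool → Pixel → Bool
colour b (x , y) = b xor even (x ℤ.+ y)

colour-alternating : ∀ b → Alternating (colour b)
colour-alternating b d (x , y) = trans (cong (b xor_) (lem d)) (xor-not b _)
  where
  xor-not : ∀ a c → a xor not c ≡ not (a xor c)
  xor-not false c = refl
  xor-not true c = refl
  l₁ : ∀ x y → x ℤ.+ (y ℤ.+ ℤ.1ℤ) ≡ x ℤ.+ y ℤ.+ ℤ.1ℤ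
  l₁ = solve-∀
  l₂ : ∀ x y → x ℤ.+ (y ℤ.- ℤ.1ℤ) ≡ x ℤ.+ y ℤ.- ℤ.1ℤ
  l₂ = solve-∀
  l₃ : ∀ x y → x ℤ.- ℤ.1ℤ ℤ.+ y ≡ x ℤ.+ y ℤ.- ℤ.1ℤ
  l₃ = solve-∀
  l₄ : ∀ x y → x ℤ.+ ℤ.1ℤ ℤ.+ y ≡ x ℤ.+ y ℤ.+ ℤ.1ℤ
  l₄ = solve-∀
  lem : ∀ d → even (proj₁ (move d (x , y)) ℤ.+ proj₂ (move d (x , y))) ≡ not (even (x ℤ.+ y))
  lem up = trans (cong even (l₁ x y)) (even-suc (x ℤ.+ y))
  lem down = trans (cong even (l₂ x y)) (even-pred (x ℤ.+ y))
  lem left = trans (cong even (l₃ x y)) (even-pred (x ℤ.+ y))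
  lem right = trans (cong even (l₄ x y)) (even-suc (x ℤ.+ y))

alternating-∘ : ∀ {cl} ψ → Alternating cl → Alternating (cl ∘ to ψ)
alternating-∘ {cl} ψ a d p = trans (cong cl (to-move ψ d p)) (a _ _)

-- One side of the ring

-- From -(n+2) to 1: the columns of the rectangle and the two marker columns at either end.
data Col (n : ℕ) : ℤ → Set where
  mid  : ∀ {k} → k ≤ suc (suc n) → Col n (column k)
  last : Col n (+ 1)

data Lane (n : ℕ) : Pixel → Set where
  inner : ∀ {x} → Col n x → Lane n (x , -[1+ 0 ])
  outer : ∀ {x} → Col n x → Lane n (x , -[1+ 1 ])

-- The inner corner (1, -1) is left to the next side, which begins there; the outer pixel of that
-- column, `tip`, still belongs to this side. The outer corner (2, -2) belongs to none.
data InSide (i : ℕ) : Pixel → Set where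
  inner : ∀ {k} → k ≤ i → InSide i (column k , -[1+ 0 ])
  outer : ∀ {k} → k ≤ i → InSide i (column k , -[1+ 1 ])
  tip   : InSide i (+ 1 , -[1+ 1 ])

inSide-weaken : ∀ {i q} → InSide i q → InSide (suc i) q
inSide-weaken (inner le) = inner (ℕP.m≤n⇒m≤1+n le)
inSide-weaken (outer le) = outer (ℕP.m≤n⇒m≤1+n le)
inSide-weaken tip = tip

column-injective : ∀ i j → column i ≡ column j → i ≡ j
column-injective zero zero e = refl
column-injective (suc i) (suc j) e = cong suc (ℤP.-[1+-injective e)

module Side (cl : Pixel → Bool) (alt : Alternating cl) where

  pick : ℤ → Pixel
  pick x = if cl (x , -[1+ 0 ]) then (x , -[1+ 0 ]) else (x , -[1+ 1 ])

  sideFrom beyond : ℕ → List Pixel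
  sideFrom i = pick (column i) ∷ beyond i
  beyond zero = if cl (+ 1 , -[1+ 0 ]) then [] else (+ 1 , -[1+ 1 ]) ∷ []
  beyond (suc i) = sideFrom i

  -- The first ring pixel of the next side in the coordinates of this one: the column in which that
  -- side begins is part of row -1 here, with its inner pixel at abscissa 1 and its outer pixel at
  -- 2.
  successor : Pixel
  successor = if cl (+ 1 , -[1+ 0 ]) then (+ 1 , -[1+ 0 ]) else (+ 2 , -[1+ 0 ])

  alt-down : ∀ x → cl (x , -[1+ 1 ]) ≡ not (cl (x , -[1+ 0 ]))
  alt-down x = alt down (x , -[1+ 0 ])

  pick-coloured : ∀ x → cl (pick x) ≡ true
  pick-coloured x with cl (x , -[1+ 0 ]) in e
  ... | true = e
  ... | false = trans (alt-down x) (cong not e)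

  pick-inSide : ∀ {k i} → k ≤ i → InSide i (pick (column k))
  pick-inSide {k} le with cl (column k , -[1+ 0 ])
  ... | true = inner le
  ... | false = outer le

  sideFrom-coloured : ∀ i {q} → q ∈ sideFrom i → cl q ≡ true
  sideFrom-coloured i (here refl) = pick-coloured (column i)
  sideFrom-coloured (suc i) (there q∈) = sideFrom-coloured i q∈
  sideFrom-coloured zero (there q∈) with cl (+ 1 , -[1+ 0 ]) in e
  sideFrom-coloured zero (there (here refl)) | false = trans (alt-down (+ 1)) (cong not e)

  sideFrom-inSide : ∀ i {q} → q ∈ sideFrom i → InSide i q
  sideFrom-inSide i (here refl) = pick-inSide ℕP.≤-refl
  sideFrom-inSide (suc i) (there q∈) = inSide-weaken (sideFrom-inSide i q∈)
  sideFrom-inSide zero (there q∈) with cl (+ 1 , -[1+ 0 ])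
  sideFrom-inSide zero (there (here refl)) | false = tip

  pick-∈ : ∀ {k} i → k ≤ i → pick (column k) ∈ sideFrom i
  pick-∈ zero z≤n = here refl
  pick-∈ {k} (suc i) le with ℕP.m≤n⇒m<n∨m≡n le
  ... | inj₁ (s≤s le′) = there (pick-∈ i le′)
  ... | inj₂ refl = here refl

  inner-∈ : ∀ {k} i → k ≤ i → cl (column k , -[1+ 0 ]) ≡ true → (column k , -[1+ 0 ]) ∈ sideFrom i
  inner-∈ {k} i le e = subst (_∈ sideFrom i) (cong (if_then _ else _) e) (pick-∈ i le)

  outer-∈ : ∀ {k} i → k ≤ i → cl (column k , -[1+ 1 ]) ≡ true → (column k , -[1+ 1 ]) ∈ sideFrom i
  outer-∈ {k} i le e = subst (_∈ sideFrom i) (cong (if_then _ else _) e′) (pick-∈ i le)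
    where
    e′ : cl (column k , -[1+ 0 ]) ≡ false
    e′ = trans (sym (not-involutive _)) (cong not (trans (sym (alt-down (column k))) e))

  tip-∈ : ∀ i → cl (+ 1 , -[1+ 1 ]) ≡ true → (+ 1 , -[1+ 1 ]) ∈ sideFrom i
  tip-∈ (suc i) e = there (tip-∈ i e)
  tip-∈ zero e with cl (+ 1 , -[1+ 0 ]) in e′
  ... | false = there (here refl)
  ... | true with () ← trans (sym e) (trans (alt-down (+ 1)) (cong not e′))

  private
    climb : ∀ x x′ → x ℤ.+ ℤ.1ℤ ≡ x′ → DiagPair (pick x) (pick x′)
    climb x x′ refl with cl (x , -[1+ 0 ]) in e | cl (x ℤ.+ ℤ.1ℤ , -[1+ 0 ]) in e′
    ... | true | false = right , down , hr , vd , refl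
    ... | false | true = right , up , hr , vu , refl
    ... | true | true with () ← trans (sym e′) (trans (alt right (x , -[1+ 0 ])) (cong not e))
    ... | false | false with () ← trans (sym e′) (trans (alt right (x , -[1+ 0 ])) (cong not e))

  -- Colours alternate along a lane, so in neighbouring columns the coloured pixels lie in opposite
  -- rows and form a diagonal pair.
  sideFrom-linked : ∀ i → Linked DiagPair (sideFrom i ++ successor ∷ [])
  sideFrom-linked (suc i) = climb -[1+ i ] (column i) (column-next i) ∷ sideFrom-linked i
  sideFrom-linked zero with cl (+ 1 , -[1+ 0 ]) in e | cl (+ 0 , -[1+ 0 ]) in e′
  ... | true | false = (right , up , hr , vu , refl) ∷ [-]
  ... | false | true = (right , down , hr , vd , refl) ∷ (right , up , hr , vu , refl) ∷ [-]
  ... | true | true with () ← trans (sym e) (trans (alt right (+ 0 , -[1+ 0 ])) (cong not e′))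
  ... | false | false with () ← trans (sym e) (trans (alt right (+ 0 , -[1+ 0 ])) (cong not e′))

  private
    fresh : ∀ i {q} → InSide i q → pick -[1+ i ] ≢ q
    fresh i {q} s e = go s (trans (sym (abs -[1+ i ])) (cong proj₁ e))
      where
      abs : ∀ x → proj₁ (pick x) ≡ x
      abs x with cl (x , -[1+ 0 ])
      ... | true = refl
      ... | false = refl
      go : ∀ {q} → InSide i q → -[1+ i ] ≢ proj₁ q
      go (inner {k} le) e = ℕP.<-irrefl (sym (column-injective (suc i) k e)) (s≤s le)
      go (outer {k} le) e = ℕP.<-irrefl (sym (column-injective (suc i) k e)) (s≤s le)

  sideFrom-unique : ∀ i → Unique (sideFrom i)
  sideFrom-unique (suc i) = All.tabulate (λ q∈ → fresh i (sideFrom-inSide i q∈)) ∷ sideFrom-unique i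
  sideFrom-unique zero with cl (+ 1 , -[1+ 0 ]) | cl (+ 0 , -[1+ 0 ])
  ... | true | _ = [] ∷ []
  ... | false | true = ((λ ()) ∷ []) ∷ [] ∷ []
  ... | false | false = ((λ ()) ∷ []) ∷ [] ∷ []

  sideFrom-length : ∀ i → length (sideFrom i) ≤ 2 + i
  sideFrom-length (suc i) = s≤s (sideFrom-length i)
  sideFrom-length zero with cl (+ 1 , -[1+ 0 ])
  ... | true = s≤s z≤n
  ... | false = ℕP.≤-refl

linked-join : ∀ {R : Pixel → Pixel → Set} xs {y ys} → Linked R (xs ++ y ∷ []) → Linked R (y ∷ ys) → Linked R (xs ++ y ∷ ys)
linked-join [] l l′ = l′
linked-join (x ∷ []) (r ∷ l) l′ = r ∷ l′
linked-join (x ∷ x′ ∷ xs) (r ∷ l) l′ = r ∷ linked-join (x′ ∷ xs) l l′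

private
  ℓ₁ : ∀ M → + 1 ℤ.+ M ℤ.+ (ℤ.- (+ 2 ℤ.+ M)) ≡ ℤ.- (+ 1)
  ℓ₁ = solve-∀

quarter-corner : ∀ m → to (quarter m) (-[1+ suc m ] , -[1+ 0 ]) ≡ (+ 1 , -[1+ 0 ])
quarter-corner m = cong (+ 1 ,_) (ℓ₁ (+ m))

quarter-corner′ : ∀ m → to (quarter m) (-[1+ suc m ] , -[1+ 1 ]) ≡ (+ 2 , -[1+ 0 ])
quarter-corner′ m = cong (+ 2 ,_) (ℓ₁ (+ m))

private
  low-enough : ∀ m k → k ≤ suc (suc m) → + suc m ℤ.+ column k ≢ -[1+ 1 ]
  low-enough m zero le e with () ← trans (sym (ℤP.+-identityʳ (+ suc m))) e
  low-enough m (suc k) le e = ℕP.<-irrefl refl (ℕP.≤-trans (ℕP.≤-reflexive (cong suc k≡)) le)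
    where
    l : ∀ M K → + 1 ℤ.+ K ≡ + 1 ℤ.+ M ℤ.- (+ 1 ℤ.+ M ℤ.+ (ℤ.- (+ 1 ℤ.+ K)))
    l = solve-∀
    k≡ : suc (suc m) ≡ k
    k≡ = sym (ℕP.suc-injective (ℤP.+-injective (trans (l (+ m) (+ k)) (trans (cong (λ z → + suc m ℤ.- z) e) (cong +_ (lem m))))))
      where
      lem : ∀ m → suc (m + 2) ≡ 3 + m
      lem m = cong suc (ℕP.+-comm m 2)

-- The next side lies at abscissae 1 and 2, where this side has only its tip; there the ordinates
-- are at least -1, while the tip has -2.
side-disjoint₁ : ∀ {n m a b} → InSide (suc (suc n)) a → InSide (suc (suc m)) b → a ≢ to (quarter m) b
side-disjoint₁ {n} {m} s t e = clash s t (cong proj₁ e) (cong proj₂ e)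
  where
  nonpos : ∀ k j → column k ≢ + suc j
  nonpos zero j ()
  nonpos (suc k) j ()
  clash : ∀ {a b} → InSide (suc (suc n)) a → InSide (suc (suc m)) b →
    proj₁ a ≡ ℤ.- proj₂ b → proj₂ a ≢ + suc m ℤ.+ proj₁ b
  clash (inner {k} _) (inner _) e _ = nonpos k 0 e
  clash (inner {k} _) (outer _) e _ = nonpos k 1 e
  clash (inner {k} _) tip e _ = nonpos k 1 e
  clash (outer {k} _) (inner _) e _ = nonpos k 0 e
  clash (outer {k} _) (outer _) e _ = nonpos k 1 e
  clash (outer {k} _) tip e _ = nonpos k 1 e
  clash tip (inner {k} le) _ e = low-enough m k le (sym e)

side-disjoint₂ : ∀ {n m a b} → InSide (suc (suc n)) a → InSide (suc (suc n)) b →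
                 a ≢ to (quarter m) (to (quarter n) b)
side-disjoint₂ {n} {m} s t e = clash s t (cong proj₂ e)
  where
  clash : ∀ {a b} → InSide (suc (suc n)) a → InSide (suc (suc n)) b → proj₂ a ≢ + suc m ℤ.+ (ℤ.- proj₂ b)
  clash (inner _) (inner _) ()
  clash (inner _) (outer _) ()
  clash (inner _) tip ()
  clash (outer _) (inner _) ()
  clash (outer _) (outer _) ()
  clash (outer _) tip ()
  clash tip (inner _) ()
  clash tip (outer _) ()
  clash tip tip ()

private
  -- The right-hand side is `from (quarter n)`: three sides onward amount to one side back, and `m`
  -- cancels.
  back≡ : ∀ n m b → to (quarter m) (to (quarter n) (to (quarter m) b)) ≡ (proj₂ b ℤ.- + suc n , ℤ.- proj₁ b)
  back≡ n m (x , y) = cong₂ _,_ (l₁ (+ n) y) (l₂ (+ m) x)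
    where
    l₁ : ∀ N Y → ℤ.- (+ 1 ℤ.+ N ℤ.+ (ℤ.- Y)) ≡ Y ℤ.- (+ 1 ℤ.+ N)
    l₁ = solve-∀
    l₂ : ∀ M X → + 1 ℤ.+ M ℤ.+ (ℤ.- (+ 1 ℤ.+ M ℤ.+ X)) ≡ ℤ.- X
    l₂ = solve-∀

  far-column : ∀ n k → k ≤ suc (suc n) → column k ≢ -[1+ suc (suc n) ]
  far-column n k le e = ℕP.<-irrefl (column-injective k (suc (suc (suc n))) e) (s≤s le)

  neg-column : ∀ k j → -[1+ j ] ≢ ℤ.- column k
  neg-column zero j ()
  neg-column (suc k) j ()

side-disjoint₃ : ∀ {n m a b} → InSide (suc (suc n)) a → InSide (suc (suc m)) b →
                 a ≢ to (quarter m) (to (quarter n) (to (quarter m) b))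
side-disjoint₃ {n} {m} {b = b} s t e = go s t (trans e (back≡ n m b))
  where
  go : ∀ {a b} → InSide (suc (suc n)) a → InSide (suc (suc m)) b → a ≢ (proj₂ b ℤ.- + suc n , ℤ.- proj₁ b)
  go (inner _) (inner {k} _) e = neg-column k 0 (cong proj₂ e)
  go (outer _) (inner {k} _) e = neg-column k 1 (cong proj₂ e)
  go tip (inner {k} _) e = neg-column k 1 (cong proj₂ e)
  go (inner _) (outer {k} _) e = neg-column k 0 (cong proj₂ e)
  go (outer _) (outer {k} _) e = neg-column k 1 (cong proj₂ e)
  go tip (outer {k} _) e = neg-column k 1 (cong proj₂ e)
  go (inner {k} le) tip e = far-column n k le (cong proj₁ e)
  go (outer _) tip e with () ← cong proj₂ e
  go tip tip e with () ← cong proj₂ e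

quarter-cycle : ∀ n m → to (quarter m) (to (quarter n) (to (quarter m) (+ 1 , -[1+ 0 ]))) ≡ (-[1+ suc n ] , -[1+ 0 ])
quarter-cycle n m = back≡ n m (+ 1 , -[1+ 0 ])

quarter-cycle′ : ∀ n m → to (quarter m) (to (quarter n) (to (quarter m) (+ 2 , -[1+ 0 ]))) ≡ (-[1+ suc n ] , -[1+ 1 ])
quarter-cycle′ n m = back≡ n m (+ 2 , -[1+ 0 ])

-- The closed ring around the bounding rectangle

module Ring (P : List Pixel) (x0 x1 y0 y1 : ℤ) (N : ℕ) (inR : ∀ {q} → q ∈ P → Run.Within P x0 x1 y0 y1 N 0 q)
  (ψ : Iso) (n m : ℕ) (pl : Run.Placed P x0 x1 y0 y1 N (to ψ) n m 0 0 0 0) where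

  open Run P x0 x1 y0 y1 N

  corner : Pixel
  corner = to ψ (-[1+ suc n ] , -[1+ 0 ])

  abstract
    -- The colour class is chosen to contain the corner where the drawing begins, so that the robot
    -- can start with the bit `true`.
    col : Pixel → Bool
    col = colour (not (even (proj₁ corner ℤ.+ proj₂ corner)))

    col-alternating : Alternating col
    col-alternating = colour-alternating (not (even (proj₁ corner ℤ.+ proj₂ corner)))

    col-corner : col corner ≡ true
    col-corner with even (proj₁ corner ℤ.+ proj₂ corner)
    ... | true = refl
    ... | false = refl

  module _ (ψ : Iso) where
    open Side (col ∘ to ψ) (alternating-∘ ψ col-alternating) public

  loop : ℕ → Iso → List Pixel
  loop n ψ = map (to ψ) (sideFrom ψ (suc (suc n)))

  heads : ∀ ψ m → to (ψ ∘ᵢ quarter m) (pick (ψ ∘ᵢ quarter m) -[1+ suc m ]) ≡ to ψ (successor ψ)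
  heads ψ m = trans
    (cong (λ b → to ψ (to (quarter m) (if b then (-[1+ suc m ] , -[1+ 0 ]) else (-[1+ suc m ] , -[1+ 1 ]))))
      (cong (col ∘ to ψ) (quarter-corner m)))
    (cong (to ψ) (cases (col (to ψ (+ 1 , -[1+ 0 ])))))
    where
    cases : ∀ b → to (quarter m) (if b then (-[1+ suc m ] , -[1+ 0 ]) else (-[1+ suc m ] , -[1+ 1 ])) ≡
                  (if b then (+ 1 , -[1+ 0 ]) else (+ 2 , -[1+ 0 ]))
    cases true = quarter-corner m
    cases false = quarter-corner′ m

  loop-linked : ∀ n ψ {q} → q ≡ to ψ (successor ψ) → Linked DiagPair (loop n ψ ++ q ∷ [])
  loop-linked n ψ refl = subst (Linked DiagPair) (map-++ (to ψ) (sideFrom ψ (suc (suc n))) (successor ψ ∷ []))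
    (LinkedP.map⁺ (Linked.map (diagPair-to ψ) (sideFrom-linked ψ (suc (suc n)))))

  ψ₂ ψ₃ ψ₄ : Iso
  ψ₂ = ψ ∘ᵢ quarter m
  ψ₃ = ψ₂ ∘ᵢ quarter n
  ψ₄ = ψ₃ ∘ᵢ quarter m

  pl₂ : Placed (to ψ₂) m n 0 0 0 0
  pl₂ = placed-quarter pl
  pl₃ : Placed (to ψ₃) n m 0 0 0 0
  pl₃ = placed-quarter pl₂
  pl₄ : Placed (to ψ₄) m n 0 0 0 0
  pl₄ = placed-quarter pl₃

  abstract
    ring : List Pixel
    ring = loop n ψ ++ (loop m ψ₂ ++ (loop n ψ₃ ++ loop m ψ₄))

    first : Pixel
    first = to ψ (pick ψ -[1+ suc n ])

    first≡ : first ≡ to ψ₄ (successor ψ₄)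
    first≡ = sym (trans
      (cong (to ψ) (cases (col (to ψ₄ (+ 1 , -[1+ 0 ])))))
      (cong (λ b → to ψ (if b then (-[1+ suc n ] , -[1+ 0 ]) else (-[1+ suc n ] , -[1+ 1 ])))
        (cong (col ∘ to ψ) (quarter-cycle n m))))
      where
      cases : ∀ b → to (quarter m) (to (quarter n) (to (quarter m) (if b then (+ 1 , -[1+ 0 ]) else (+ 2 , -[1+ 0 ])))) ≡
                    (if b then (-[1+ suc n ] , -[1+ 0 ]) else (-[1+ suc n ] , -[1+ 1 ]))
      cases true = quarter-cycle n m
      cases false = quarter-cycle′ n m

    ring-first : ∃ λ bs → ring ≡ first ∷ bs
    ring-first = _ , refl

    ring-linked : Linked DiagPair (ring ++ first ∷ [])
    ring-linked = subst (Linked DiagPair)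
      (sym (trans (++-assoc (loop n ψ) _ (first ∷ []))
        (cong (loop n ψ ++_) (trans (++-assoc (loop m ψ₂) _ (first ∷ []))
          (cong (loop m ψ₂ ++_) (++-assoc (loop n ψ₃) _ (first ∷ [])))))))
      (linked-join (loop n ψ) (loop-linked n ψ (heads ψ m))
        (linked-join (loop m ψ₂) (loop-linked m ψ₂ (heads ψ₂ n))
          (linked-join (loop n ψ₃) (loop-linked n ψ₃ (heads ψ₃ m)) (loop-linked m ψ₄ first≡))))

  loop-∈ : ∀ {n ψ q} → q ∈ loop n ψ → ∃ λ a → InSide (suc (suc n)) a × col (to ψ a) ≡ true × q ≡ to ψ a
  loop-∈ {n} {ψ} q∈ with ∈-map⁻ (to ψ) q∈
  ... | a , a∈ , e = a , sideFrom-inSide ψ (suc (suc n)) a∈ , sideFrom-coloured ψ (suc (suc n)) a∈ , e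

  record OnSide (q : Pixel) : Set where
    constructor onSide
    field
      {ξ}    : Iso
      {k l}  : ℕ
      placed : Placed (to ξ) k l 0 0 0 0
      {a}    : Pixel
      inSide : InSide (suc (suc k)) a
      here≡  : q ≡ to ξ a
      tinted : col q ≡ true

  loop-onSide : ∀ {n m} ψ {q} → Placed (to ψ) n m 0 0 0 0 → q ∈ loop n ψ → OnSide q
  loop-onSide {n} {m} ψ pl q∈ with loop-∈ {n} {ψ} q∈
  ... | a , s , c , refl = onSide {ξ = ψ} pl s refl c

  abstract
    ring-split : ∀ {q} → q ∈ ring → (q ∈ loop n ψ ⊎ q ∈ loop m ψ₂) ⊎ (q ∈ loop n ψ₃ ⊎ q ∈ loop m ψ₄)
    ring-split q∈ with ∈-++⁻ (loop n ψ) q∈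
    ... | inj₁ q∈₁ = inj₁ (inj₁ q∈₁)
    ... | inj₂ q∈ with ∈-++⁻ (loop m ψ₂) q∈
    ...   | inj₁ q∈₂ = inj₁ (inj₂ q∈₂)
    ...   | inj₂ q∈ = inj₂ (∈-++⁻ (loop n ψ₃) q∈)

  ring-onSide : ∀ {q} → q ∈ ring → OnSide q
  ring-onSide q∈ with ring-split q∈
  ... | inj₁ (inj₁ i) = loop-onSide ψ pl i
  ... | inj₁ (inj₂ i) = loop-onSide ψ₂ pl₂ i
  ... | inj₂ (inj₁ i) = loop-onSide ψ₃ pl₃ i
  ... | inj₂ (inj₂ i) = loop-onSide ψ₄ pl₄ i

  ring-coloured : ∀ {q} → q ∈ ring → col q ≡ true
  ring-coloured q∈ = OnSide.tinted (ring-onSide q∈)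

  loop-unique : ∀ n ψ → Unique (loop n ψ)
  loop-unique n ψ = UniqueP.map⁺ (to-injective ψ) (sideFrom-unique ψ (suc (suc n)))

  private
    apart₁ : ∀ {n m} ψ {q} → q ∈ loop n ψ → q ∈ loop m (ψ ∘ᵢ quarter m) → ⊥
    apart₁ {n} {m} ψ q∈ q∈′ with loop-∈ {n} {ψ} q∈ | loop-∈ {m} {ψ ∘ᵢ quarter m} q∈′
    ... | a , s , _ , e | b , t , _ , e′ = side-disjoint₁ s t (to-injective ψ (trans (sym e) e′))

    apart₂ : ∀ {n m} ψ {q} → q ∈ loop n ψ → q ∈ loop n ((ψ ∘ᵢ quarter m) ∘ᵢ quarter n) → ⊥
    apart₂ {n} {m} ψ q∈ q∈′ with loop-∈ {n} {ψ} q∈ | loop-∈ {n} {(ψ ∘ᵢ quarter m) ∘ᵢ quarter n} q∈′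
    ... | a , s , _ , e | b , t , _ , e′ = side-disjoint₂ s t (to-injective ψ (trans (sym e) e′))

    apart₃ : ∀ {q} → q ∈ loop n ψ → q ∈ loop m ψ₄ → ⊥
    apart₃ q∈ q∈′ with loop-∈ {n} {ψ} q∈ | loop-∈ {m} {ψ₄} q∈′
    ... | a , s , _ , e | b , t , _ , e′ = side-disjoint₃ s t (to-injective ψ (trans (sym e) e′))

  abstract
    ring-unique : Unique ring
    ring-unique = UniqueP.++⁺ (loop-unique n ψ)
      (UniqueP.++⁺ (loop-unique m ψ₂)
        (UniqueP.++⁺ (loop-unique n ψ₃) (loop-unique m ψ₄) λ (a , b) → apart₁ {n} {m} ψ₃ a b)
        λ (a , b) → case₂ a (∈-++⁻ (loop n ψ₃) b))
      λ (a , b) → case₁ a (∈-++⁻ (loop m ψ₂) b)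
      where
      case₂ : ∀ {q} → q ∈ loop m ψ₂ → q ∈ loop n ψ₃ ⊎ q ∈ loop m ψ₄ → ⊥
      case₂ a (inj₁ b) = apart₁ {m} {n} ψ₂ a b
      case₂ a (inj₂ b) = apart₂ {m} {n} ψ₂ a b
      case₁ : ∀ {q} → q ∈ loop n ψ → q ∈ loop m ψ₂ ⊎ q ∈ loop n ψ₃ ++ loop m ψ₄ → ⊥
      case₁ a (inj₁ b) = apart₁ {n} {m} ψ a b
      case₁ a (inj₂ b) with ∈-++⁻ (loop n ψ₃) b
      ... | inj₁ b = apart₂ {n} {m} ψ a b
      ... | inj₂ b = apart₃ a b

    ring-length : length ring ≤ 4 * (4 + (n + m))
    ring-length = begin
      length ring ≡⟨ trans (length-++ (loop n ψ)) (cong (length (loop n ψ) ℕ.+_) (trans (length-++ (loop m ψ₂))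
        (cong (length (loop m ψ₂) ℕ.+_) (length-++ (loop n ψ₃))))) ⟩
      length (loop n ψ) + (length (loop m ψ₂) + (length (loop n ψ₃) + length (loop m ψ₄)))
        ≤⟨ ℕP.+-mono-≤ (ln′ n ψ (ℕP.m≤m+n n m)) (ℕP.+-mono-≤ (ln′ m ψ₂ (ℕP.m≤n+m m n))
             (ℕP.+-mono-≤ (ln′ n ψ₃ (ℕP.m≤m+n n m)) (ℕP.≤-trans (ln′ m ψ₄ (ℕP.m≤n+m m n)) (ℕP.≤-reflexive (sym (ℕP.+-identityʳ _)))))) ⟩
      4 * (4 + (n + m)) ∎
      where
      open ℕP.≤-Reasoning
      ln′ : ∀ k ξ → k ≤ n + m → length (loop k ξ) ≤ 4 + (n + m)
      ln′ k ξ le = ℕP.≤-trans (ℕP.≤-reflexive (length-map (to ξ) (sideFrom ξ (suc (suc k)))))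
        (ℕP.≤-trans (sideFrom-length ξ (suc (suc k))) (ℕP.+-monoʳ-≤ 4 le))

  record Frame (ξ : Iso) (k l : ℕ) : Set where
    field
      placed : Placed (to ξ) k l 0 0 0 0
      covers : ∀ {q} → Lane k q → col (to ξ q) ≡ true → to ξ q ∈ ring

  private
    -- A lane contains one pixel that the loop of its side lacks, the inner corner (1, -1); `nxt`
    -- supplies it from the loop of the next side.
    covering : ∀ {k} ξ → (∀ {q} → q ∈ loop k ξ → q ∈ ring) →
      (col (to ξ (+ 1 , -[1+ 0 ])) ≡ true → to ξ (+ 1 , -[1+ 0 ]) ∈ ring) →
      ∀ {q} → Lane k q → col (to ξ q) ≡ true → to ξ q ∈ ring
    covering {k} ξ inc nxt (inner (mid le)) c = inc (∈-map⁺ (to ξ) (inner-∈ ξ (suc (suc k)) le c))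
    covering {k} ξ inc nxt (outer (mid le)) c = inc (∈-map⁺ (to ξ) (outer-∈ ξ (suc (suc k)) le c))
    covering {k} ξ inc nxt (outer last) c = inc (∈-map⁺ (to ξ) (tip-∈ ξ (suc (suc k)) c))
    covering {k} ξ inc nxt (inner last) c = nxt c

    first-∈ : ∀ l ξ q → to ξ (-[1+ suc l ] , -[1+ 0 ]) ≡ q → col q ≡ true → q ∈ loop l ξ
    first-∈ l ξ q refl c = ∈-map⁺ (to ξ) (inner-∈ ξ (suc (suc l)) ℕP.≤-refl c)

    abstract
      inc₁ : ∀ {q} → q ∈ loop n ψ → q ∈ ring
      inc₁ = ∈-++⁺ˡ
      inc₂ : ∀ {q} → q ∈ loop m ψ₂ → q ∈ ring
      inc₂ = ∈-++⁺ʳ (loop n ψ) ∘ ∈-++⁺ˡ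
      inc₃ : ∀ {q} → q ∈ loop n ψ₃ → q ∈ ring
      inc₃ = ∈-++⁺ʳ (loop n ψ) ∘ ∈-++⁺ʳ (loop m ψ₂) ∘ ∈-++⁺ˡ
      inc₄ : ∀ {q} → q ∈ loop m ψ₄ → q ∈ ring
      inc₄ = ∈-++⁺ʳ (loop n ψ) ∘ ∈-++⁺ʳ (loop m ψ₂) ∘ ∈-++⁺ʳ (loop n ψ₃)

  frame₁ : Frame ψ n m
  frame₁ = record { placed = pl ; covers = covering ψ inc₁ (inc₂ ∘ first-∈ m ψ₂ _ (cong (to ψ) (quarter-corner m))) }

  frame₂ : Frame ψ₂ m n
  frame₂ = record { placed = pl₂ ; covers = covering ψ₂ inc₂ (inc₃ ∘ first-∈ n ψ₃ _ (cong (to ψ₂) (quarter-corner n))) }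

  frame₃ : Frame ψ₃ n m
  frame₃ = record { placed = pl₃ ; covers = covering ψ₃ inc₃ (inc₄ ∘ first-∈ m ψ₄ _ (cong (to ψ₃) (quarter-corner m))) }

  frame₄ : Frame ψ₄ m n
  frame₄ = record { placed = pl₄ ; covers = covering ψ₄ inc₄ (inc₁ ∘ first-∈ n ψ _ (sym (cong (to ψ) (quarter-cycle n m)))) }

-- The ring as a bounding box

module Box (P : List Pixel) (x0 x1 y0 y1 : ℤ) (N : ℕ) (inR : ∀ {q} → q ∈ P → Run.Within P x0 x1 y0 y1 N 0 q)
  (ψ : Iso) (n m : ℕ) (pl : Run.Placed P x0 x1 y0 y1 N (to ψ) n m 0 0 0 0) where

  open Run P x0 x1 y0 y1 N
  open Ring P x0 x1 y0 y1 N inR ψ n m pl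

  lane-far : ∀ {k l q ξ} → Placed (to ξ) k l 0 0 0 0 → Lane k q → ¬ Within 1 (to ξ q)
  lane-far {q = q} {ξ} pl s w = absurd s (subst (λ z → + 0 ℤ.≤ z ℤ.+ + 1) (Placed.north≡ pl q)
      (proj₁ (proj₂ (Placed.within⁻ pl 1 (to ξ q) w))))
    where
    absurd : ∀ {k q} → Lane k q → ¬ (+ 0 ℤ.≤ (proj₂ q ℤ.- + 1 ℤ.+ + 0) ℤ.+ + 1)
    absurd (inner _) ()
    absurd (outer _) ()

  col-bounds : ∀ {k x} → Col k x → -[1+ suc k ] ℤ.≤ x × x ℤ.≤ + 1
  col-bounds (mid {zero} le) = -≤+ , +≤+ z≤n
  col-bounds (mid {suc _} (s≤s le)) = -≤- le , -≤+
  col-bounds last = -≤+ , +≤+ ℕP.≤-refl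

  lane-near : ∀ {k l q ξ} → Placed (to ξ) k l 0 0 0 0 → Lane k q → Within 3 (to ξ q)
  lane-near pl (inner c) = nearby pl (proj₁ (col-bounds c)) (proj₂ (col-bounds c)) (-≤- z≤n) -≤+
  lane-near pl (outer c) = nearby pl (proj₁ (col-bounds c)) (proj₂ (col-bounds c)) (-≤- ℕP.≤-refl) -≤+

  inSide-lane : ∀ {k q} → InSide (suc (suc k)) q → Lane k q
  inSide-lane (inner le) = inner (mid le)
  inSide-lane (outer le) = outer (mid le)
  inSide-lane tip = outer last

  ring-far : ∀ {q} → q ∈ ring → ¬ Within 1 q
  ring-far q∈ with ring-onSide q∈
  ... | onSide {ξ} pl s refl _ = lane-far {ξ = ξ} pl (inSide-lane s)

  ring-near : ∀ {q} → q ∈ ring → Within 3 q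
  ring-near q∈ with ring-onSide q∈
  ... | onSide {ξ} pl s refl _ = lane-near {ξ = ξ} pl (inSide-lane s)

  within-suc : ∀ k q → Within k q → Within (suc k) q
  within-suc k (x , y) ((a , b) , (c , d)) =
    (f (x ℤ.- x0) a , f (x1 ℤ.- x) b) , (f (y ℤ.- y0) c , f (y1 ℤ.- y) d)
    where
    l : ∀ G K → G ℤ.+ K ℤ.+ + 1 ≡ G ℤ.+ (+ 1 ℤ.+ K)
    l = solve-∀
    f : ∀ g → + 0 ℤ.≤ g ℤ.+ + k → + 0 ℤ.≤ g ℤ.+ + suc k
    f g p = subst (+ 0 ℤ.≤_) (l g (+ k)) (0≤+ p (+≤+ z≤n))

  target : Grid
  target q = gridOf P q ∨ does (q ∈? ring)

  target-lane : ∀ {ξ k l q} → Frame ξ k l → Lane k q → target (to ξ q) ≡ col (to ξ q)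
  target-lane {ξ} {k} {l} {q} f s with col (to ξ q) in e
  ... | true = trans (cong (gridOf P (to ξ q) ∨_) (dec-true (to ξ q ∈? ring) (Frame.covers f s e))) (∨-true _)
    where
    ∨-true : ∀ b → b ∨ true ≡ true
    ∨-true true = refl
    ∨-true false = refl
  ... | false = cong₂ _∨_
    (gridOf-false (λ q∈ → lane-far {ξ = ξ} (Frame.placed f) s (within-suc 0 (to ξ q) (inR q∈))))
    (dec-false (to ξ q ∈? ring) λ q∈ → absurd (trans (sym e) (ring-coloured q∈)))
    where
    absurd : false ≢ true
    absurd ()

  target-near : ∀ {q} → q ∉ P → Within 1 q → target q ≡ false
  target-near {q} q∉ w = cong₂ _∨_ (gridOf-false q∉) (dec-false (q ∈? ring) (λ q∈ → ring-far q∈ w))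

  target⁻ : ∀ {q} → target q ≡ true → q ∈ P ⊎ q ∈ ring
  target⁻ {q} e with q ∈? P | q ∈? ring
  ... | yes q∈ | _ = inj₁ q∈
  ... | no _ | yes q∈ = inj₂ q∈

  target⁺ : ∀ {q} → q ∈ P ⊎ q ∈ ring → target q ≡ true
  target⁺ {q} (inj₁ q∈) = cong (_∨ does (q ∈? ring)) (gridOf⁺ q∈)
  target⁺ {q} (inj₂ q∈) with gridOf P q
  ... | true = refl
  ... | false = dec-true (q ∈? ring) q∈

  private
    Peeled : ℕ → Pixel → Set
    Peeled k (x , y) = (x ℤ.- x0 ℤ.+ + k ≡ + 0 ⊎ x1 ℤ.- x ℤ.+ + k ≡ + 0) ⊎
                       (y ℤ.- y0 ℤ.+ + k ≡ + 0 ⊎ y1 ℤ.- y ℤ.+ + k ≡ + 0)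

    peel₁ : ∀ g k → + 0 ℤ.≤ g ℤ.+ + suc k → + 0 ℤ.≤ g ℤ.+ + k ⊎ g ℤ.+ + suc k ≡ + 0
    peel₁ g k p = go (g ℤ.+ + suc k) (l g (+ k)) p
      where
      l : ∀ G K → G ℤ.+ K ≡ G ℤ.+ (+ 1 ℤ.+ K) ℤ.- + 1
      l = solve-∀
      go : ∀ z → g ℤ.+ + k ≡ z ℤ.- + 1 → + 0 ℤ.≤ z → + 0 ℤ.≤ g ℤ.+ + k ⊎ z ≡ + 0
      go (+ zero) e _ = inj₂ refl
      go (+ suc z) e _ = inj₁ (subst (+ 0 ℤ.≤_) (sym e) (+≤+ z≤n))

    peel : ∀ k q → Within (suc k) q → Within k q ⊎ Peeled (suc k) q
    peel k (x , y) ((a , b) , (c , d)) with peel₁ (x ℤ.- x0) k a | peel₁ (x1 ℤ.- x) k b | peel₁ (y ℤ.- y0) k c | peel₁ (y1 ℤ.- y) k d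
    ... | inj₂ e | _ | _ | _ = inj₂ (inj₁ (inj₁ e))
    ... | inj₁ _ | inj₂ e | _ | _ = inj₂ (inj₁ (inj₂ e))
    ... | inj₁ _ | inj₁ _ | inj₂ e | _ = inj₂ (inj₂ (inj₁ e))
    ... | inj₁ _ | inj₁ _ | inj₁ _ | inj₂ e = inj₂ (inj₂ (inj₂ e))
    ... | inj₁ a′ | inj₁ b′ | inj₁ c′ | inj₁ d′ = inj₁ ((a′ , b′) , (c′ , d′))

    module Rect (k : ℕ) (A₀ A₁ C₀ C₁ : ℤ)
      (eA₀ : ∀ x → x ℤ.- A₀ ≡ x ℤ.- x0 ℤ.+ + k) (eA₁ : ∀ x → A₁ ℤ.- x ≡ x1 ℤ.- x ℤ.+ + k)
      (eC₀ : ∀ y → y ℤ.- C₀ ≡ y ℤ.- y0 ℤ.+ + k) (eC₁ : ∀ y → C₁ ℤ.- y ≡ y1 ℤ.- y ℤ.+ + k) where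

      inRect : ∀ q → Within k q → InRect A₀ A₁ C₀ C₁ q
      inRect (x , y) ((a , b) , (c , d)) =
        (ℤP.0≤i-j⇒j≤i (subst (+ 0 ℤ.≤_) (sym (eA₀ x)) a) , ℤP.0≤i-j⇒j≤i (subst (+ 0 ℤ.≤_) (sym (eA₁ x)) b)) ,
        (ℤP.0≤i-j⇒j≤i (subst (+ 0 ℤ.≤_) (sym (eC₀ y)) c) , ℤP.0≤i-j⇒j≤i (subst (+ 0 ℤ.≤_) (sym (eC₁ y)) d))

      onBoundary : ∀ q → Within k q → Peeled k q → OnRectBoundary A₀ A₁ C₀ C₁ q
      onBoundary (x , y) w p = inRect _ w , go p
        where
        go : Peeled k (x , y) → x ≡ A₀ ⊎ x ≡ A₁ ⊎ y ≡ C₀ ⊎ y ≡ C₁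
        go (inj₁ (inj₁ e)) = inj₁ (ℤP.i-j≡0⇒i≡j x A₀ (trans (eA₀ x) e))
        go (inj₁ (inj₂ e)) = inj₂ (inj₁ (sym (ℤP.i-j≡0⇒i≡j A₁ x (trans (eA₁ x) e))))
        go (inj₂ (inj₁ e)) = inj₂ (inj₂ (inj₁ (ℤP.i-j≡0⇒i≡j y C₀ (trans (eC₀ y) e))))
        go (inj₂ (inj₂ e)) = inj₂ (inj₂ (inj₂ (sym (ℤP.i-j≡0⇒i≡j C₁ y (trans (eC₁ y) e)))))

    l₁ : ∀ A x → x ℤ.- (A ℤ.- + 2) ≡ x ℤ.- A ℤ.+ + 2
    l₁ = solve-∀
    l₂ : ∀ A x → A ℤ.+ + 2 ℤ.- x ≡ A ℤ.- x ℤ.+ + 2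
    l₂ = solve-∀
    l₃ : ∀ A x → x ℤ.- (A ℤ.- + 2 ℤ.- ℤ.1ℤ) ≡ x ℤ.- A ℤ.+ + 3
    l₃ = solve-∀
    l₄ : ∀ A x → A ℤ.+ + 2 ℤ.+ ℤ.1ℤ ℤ.- x ≡ A ℤ.- x ℤ.+ + 3
    l₄ = solve-∀

    module Inner = Rect 2 (x0 ℤ.- + 2) (x1 ℤ.+ + 2) (y0 ℤ.- + 2) (y1 ℤ.+ + 2) (l₁ x0) (l₂ x1) (l₁ y0) (l₂ y1)
    module Outer = Rect 3 (x0 ℤ.- + 2 ℤ.- ℤ.1ℤ) (x1 ℤ.+ + 2 ℤ.+ ℤ.1ℤ) (y0 ℤ.- + 2 ℤ.- ℤ.1ℤ) (y1 ℤ.+ + 2 ℤ.+ ℤ.1ℤ)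
      (l₃ x0) (l₄ x1) (l₃ y0) (l₄ y1)

    ring-lanes : ∀ {q} → q ∈ ring → OnRectBoundary (x0 ℤ.- + 2) (x1 ℤ.+ + 2) (y0 ℤ.- + 2) (y1 ℤ.+ + 2) q ⊎
      OnRectBoundary (x0 ℤ.- + 2 ℤ.- ℤ.1ℤ) (x1 ℤ.+ + 2 ℤ.+ ℤ.1ℤ) (y0 ℤ.- + 2 ℤ.- ℤ.1ℤ) (y1 ℤ.+ + 2 ℤ.+ ℤ.1ℤ) q
    ring-lanes {q} q∈ with peel 2 q (ring-near q∈)
    ... | inj₂ p = inj₂ (Outer.onBoundary q (ring-near q∈) p)
    ... | inj₁ w with peel 1 q w
    ...   | inj₂ p = inj₁ (Inner.onBoundary q w p)
    ...   | inj₁ w₁ = ⊥-elim (ring-far q∈ w₁)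

    within? : ∀ k q → Dec (Within k q)
    within? k (x , y) = ((+ 0 ℤ.≤? _) ×-dec (+ 0 ℤ.≤? _)) ×-dec ((+ 0 ℤ.≤? _) ×-dec (+ 0 ℤ.≤? _))
      where open import Relation.Nullary.Decidable using (_×-dec_)

    -- A step across a side goes from the inner to the outer lane and hits the coloured one of the two.
    crossing : ∀ {ξ k l} → Frame ξ k l → ∀ u → Within 2 u → ¬ Within 2 (move (out ξ) u) →
      u ∈ ring ⊎ move (out ξ) u ∈ ring
    crossing {ξ} {k} {l} f u w nw with from ξ u | to-from ξ u
    ... | (x , y) | refl with Placed.within⁻ (Frame.placed f) 2 (to ξ (x , y)) w
    ...   | (a , b) , (c , d) = decide (col (to ξ (x , y))) refl
      where
      open Placed (Frame.placed f)
      m₁ : ∀ Y L → L ℤ.+ + 0 ℤ.- Y ℤ.+ + 2 ℤ.+ + 1 ≡ L ℤ.+ + 0 ℤ.- (Y ℤ.- + 1) ℤ.+ + 2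
      m₁ = solve-∀
      m₂ : ∀ Y → Y ≡ Y ℤ.- + 1 ℤ.- + 1 ℤ.+ + 0 ℤ.+ + 2
      m₂ = solve-∀
      m₃ : ∀ Y → Y ℤ.- + 1 ℤ.+ + 0 ℤ.+ + 2 ≡ Y ℤ.+ + 1
      m₃ = solve-∀
      m₄ : ∀ X → + 0 ℤ.- + 1 ℤ.- X ℤ.+ + 2 ≡ + 1 ℤ.- X
      m₄ = solve-∀
      m₅ : ∀ X K → X ℤ.+ (K ℤ.+ + 0) ℤ.+ + 2 ≡ X ℤ.- (ℤ.- (+ 2 ℤ.+ K))
      m₅ = solve-∀
      below : to ξ (x , y ℤ.- + 1) ≡ move (out ξ) (to ξ (x , y))
      below = to-move ξ down (x , y)
      -- From a nonnegative row the outward step would stay within distance 2, so the pixel lies in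
      -- row -1, the inner lane.
      y<0 : ¬ (+ 0 ℤ.≤ y)
      y<0 0≤y = nw (subst (Within 2) below (within⁺ 2 (to ξ (x , y ℤ.- + 1))
        (subst (λ z → + 0 ℤ.≤ z ℤ.+ + 2) (sym (west≡ _)) (subst (λ z → + 0 ℤ.≤ z ℤ.+ + 2) (west≡ _) a))
        (subst (λ z → + 0 ℤ.≤ z ℤ.+ + 2) (sym (east≡ _)) (subst (λ z → + 0 ℤ.≤ z ℤ.+ + 2) (east≡ _) b))
        (subst (λ z → + 0 ℤ.≤ z ℤ.+ + 2) (sym (north≡ _)) (subst (+ 0 ℤ.≤_) (m₂ y) 0≤y))
        (subst (λ z → + 0 ℤ.≤ z ℤ.+ + 2) (sym (south≡ _)) (subst (+ 0 ℤ.≤_) (m₁ y (+ l))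
          (0≤+ (subst (λ z → + 0 ℤ.≤ z ℤ.+ + 2) (south≡ _) d) (+≤+ z≤n))))))
      minus : ∀ y → ¬ (+ 0 ℤ.≤ y) → + 0 ℤ.≤ y ℤ.+ + 1 → y ≡ -[1+ 0 ]
      minus (+ y) ny _ = ⊥-elim (ny (+≤+ z≤n))
      minus -[1+ zero ] _ _ = refl
      y≡ : y ≡ -[1+ 0 ]
      y≡ = minus y y<0 (subst (+ 0 ℤ.≤_) (m₃ y) (subst (λ z → + 0 ℤ.≤ z ℤ.+ + 2) (north≡ _) c))
      toCol : ∀ x → -[1+ suc k ] ℤ.≤ x → x ℤ.≤ + 1 → Col k x
      toCol (+ zero) _ _ = mid z≤n
      toCol (+ suc zero) _ _ = last
      toCol (+ suc (suc x)) _ (+≤+ (s≤s ()))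
      toCol -[1+ i ] (-≤- le) _ = mid (s≤s le)
      column-x : Col k x
      column-x = toCol x
        (ℤP.0≤i-j⇒j≤i (subst (+ 0 ℤ.≤_) (m₅ x (+ k)) (subst (λ z → + 0 ℤ.≤ z ℤ.+ + 2) (west≡ _) a)))
        (ℤP.0≤i-j⇒j≤i (subst (+ 0 ℤ.≤_) (m₄ x) (subst (λ z → + 0 ℤ.≤ z ℤ.+ + 2) (east≡ _) b)))
      decide : ∀ c → col (to ξ (x , y)) ≡ c → to ξ (x , y) ∈ ring ⊎ move (out ξ) (to ξ (x , y)) ∈ ring
      decide true e = inj₁ (Frame.covers f (subst (λ z → Lane k (x , z)) (sym y≡) (inner column-x)) e)
      decide false e = inj₂ (subst (_∈ ring) below (Frame.covers f
        (subst (λ z → Lane k (x , z ℤ.- + 1)) (sym y≡) (outer column-x))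
        (trans (cong col below) (trans (col-alternating (out ξ) _) (cong not e)))))

    -- The outward directions of the four frames are the four directions of the grid, so the
    -- direction of the step selects the side that is crossed.
    crossing-any : ∀ d u → Within 2 u → ¬ Within 2 (move d u) → u ∈ ring ⊎ move d u ∈ ring
    crossing-any d u w nw with unact ψ d | act-unact ψ d
    ... | down | refl = crossing {ψ} frame₁ u w nw
    ... | right | refl = crossing {ψ₂} frame₂ u w nw
    ... | up | refl = crossing {ψ₃} frame₃ u w nw
    ... | left | refl = crossing {ψ₄} frame₄ u w nw

    head-∈ : ∀ {u q xs} → u ∈ ring → Walk u q xs → Any (_∈ ring) xs
    head-∈ u∈ here = here u∈
    head-∈ u∈ (there _ _) = here u∈

    escape : ∀ {u q xs} → Within 2 u → ¬ Within 2 q → Walk u q xs → Any (_∈ ring) xs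
    escape w nw here = ⊥-elim (nw w)
    escape {u} w nw (there (d , refl) walk) with within? 2 (move d u)
    ... | yes w′ = there (escape w′ nw walk)
    ... | no nw′ with crossing-any d u w nw′
    ...   | inj₁ u∈ = here u∈
    ...   | inj₂ v∈ = there (head-∈ v∈ walk)

    -- The inequalities say that both offsets lie between -1 and 1, so one computation handles all
    -- edge and corner neighbours.
    touching : ∀ x y {o₁ o₂} → (+ 0 ℤ.≤ + 1 ℤ.- o₁ × + 0 ℤ.≤ + 1 ℤ.+ o₁) → (+ 0 ℤ.≤ + 1 ℤ.- o₂ × + 0 ℤ.≤ + 1 ℤ.+ o₂) →
      Within 0 (x ℤ.+ o₁ , y ℤ.+ o₂) → Within 1 (x , y)
    touching x y {o₁} {o₂} (p , q) (r , s) ((a , b) , (c , d)) =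
      (subst (+ 0 ℤ.≤_) (k₁ x o₁ x0) (0≤+ a p) , subst (+ 0 ℤ.≤_) (k₂ x o₁ x1) (0≤+ b q)) ,
      (subst (+ 0 ℤ.≤_) (k₁ y o₂ y0) (0≤+ c r) , subst (+ 0 ℤ.≤_) (k₂ y o₂ y1) (0≤+ d s))
      where
      k₁ : ∀ x o X → x ℤ.+ o ℤ.- X ℤ.+ + 0 ℤ.+ (+ 1 ℤ.- o) ≡ x ℤ.- X ℤ.+ + 1
      k₁ = solve-∀
      k₂ : ∀ x o X → X ℤ.- (x ℤ.+ o) ℤ.+ + 0 ℤ.+ (+ 1 ℤ.+ o) ≡ X ℤ.- x ℤ.+ + 1
      k₂ = solve-∀

    o₊ : + 0 ℤ.≤ + 0 × + 0 ℤ.≤ + 2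
    o₊ = +≤+ z≤n , +≤+ z≤n
    o₋ : + 0 ℤ.≤ + 2 × + 0 ℤ.≤ + 0
    o₋ = +≤+ z≤n , +≤+ z≤n
    o₀ : + 0 ℤ.≤ + 1 × + 0 ℤ.≤ + 1
    o₀ = +≤+ z≤n , +≤+ z≤n

    still : ∀ z → z ≡ z ℤ.+ + 0
    still z = sym (ℤP.+-identityʳ z)

    touch-adj : ∀ d b → Within 0 (move d b) → Within 1 b
    touch-adj up (x , y) w = touching x y o₀ o₊ (subst (λ z → Within 0 (z , y ℤ.+ ℤ.1ℤ)) (still x) w)
    touch-adj down (x , y) w = touching x y o₀ o₋ (subst (λ z → Within 0 (z , y ℤ.- ℤ.1ℤ)) (still x) w)
    touch-adj left (x , y) w = touching x y o₋ o₀ (subst (λ z → Within 0 (x ℤ.- ℤ.1ℤ , z)) (still y) w)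
    touch-adj right (x , y) w = touching x y o₊ o₀ (subst (λ z → Within 0 (x ℤ.+ ℤ.1ℤ , z)) (still y) w)

    touch-diag : ∀ {h v} → Horizontal h → Vertical v → ∀ b → Within 0 (move v (move h b)) → Within 1 b
    touch-diag hl vu (x , y) w = touching x y o₋ o₊ w
    touch-diag hl vd (x , y) w = touching x y o₋ o₋ w
    touch-diag hr vu (x , y) w = touching x y o₊ o₊ w
    touch-diag hr vd (x , y) w = touching x y o₊ o₋ w

  ring-isBoundingBox : IsBoundingBox P ring
  ring-isBoundingBox = record
    { ring = first , proj₁ ring-first , proj₂ ring-first ,
        subst (λ B → Linked DiagPair (B ++ first ∷ [])) (proj₂ ring-first) ring-linked
    ; distinct = ring-unique
    ; a0 = x0 ℤ.- + 2 ; a1 = x1 ℤ.+ + 2 ; c0 = y0 ℤ.- + 2 ; c1 = y1 ℤ.+ + 2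
    ; lanes = All.tabulate ring-lanes
    ; encloses = λ {p} {q} p∈ nq walk → escape (within-suc 1 p (within-suc 0 p (inR p∈)))
        (λ w → nq (Outer.inRect q (within-suc 2 q w))) walk
    ; noTouch = λ {b} {p} b∈ p∈ →
        (λ { refl → ring-far b∈ (within-suc 0 p (inR p∈)) }) ,
        (λ { (d , refl) → ring-far b∈ (touch-adj d b (inR p∈)) }) ,
        (λ { (h , v , hh , vv , refl) → ring-far b∈ (touch-diag hh vv b (inR p∈)) })
    }

-- Five steps per column, three in the last one.
lapCost : ℕ → ℕ → ℕ
lapCost zero K = 8 + K
lapCost (suc i) K = 5 + lapCost i K

-- Drawing the ring

module Build (P : List Pixel) (x0 x1 y0 y1 : ℤ) (N : ℕ) (inR : ∀ {q} → q ∈ P → Run.Within P x0 x1 y0 y1 N 0 q)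
  (ψ : Iso) (n m : ℕ) (pl : Run.Placed P x0 x1 y0 y1 N (to ψ) n m 0 0 0 0)
  (G₀ : Grid) (mem : Memory)
  (marked₀ : Marked (cells n m false false) full (G₀ ∘ to ψ) (gridOf P ∘ to ψ) mem)
  (room : 16 + 4 * (4 + (n + m)) ≤ N) where

  open Run P x0 x1 y0 y1 N
  open Ring P x0 x1 y0 y1 N inR ψ n m pl
  open Box P x0 x1 y0 y1 N inR ψ n m pl

  -- `W` lists the pixels written so far. Every write agrees with `target`, so neither the order of
  -- the writes nor the double visit of inner corners matters.
  paint : List Pixel → Grid
  paint W q = if does (q ∈? W) then target q else G₀ q

  paint-in : ∀ {W q} → q ∈ W → paint W q ≡ target q
  paint-in {W} {q} q∈ = cong (if_then target q else G₀ q) (dec-true (q ∈? W) q∈)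

  paint-out : ∀ {W q} → q ∉ W → paint W q ≡ G₀ q
  paint-out {W} {q} q∉ = cong (if_then target q else G₀ q) (dec-false (q ∈? W) q∉)

  in-case : ∀ {A : Set} (W : List Pixel) q → (q ∈ W → A) → (q ∉ W → A) → A
  in-case W q f g with q ∈? W
  ... | yes q∈ = f q∈
  ... | no q∉ = g q∉

  paint-both : ∀ {b} W q → target q ≡ b → G₀ q ≡ b → paint W q ≡ b
  paint-both W q t g = in-case W q (λ q∈ → trans (paint-in q∈) t) (λ q∉ → trans (paint-out q∉) g)

  paint-there : ∀ {W p q} → q ≢ p → paint (p ∷ W) q ≡ paint W q
  paint-there {W} {p} {q} ne = in-case W q
    (λ q∈ → trans (paint-in {p ∷ W} (there q∈)) (sym (paint-in q∈)))
    (λ q∉ → trans (paint-out {p ∷ W} (λ { (here e) → ne e ; (there q∈) → q∉ q∈ })) (sym (paint-out q∉)))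

  stamps : List Pixel
  stamps = map (to ψ) (cellList (cells n m false false))

  -- Sixteen marker cells and the ring: this cover is valid at every moment of the drawing and
  -- explains the form of `room`.
  debris : List Pixel
  debris = stamps ++ ring

  paint-tiles : ∀ W q → paint W q ≡ true → q ∈ P ⊎ q ∈ debris
  paint-tiles W q e = in-case W q
    (λ q∈ → Data.Sum.map₂ (∈-++⁺ʳ stamps) (target⁻ (trans (sym (paint-in q∈)) e)))
    (λ q∉ → Data.Sum.map (λ t → subst (_∈ P) (to-from ψ q) (gridOf⁻ t))
      (λ i → ∈-++⁺ˡ {xs = stamps} {ring} (subst (_∈ stamps) (to-from ψ q) (∈-map⁺ (to ψ) i)))
      (marked-tiles marked₀ (from ψ q) (trans (cong G₀ (to-from ψ q)) (trans (sym (paint-out q∉)) e))))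

  debris-length : length debris ≤ N
  debris-length = ℕP.≤-trans
    (ℕP.≤-reflexive (length-++ stamps {ring}))
    (ℕP.≤-trans (ℕP.+-monoʳ-≤ 16 ring-length) room)

  record Painting (ξ : Iso) (l : Local) (p : Pixel) (W : List Pixel) (c : Conf robot) : Set where
    constructor painting
    field
      sees    : View ξ l (Conf.grid c ∘ to ξ) p c
      painted : ∀ q → Conf.grid c q ≡ paint W q

  open Painting

  painting-ok : ∀ {ξ l p W c} → Painting ξ l p W c → halted l ≡ false → Within 3 (to ξ p) → Ok c
  painting-ok {ξ} {W = W} v h w = record
    { running = Ok.running base
    ; inside = Ok.inside base
    ; tiles = debris , debris-length , λ q e → paint-tiles W q (trans (sym (Painting.painted v q)) e)
    }
    where
    base = view-ok (Painting.sees v) h w (map (from ξ) debris)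
      (subst (ℕ._≤ N) (sym (length-map (from ξ) debris)) debris-length)
      (λ q e → Data.Sum.map gridOf⁺ (λ i → subst (_∈ map (from ξ) debris) (from-to ξ q) (∈-map⁺ (from ξ) i))
        (paint-tiles W (to ξ q) (trans (sym (Painting.painted v (to ξ q))) e)))

  private
    kept : ∀ {ξ p W} {g g′ : Grid} → (∀ q → g q ≡ paint W q) →
      (∀ q → g′ (to ξ q) ≡ set (g ∘ to ξ) p (g (to ξ p)) q) → ∀ q → g′ q ≡ paint W q
    kept {ξ} {p} {W} {g} {g′} pt e q = trans (cong g′ (sym (to-from ξ q))) (trans (e (from ξ q))
      (trans (set-keep (g ∘ to ξ) p (from ξ q)) (trans (cong g (to-from ξ q)) (pt q))))

    written : ∀ {ξ p W b} {g g′ : Grid} → b ≡ target (to ξ p) → (∀ q → g q ≡ paint W q) →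
      (∀ q → g′ (to ξ q) ≡ set (g ∘ to ξ) p b q) → ∀ q → g′ q ≡ paint (to ξ p ∷ W) q
    written {ξ} {p} {W} {b} {g} {g′} bt pt e q = trans (cong g′ (sym (to-from ξ q))) (trans (e (from ξ q))
      (pixel-case (from ξ q) p
        (λ { refl → trans (set-hit (g ∘ to ξ) p b) (trans bt (trans (sym (paint-in {to ξ p ∷ W} (here refl)))
              (cong (paint (to ξ p ∷ W)) (to-from ξ q)))) })
        (λ ne → trans (set-miss (g ∘ to ξ) p b ne) (trans (cong g (to-from ξ q)) (trans (pt q)
              (sym (paint-there {W} {to ξ p} {q} λ e → ne (trans (cong (from ξ) e) (from-to ξ p)))))))))

  keepP : ∀ {Φ K ξ l p W c l′ b d} p′ → Painting ξ l p W c → halted l ≡ false → Within 3 (to ξ p) →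
    Conf.grid c (to ξ p) ≡ b → δL l b ≡ (l′ , straight , b , d) → move d p ≡ p′ →
    (∀ c′ → Painting ξ l′ p′ W c′ → Ev Φ K c′) → Ev Φ (suc K) c
  keepP {ξ = ξ} {p = p} {W} p′ v h w refl e refl cont with view-step (Painting.sees v) e
  ... | view s′ q′ g′ = later (painting-ok v h w)
    (cont _ (painting (view s′ q′ (λ _ → refl)) (kept {ξ} {p} {W} (Painting.painted v) g′)))

  writeP : ∀ {Φ K ξ l p W c l′ b w d} p′ → Painting ξ l p W c → halted l ≡ false → Within 3 (to ξ p) →
    Conf.grid c (to ξ p) ≡ b → δL l b ≡ (l′ , straight , w , d) → move d p ≡ p′ → w ≡ target (to ξ p) →
    (∀ c′ → Painting ξ l′ p′ (to ξ p ∷ W) c′ → Ev Φ K c′) → Ev Φ (suc K) c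
  writeP {ξ = ξ} {p = p} {W} p′ v h w refl e refl t cont with view-step (Painting.sees v) e
  ... | view s′ q′ g′ = later (painting-ok v h w)
    (cont _ (painting (view s′ q′ (λ _ → refl)) (written {ξ} {p} {W} t (Painting.painted v) g′)))

  turnP : ∀ {Φ K ξ l p W c l′ τ b d} κ p′ → Turns τ κ → Painting ξ l p W c → halted l ≡ false → Within 3 (to ξ p) →
    Conf.grid c (to ξ p) ≡ b → δL l b ≡ (l′ , τ , b , d) → move d p ≡ to κ p′ →
    (∀ c′ → Painting (ξ ∘ᵢ κ) l′ p′ W c′ → Ev Φ K c′) → Ev Φ (suc K) c
  turnP {ξ = ξ} {p = p} {W} {c} κ p′ t v h w refl e m cont with view-turn κ p′ t m (Painting.sees v) e
  ... | view s′ q′ g′ = later (painting-ok v h w)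
    (cont _ (painting (view s′ q′ (λ _ → refl)) (kept {ξ} {p} {W} (Painting.painted v) (λ q →
      trans (cong (λ z → Conf.grid (step robot c) (to ξ z)) (sym (to-from κ q)))
        (trans (g′ (from κ q)) (cong (set (Conf.grid c ∘ to ξ) p (Conf.grid c (to ξ p))) (to-from κ q)))))))

  record Quarter (ξ : Iso) (k l : ℕ) : Set where
    field
      frame : Frame ξ k l
      {rem} : Memory
      stamp : Marked (cells k l false false) full (G₀ ∘ to ξ) (gridOf P ∘ to ξ) rem

  module Lap {ξ : Iso} {k l : ℕ} (Q : Quarter ξ k l) where

    open Quarter Q
    open Placed (Frame.placed frame)

    strip-within : ∀ x → -[1+ suc k ] ℤ.< x → x ℤ.≤ + 0 → Within 1 (to ξ (x , + 0))
    strip-within x a b = within⁺ 1 _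
      (subst (λ z → + 0 ℤ.≤ z ℤ.+ + 1) (sym (west≡ _)) (subst (+ 0 ℤ.≤_) (l₁ x (+ k)) (0≤diff (ℤP.i<j⇒suc[i]≤j a))))
      (subst (λ z → + 0 ℤ.≤ z ℤ.+ + 1) (sym (east≡ _)) (subst (+ 0 ℤ.≤_) (l₂ x) (0≤diff b)))
      (subst (λ z → + 0 ℤ.≤ z ℤ.+ + 1) (sym (north≡ _)) (+≤+ z≤n))
      (subst (λ z → + 0 ℤ.≤ z ℤ.+ + 1) (sym (south≡ _)) (subst (+ 0 ℤ.≤_) (l₃ (+ l)) (+≤+ z≤n)))
      where
      l₁ : ∀ X K → X ℤ.- (+ 1 ℤ.+ ℤ.- (+ 2 ℤ.+ K)) ≡ X ℤ.+ (K ℤ.+ + 0) ℤ.+ + 1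
      l₁ = solve-∀
      l₂ : ∀ X → + 0 ℤ.- X ≡ + 0 ℤ.- + 1 ℤ.- X ℤ.+ + 1
      l₂ = solve-∀
      l₃ : ∀ L → L ℤ.+ + 1 ≡ L ℤ.+ + 0 ℤ.- + 0 ℤ.+ + 1
      l₃ = solve-∀

    strip-∉ : ∀ x → to ξ (x , + 0) ∉ P
    strip-∉ x q∈ with () ← subst (λ z → + 0 ℤ.≤ z ℤ.+ + 0) (north≡ (x , + 0)) (proj₁ (proj₂ (within⁻ 0 _ (inR q∈))))

    strip-target : ∀ x → -[1+ suc k ] ℤ.< x → x ℤ.≤ + 0 → target (to ξ (x , + 0)) ≡ false
    strip-target x a b = target-near (strip-∉ x) (strip-within x a b)

    strip-G₀ : ∀ {i} → i < k → G₀ (to ξ (-[1+ i ] , + 0)) ≡ false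
    strip-G₀ {i} i<k = trans (rest stamp (-[1+ i ] , + 0) λ i′ j′ _ e → off i′ (cong proj₁ e)) (gridOf-false (strip-∉ -[1+ i ]))
      where
      off : ∀ i′ → -[1+ i ] ≢ abscissa k i′
      off lf e = ℕP.<-irrefl (ℤP.-[1+-injective e) (ℕP.m<n⇒m<1+n i<k)
      off ln e = ℕP.<-irrefl (ℤP.-[1+-injective e) i<k

    remote : ∀ {q} → Lane k q → ¬ Within 1 (to ξ q)
    remote = lane-far {ξ = ξ} (Frame.placed frame)

    close : ∀ {q} → Lane k q → Within 3 (to ξ q)
    close = lane-near {ξ = ξ} (Frame.placed frame)

    finish : Pixel
    finish = to ξ (+ 0 , + 0)

    finish-within : Within 1 finish
    finish-within = strip-within (+ 0) ℤ.-<+ (+≤+ z≤n)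

    Done : ℤ → List Pixel → Set
    Done x W = to ξ (x , -[1+ 0 ]) ∈ W × to ξ (x , -[1+ 1 ]) ∈ W

    -- `new` keeps the writes of the lap away from distance 1, so the marker tile at its end
    -- survives until it is reached.
    record Progress (W₀ W : List Pixel) (i : ℕ) : Set where
      field
        sub  : ∀ {q} → q ∈ W₀ → q ∈ W
        new  : ∀ {q} → q ∈ W → q ∈ W₀ ⊎ ¬ Within 1 q
        cols : ∀ {j} → i ≤ j → j ≤ suc (suc k) → Done (column j) W

    open Progress

    record Finale (W₀ W : List Pixel) : Set where
      field
        sub  : ∀ {q} → q ∈ W₀ → q ∈ W
        new  : ∀ {q} → q ∈ W → q ∈ W₀ ⊎ q ≡ finish ⊎ ¬ Within 1 q
        all  : ∀ {q} → Lane k q → to ξ q ∈ W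
        end  : finish ∈ W

    module _ {r : Memory} {j : Fin 4} where

      private
        at₀ : ∀ {x} → Col k x → Within 3 (to ξ (x , + 0))
        at₀ c = nearby (Frame.placed frame) (proj₁ (col-bounds c)) (proj₂ (col-bounds c)) -≤+ (+≤+ z≤n)

        δ₁ : ∀ i κ b → δL (r , j , lane i 1F κ) b ≡ ((r , j , lane i 2F κ) , straight , κ , down)
        δ₁ 0F κ b = refl
        δ₁ 1F κ b = refl
        δ₁ 2F κ b = refl
        δ₁ 3F κ b = refl
        δ₁ 4F κ b = refl
        δ₂ : ∀ i κ b → δL (r , j , lane i 2F κ) b ≡ ((r , j , lane i 3F κ) , straight , not κ , up)
        δ₂ 0F κ b = refl
        δ₂ 1F κ b = refl
        δ₂ 2F κ b = refl
        δ₂ 3F κ b = refl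
        δ₂ 4F κ b = refl
        δ₃ : ∀ i κ b → i ≢ 4F → δL (r , j , lane i 3F κ) b ≡ ((r , j , lane i 4F κ) , straight , b , up)
        δ₃ 0F κ b _ = refl
        δ₃ 1F κ b _ = refl
        δ₃ 2F κ b _ = refl
        δ₃ 3F κ b _ = refl
        δ₃ 4F κ b ne = ⊥-elim (ne refl)
        δ₄ : ∀ i κ b → δL (r , j , lane i 4F κ) b ≡ ((r , j , lane (advance i) 0F (not κ)) , straight , b , right)
        δ₄ 0F κ b = refl
        δ₄ 1F κ b = refl
        δ₄ 2F κ b = refl
        δ₄ 3F κ b = refl
        δ₄ 4F κ b = refl

      strokes : ∀ {Φ K i κ x W c} → Painting ξ (r , j , lane i 1F κ) (x , -[1+ 0 ]) W c → Col k x →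
        κ ≡ col (to ξ (x , -[1+ 0 ])) →
        (∀ c′ → Painting ξ (r , j , lane i 3F κ) (x , -[1+ 0 ]) (to ξ (x , -[1+ 1 ]) ∷ to ξ (x , -[1+ 0 ]) ∷ W) c′ → Ev Φ K c′) →
        Ev Φ (2 + K) c
      strokes {i = i} {κ} {x} v cx e cont =
        writeP (x , -[1+ 1 ]) v refl (close (inner cx)) refl (δ₁ i κ _) refl
          (trans e (sym (target-lane {ξ} frame (inner cx)))) λ _ v →
        writeP (x , -[1+ 0 ]) v refl (close (outer cx)) refl (δ₂ i κ _) refl
          (trans (cong not e) (trans (sym (alternating-∘ ξ col-alternating down (x , -[1+ 0 ])))
            (sym (target-lane {ξ} frame (outer cx))))) λ _ v →
        cont _ v

      lift : ∀ {Φ K i κ x x′ W c} → i ≢ 4F → Painting ξ (r , j , lane i 3F κ) (x , -[1+ 0 ]) W c → Col k x →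
        x ℤ.+ ℤ.1ℤ ≡ x′ →
        (∀ c′ → Painting ξ (r , j , lane (advance i) 0F (not κ)) (x′ , + 0) W c′ → Ev Φ K c′) → Ev Φ (2 + K) c
      lift {i = i} {κ} {x} i≢4 v cx e cont =
        keepP (x , + 0) v refl (close (inner cx)) refl (δ₃ i κ _ i≢4) refl λ _ v →
        keepP _ v refl (at₀ cx) refl (δ₄ i κ _) (cong (_, + 0) e) λ _ v →
        cont _ v

      next-col : ∀ {κ x x′} → κ ≡ col (to ξ (x , -[1+ 0 ])) → x ℤ.+ ℤ.1ℤ ≡ x′ → not κ ≡ col (to ξ (x′ , -[1+ 0 ]))
      next-col {x = x} e refl = trans (cong not e) (sym (alternating-∘ ξ col-alternating right (x , -[1+ 0 ])))

      extend : ∀ {W₀ W i x} → x ≡ column i → Col k x → Progress W₀ W (suc i) →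
        Progress W₀ (to ξ (x , -[1+ 1 ]) ∷ to ξ (x , -[1+ 0 ]) ∷ W) i
      extend {W₀} {W} {i} refl cx pr = record
        { sub = λ q∈ → there (there (sub pr q∈))
        ; new = λ { (here refl) → inj₂ (remote (outer cx))
                  ; (there (here refl)) → inj₂ (remote (inner cx))
                  ; (there (there q∈)) → new pr q∈ }
        ; cols = λ {j′} le le′ → pick′ (ℕP.m≤n⇒m<n∨m≡n le) le′
        }
        where
        pick′ : ∀ {j′} → i < j′ ⊎ i ≡ j′ → j′ ≤ suc (suc k) →
          Done (column j′) (to ξ (column i , -[1+ 1 ]) ∷ to ξ (column i , -[1+ 0 ]) ∷ W)
        pick′ (inj₁ lt) le′ = let (a , b) = cols pr lt le′ in there (there a) , there (there b)
        pick′ (inj₂ refl) _ = there (here refl) , here refl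

      lapLoop : ∀ {Φ K κ W₀ W} i {c} → i ≤ k → finish ∉ W₀ →
        Painting ξ (r , j , lane 2F 0F κ) (column i , + 0) W c → κ ≡ col (to ξ (column i , -[1+ 0 ])) →
        Progress W₀ W (suc i) →
        (∀ κ′ W′ c′ → Painting ξ (r , j , lane 4F 3F κ′) (+ 1 , -[1+ 0 ]) W′ c′ →
           κ′ ≡ col (to ξ (+ 1 , -[1+ 0 ])) → Finale W₀ W′ → Ev Φ K c′) →
        Ev Φ (lapCost i K) c
      lapLoop {κ = κ} {W₀} {W} (suc i) i<k f∉ v e pr cont =
        keepP (-[1+ i ] , -[1+ 0 ]) v refl (at₀ cx)
          -- Whether or not an earlier lap has written this pixel, it is empty: `target` and the
          -- grid before the drawing agree here.
          (trans (Painting.painted v _) (paint-both W _ (strip-target -[1+ i ] (ℤ.-<- (ℕP.m<n⇒m<1+n i<k)) ℤ.-≤+) (strip-G₀ i<k)))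
          refl refl λ _ v →
        strokes v cx e λ _ v →
        lift {i = 2F} (λ ()) v cx (column-next i) λ _ v →
        lapLoop i (ℕP.<⇒≤ i<k) f∉ v (next-col e (column-next i)) (extend refl cx pr) cont
        where
        cx : Col k -[1+ i ]
        cx = mid {k = suc i} (ℕP.m≤n⇒m≤1+n (ℕP.m≤n⇒m≤1+n i<k))
      lapLoop {κ = κ} {W₀} {W} zero _ f∉ v e pr cont =
        -- The marker tile of the end corner is still in place by `fresh`; reading it ends the side,
        -- and the same step erases it.
        writeP (+ 0 , -[1+ 0 ]) v refl (at₀ cx)
          (trans (Painting.painted v _) (trans (paint-out fresh) (marks stamp hn ln refl)))
          refl refl (sym (strip-target (+ 0) ℤ.-<+ (+≤+ z≤n))) λ _ v →
        strokes v cx e λ _ v →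
        lift {i = 3F} (λ ()) v cx refl λ _ v →
        keepP (+ 1 , -[1+ 0 ]) v refl (at₀ last) refl refl refl λ _ v →
        strokes v last (next-col e refl) λ _ v →
        cont _ _ _ v (next-col e refl) (record
          { sub = λ q∈ → there (there (there (there (there (sub pr q∈)))))
          ; new = λ
            { (here refl) → inj₂ (inj₂ (remote (outer last)))
            ; (there (here refl)) → inj₂ (inj₂ (remote (inner last)))
            ; (there (there (here refl))) → inj₂ (inj₂ (remote (outer cx)))
            ; (there (there (there (here refl)))) → inj₂ (inj₂ (remote (inner cx)))
            ; (there (there (there (there (here refl))))) → inj₂ (inj₁ refl)
            ; (there (there (there (there (there q∈))))) → Data.Sum.map₂ inj₂ (new pr q∈) }
          ; all = λ
            { (inner last) → there (here refl)
            ; (outer last) → here refl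
            ; (inner (mid {zero} le)) → there (there (there (here refl)))
            ; (outer (mid {zero} le)) → there (there (here refl))
            ; (inner (mid {suc i} le)) → there (there (there (there (there (proj₁ (cols pr (s≤s z≤n) le))))))
            ; (outer (mid {suc i} le)) → there (there (there (there (there (proj₂ (cols pr (s≤s z≤n) le)))))) }
          ; end = there (there (there (there (here refl))))
          })
        where
        cx : Col k (+ 0)
        cx = mid {k = 0} z≤n
        fresh : finish ∉ W
        fresh q∈ with new pr q∈
        ... | inj₁ q∈₀ = f∉ q∈₀
        ... | inj₂ nw = nw finish-within

      lap : ∀ {Φ K κ W c} → finish ∉ W →
        Painting ξ (r , j , lane 0F 0F κ) (-[1+ suc k ] , + 0) W c → κ ≡ col (to ξ (-[1+ suc k ] , -[1+ 0 ])) →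
        (∀ κ′ W′ c′ → Painting ξ (r , j , lane 4F 3F κ′) (+ 1 , -[1+ 0 ]) W′ c′ →
           κ′ ≡ col (to ξ (+ 1 , -[1+ 0 ])) → Finale W W′ → Ev Φ K c′) →
        Ev Φ (10 + lapCost k K) c
      lap {W = W} f∉ v e cont =
        keepP (-[1+ suc k ] , -[1+ 0 ]) v refl (at₀ c₁) refl refl refl λ _ v →
        strokes v c₁ e λ _ v →
        lift {i = 0F} (λ ()) v c₁ refl λ _ v →
        keepP (-[1+ k ] , -[1+ 0 ]) v refl (at₀ c₂) refl refl refl λ _ v →
        strokes v c₂ (next-col e refl) λ _ v →
        lift {i = 1F} (λ ()) v c₂ (column-next k) λ _ v →
        lapLoop k ℕP.≤-refl f∉ v (next-col (next-col e refl) (column-next k))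
          (extend refl c₂ (extend refl c₁ (record
            { sub = id ; new = inj₁ ; cols = λ le le′ → ⊥-elim (ℕP.<-irrefl refl (ℕP.≤-trans le le′)) }))) cont
        where
        c₁ : Col k -[1+ suc k ]
        c₁ = mid {k = suc (suc k)} ℕP.≤-refl
        c₂ : Col k -[1+ k ]
        c₂ = mid {k = suc k} (ℕP.n≤1+n _)

module Circuit (P : List Pixel) (x0 x1 y0 y1 : ℤ) (N : ℕ) (inR : ∀ {q} → q ∈ P → Run.Within P x0 x1 y0 y1 N 0 q)
  (ψ : Iso) (n m : ℕ) (pl : Run.Placed P x0 x1 y0 y1 N (to ψ) n m 0 0 0 0)
  (G₀ : Grid) (mem : Memory)
  (marked₀ : Marked (cells n m false false) full (G₀ ∘ to ψ) (gridOf P ∘ to ψ) mem)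
  (room : 16 + 4 * (4 + (n + m)) ≤ N) where

  open Run P x0 x1 y0 y1 N
  open Ring P x0 x1 y0 y1 N inR ψ n m pl
  open Box P x0 x1 y0 y1 N inR ψ n m pl
  open Build P x0 x1 y0 y1 N inR ψ n m pl G₀ mem marked₀ room

  Q₁ : Quarter ψ n m
  Q₁ = record { frame = frame₁ ; stamp = marked₀ }
  Q₂ : Quarter ψ₂ m n
  Q₂ = record { frame = frame₂ ; stamp = marked-quarter marked₀ }
  Q₃ : Quarter ψ₃ n m
  Q₃ = record { frame = frame₃ ; stamp = marked-quarter (marked-quarter marked₀) }
  Q₄ : Quarter ψ₄ m n
  Q₄ = record { frame = frame₄ ; stamp = marked-quarter (marked-quarter (marked-quarter marked₀)) }

  module L₁ = Lap Q₁
  module L₂ = Lap Q₂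
  module L₃ = Lap Q₃
  module L₄ = Lap Q₄

  record Complete (c : Conf robot) : Set where
    field
      halt   : Robot.halting robot (Conf.state c) ≡ true
      inside : Within 3 (Conf.pos c)
      drawn  : ∀ q → Conf.grid c q ≡ target q

  private
    to≢ : ∀ ξ {p q} → p ≢ q → to ξ p ≢ to ξ q
    to≢ ξ ne e = ne (to-injective ξ e)

    one : ∀ ξ l → to (ξ ∘ᵢ quarter l) (+ 0 , + 0) ≢ to ξ (+ 0 , + 0)
    one ξ l = to≢ ξ λ ()

    two : ∀ ξ l k → to ((ξ ∘ᵢ quarter l) ∘ᵢ quarter k) (+ 0 , + 0) ≢ to ξ (+ 0 , + 0)
    two ξ l k = to≢ ξ λ ()

    three : ∀ ξ l k → to (((ξ ∘ᵢ quarter l) ∘ᵢ quarter k) ∘ᵢ quarter l) (+ 0 , + 0) ≢ to ξ (+ 0 , + 0)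
    three ξ l k = to≢ ξ λ ()

    turn-start : ∀ l → (+ 0 , -[1+ 0 ]) ≡ to (quarter l) (-[1+ suc l ] , + 0)
    turn-start l = cong (+ 0 ,_) (sym (cong proj₂ (quarter-corner l)))

    turn-colour : ∀ {κ} ξ l → κ ≡ col (to ξ (+ 1 , -[1+ 0 ])) →
      κ ≡ col (to (ξ ∘ᵢ quarter l) (-[1+ suc l ] , -[1+ 0 ]))
    turn-colour ξ l e = trans e (cong (col ∘ to ξ) (sym (quarter-corner l)))

    tip-within : ∀ ξ {k l} → Placed (to ξ) k l 0 0 0 0 → Within 3 (to ξ (+ 1 , -[1+ 0 ]))
    tip-within ξ pl = lane-near {ξ = ξ} pl (inner last)

  module _ {W : List Pixel} (everything₁ : ∀ {q} → Lane n q → to ψ q ∈ W) (everything₂ : ∀ {q} → Lane m q → to ψ₂ q ∈ W)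
    (everything₃ : ∀ {q} → Lane n q → to ψ₃ q ∈ W) (everything₄ : ∀ {q} → Lane m q → to ψ₄ q ∈ W)
    (f₁ : L₁.finish ∈ W) (f₂ : L₂.finish ∈ W) (f₃ : L₃.finish ∈ W) (f₄ : L₄.finish ∈ W) where

    private
      C : Cells
      C = cells n m false false
      C′ : Cells
      C′ = cells m n false false

      row : ∀ k l i → Lane k (cells k l false false i lf)
      row k l lf = inner (mid {k = suc (suc k)} ℕP.≤-refl)
      row k l ln = inner (mid {k = suc k} (ℕP.n≤1+n _))
      row k l hn = inner (mid {k = 0} z≤n)
      row k l hf = inner last

      turn₂ : ∀ i j → to ψ₂ (C′ i j) ≡ to ψ (C (flip j) i)
      turn₂ i j = cong (to ψ) (quarter-cells n m i j)
      turn₃ : ∀ i j → to ψ₃ (C i j) ≡ to ψ (C (flip i) (flip j))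
      turn₃ i j = trans (cong (to ψ₂) (quarter-cells m n i j)) (turn₂ (flip j) i)
      turn₄ : ∀ i j → to ψ₄ (C′ i j) ≡ to ψ (C j (flip i))
      turn₄ i j = trans (cong (to ψ₃) (quarter-cells n m i j)) (trans (turn₃ (flip j) i)
        (cong (λ z → to ψ (C z (flip i))) (flip-flip j)))

      -- A marker cell with a far index lies in some inner lane, and the four cells with both
      -- indices near are the `finish` pixels. Hence every marker cell has been overwritten.
      cell-∈ : ∀ i j → to ψ (C i j) ∈ W
      cell-∈ i lf = everything₁ (row n m i)
      cell-∈ hf j = subst (_∈ W) (turn₂ j lf) (everything₂ (row m n j))
      cell-∈ i hf = subst (_∈ W) (trans (turn₃ (flip i) lf) (cong (λ z → to ψ (C z hf)) (flip-flip i)))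
        (everything₃ (row n m (flip i)))
      cell-∈ lf j = subst (_∈ W) (trans (turn₄ (flip j) lf) (cong (λ z → to ψ (C lf z)) (flip-flip j)))
        (everything₄ (row m n (flip j)))
      cell-∈ hn ln = f₁
      cell-∈ hn hn = subst (_∈ W) (turn₂ hn ln) f₂
      cell-∈ ln hn = subst (_∈ W) (turn₃ hn ln) f₃
      cell-∈ ln ln = subst (_∈ W) (turn₄ hn ln) f₄

      loop-W : ∀ {k ξ q} → (∀ {a} → Lane k a → to ξ a ∈ W) → q ∈ loop k ξ → q ∈ W
      loop-W {k} {ξ} f q∈ with loop-∈ {k} {ξ} q∈
      ... | a , s , _ , refl = f (inSide-lane s)

      ring-∈ : ∀ {q} → q ∈ ring → q ∈ W
      ring-∈ q∈ with ring-split q∈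
      ... | inj₁ (inj₁ i) = loop-W {ξ = ψ} everything₁ i
      ... | inj₁ (inj₂ i) = loop-W {ξ = ψ₂} everything₂ i
      ... | inj₂ (inj₁ i) = loop-W {ξ = ψ₃} everything₃ i
      ... | inj₂ (inj₂ i) = loop-W {ξ = ψ₄} everything₄ i

    paint-complete : ∀ q → paint W q ≡ target q
    paint-complete q = in-case W q paint-in λ q∉ → trans (paint-out q∉) (trans
      (trans (cong G₀ (sym (to-from ψ q))) (trans
        (rest marked₀ (from ψ q) λ i j _ e → q∉ (subst (_∈ W) (trans (cong (to ψ) (sym e)) (to-from ψ q)) (cell-∈ i j)))
        (cong (gridOf P) (to-from ψ q))))
      (sym (trans (cong (gridOf P q ∨_) (dec-false (q ∈? ring) (q∉ ∘ ring-∈))) (∨-false _))))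
      where
      ∨-false : ∀ b → b ∨ false ≡ b
      ∨-false true = refl
      ∨-false false = refl

  circuitCost : ℕ
  circuitCost = suc (10 + lapCost n (suc (10 + lapCost m (suc (10 + lapCost n (suc (10 + lapCost m 1)))))))

  circuit : ∀ {c} → Painting ψ (mem , 0F , enter) (-[1+ n ] , + 0) [] c → Ev Complete circuitCost c
  circuit v =
    keepP (-[1+ suc n ] , + 0) v refl (nearby pl (-≤- (ℕP.n≤1+n n)) -≤+ -≤+ (+≤+ z≤n)) refl refl
      (cong (λ z → -[1+ suc z ] , + 0) (ℕP.+-identityʳ n)) λ _ v →
    L₁.lap (λ ()) v (sym col-corner) λ _ W₁ _ v e F₁ →
    turnP (quarter m) (-[1+ suc m ] , + 0) (λ _ _ → refl) v refl (tip-within ψ pl) refl refl (turn-start m) λ _ v →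
    L₂.lap (out₂ F₁) v (turn-colour ψ m e) λ _ W₂ _ v e F₂ →
    turnP (quarter n) (-[1+ suc n ] , + 0) (λ _ _ → refl) v refl (tip-within ψ₂ pl₂) refl refl (turn-start n) λ _ v →
    L₃.lap (out₃ F₁ F₂) v (turn-colour ψ₂ n e) λ _ W₃ _ v e F₃ →
    turnP (quarter m) (-[1+ suc m ] , + 0) (λ _ _ → refl) v refl (tip-within ψ₃ pl₃) refl refl (turn-start m) λ _ v →
    L₄.lap (out₄ F₁ F₂ F₃) v (turn-colour ψ₃ m e) λ _ W₄ _ v e F₄ →
    turnP (quarter n) (-[1+ suc n ] , + 0) (λ _ _ → refl) v refl (tip-within ψ₄ pl₄) refl refl (turn-start n) λ _ v →
    now (record
      { halt = trans (cong (λ s → halted (proj₂ (dec finite-State s))) (state≡ (Painting.sees v)))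
          (cong (halted ∘ proj₂) (dec-enc finite-State _))
      ; inside = subst (Within 3) (sym (trans (pos≡ (Painting.sees v)) (cong (to ψ₄) (sym (turn-start n)))))
          (lane-near {ξ = ψ₄} pl₄ (inner (mid {k = 0} z≤n)))
      ; drawn = λ q → trans (Painting.painted v q) (paint-complete
          (λ s → L₄.Finale.sub F₄ (L₃.Finale.sub F₃ (L₂.Finale.sub F₂ (L₁.Finale.all F₁ s))))
          (λ s → L₄.Finale.sub F₄ (L₃.Finale.sub F₃ (L₂.Finale.all F₂ s)))
          (λ s → L₄.Finale.sub F₄ (L₃.Finale.all F₃ s))
          (λ s → L₄.Finale.all F₄ s)
          (L₄.Finale.sub F₄ (L₃.Finale.sub F₃ (L₂.Finale.sub F₂ (L₁.Finale.end F₁))))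
          (L₄.Finale.sub F₄ (L₃.Finale.sub F₃ (L₂.Finale.end F₂)))
          (L₄.Finale.sub F₄ (L₃.Finale.end F₃))
          (L₄.Finale.end F₄) q)
      })
    where
    -- Earlier laps wrote only in lanes, which avoid distance 1, and at their own `finish` pixels,
    -- which are different corners.
    out₂ : ∀ {W₁} → L₁.Finale [] W₁ → L₂.finish ∉ W₁
    out₂ F₁ q∈ with L₁.Finale.new F₁ q∈
    ... | inj₂ (inj₁ e) = one ψ m e
    ... | inj₂ (inj₂ nw) = nw L₂.finish-within

    out₃ : ∀ {W₁ W₂} → L₁.Finale [] W₁ → L₂.Finale W₁ W₂ → L₃.finish ∉ W₂
    out₃ F₁ F₂ q∈ with L₂.Finale.new F₂ q∈
    ... | inj₂ (inj₁ e) = one ψ₂ n e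
    ... | inj₂ (inj₂ nw) = nw L₃.finish-within
    ... | inj₁ q∈ with L₁.Finale.new F₁ q∈
    ...   | inj₂ (inj₁ e) = two ψ m n e
    ...   | inj₂ (inj₂ nw) = nw L₃.finish-within

    out₄ : ∀ {W₁ W₂ W₃} → L₁.Finale [] W₁ → L₂.Finale W₁ W₂ → L₃.Finale W₂ W₃ → L₄.finish ∉ W₃
    out₄ F₁ F₂ F₃ q∈ with L₃.Finale.new F₃ q∈
    ... | inj₂ (inj₁ e) = one ψ₃ m e
    ... | inj₂ (inj₂ nw) = nw L₄.finish-within
    ... | inj₁ q∈ with L₂.Finale.new F₂ q∈
    ...   | inj₂ (inj₁ e) = two ψ₂ n m e
    ...   | inj₂ (inj₂ nw) = nw L₄.finish-within
    ...   | inj₁ q∈ with L₁.Finale.new F₁ q∈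
    ...     | inj₂ (inj₁ e) = three ψ m n e
    ...     | inj₂ (inj₂ nw) = nw L₄.finish-within

lapCost≡ : ∀ i K → lapCost i K ≡ i * 5 + (8 + K)
lapCost≡ zero K = refl
lapCost≡ (suc i) K = cong (5 ℕ.+_) (lapCost≡ i K)

-- From the end of the search to the finished box

module Conclusion (P : List Pixel) (poly : Polyomino P) (x0 x1 y0 y1 : ℤ) (br : BoundingRect P x0 x1 y0 y1) (S : ℕ) where

  N : ℕ
  N = 16 + 4 * (4 + S)

  open Run P x0 x1 y0 y1 N public
  open Expedition P x0 x1 y0 y1 N (ℕP.m≤m+n 16 _) (Polyomino.diagonal poly) (boundingRect-within N br) public
  open Journey P x0 x1 y0 y1 N (ℕP.m≤m+n 16 _) (Polyomino.diagonal poly) br public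

  inR : ∀ {q} → q ∈ P → Within 0 q
  inR = boundingRect-within N br

  Success : Conf robot → Set
  Success c = Robot.halting robot (Conf.state c) ≡ true × Within 3 (Conf.pos c) ×
    BuildsBoundingBox P (Conf.grid c) ×
    (∃ λ D → length D ≤ N × (∀ q → Conf.grid c q ≡ true → q ∈ P ⊎ q ∈ D))

  module _ {n m L R T B : ℕ} {c : Conf robot} (F : Finished n m L R T B c) where

    open Finished F
    open Placed placed using (west≡; east≡; north≡; south≡; touch)

    private
      h = gridOf P ∘ to ψ

      edge : ∀ g → + 0 ℤ.≤ g → + 0 ℤ.≤ g ℤ.- + 1 ⊎ g ℤ.- + 1 ≡ -[1+ 0 ]
      edge (+ zero) _ = inj₂ refl
      edge (+ suc g) _ = inj₁ (+≤+ z≤n)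

      -- A step out of the rectangle would end in the row just beyond one of its sides, and all four
      -- of these rows are empty.
      move-in : ∀ d q → InQ n m q → h (move d q) ≡ true → InQ n m (move d q)
      move-in up (x , y) ((w , e) , (u , s)) t = (w , e) , (subst (+ 0 ℤ.≤_) (l₁ y) (0≤+ u (+≤+ z≤n)) , go (edge _ s))
        where
        l₁ : ∀ Y → Y ℤ.- + 1 ℤ.+ + 0 ℤ.+ + 1 ≡ Y ℤ.+ + 1 ℤ.- + 1 ℤ.+ + 0
        l₁ = solve-∀
        l₂ : ∀ Y M → M ℤ.+ + 0 ℤ.- Y ℤ.- + 1 ≡ M ℤ.+ + 0 ℤ.- (Y ℤ.+ + 1)
        l₂ = solve-∀
        go : + 0 ℤ.≤ gapS m 0 (x , y) ℤ.- + 1 ⊎ gapS m 0 (x , y) ℤ.- + 1 ≡ -[1+ 0 ] → + 0 ℤ.≤ gapS m 0 (x , y ℤ.+ + 1)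
        go (inj₁ p) = subst (+ 0 ℤ.≤_) (l₂ y (+ m)) p
        go (inj₂ p) with () ← trans (sym t) (proj₂ (proj₂ clear) (x , y ℤ.+ + 1) (trans (sym (l₂ y (+ m))) p) w e)
      move-in down (x , y) ((w , e) , (u , s)) t = (w , e) , (go (edge _ u) , subst (+ 0 ℤ.≤_) (l₁ y (+ m)) (0≤+ s (+≤+ z≤n)))
        where
        l₁ : ∀ Y M → M ℤ.+ + 0 ℤ.- Y ℤ.+ + 1 ≡ M ℤ.+ + 0 ℤ.- (Y ℤ.- + 1)
        l₁ = solve-∀
        l₂ : ∀ Y → Y ℤ.- + 1 ℤ.+ + 0 ℤ.- + 1 ≡ Y ℤ.- + 1 ℤ.- + 1 ℤ.+ + 0
        l₂ = solve-∀
        go : + 0 ℤ.≤ gapN m 0 (x , y) ℤ.- + 1 ⊎ gapN m 0 (x , y) ℤ.- + 1 ≡ -[1+ 0 ] → + 0 ℤ.≤ gapN m 0 (x , y ℤ.- + 1)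
        go (inj₁ p) = subst (+ 0 ℤ.≤_) (l₂ y) p
        go (inj₂ p) with () ← trans (sym t) (proj₁ (proj₂ clear) (x , y ℤ.- + 1) (trans (sym (l₂ y)) p) w e)
      move-in left (x , y) ((w , e) , (u , s)) t = (go (edge _ w) , subst (+ 0 ℤ.≤_) (l₁ x) (0≤+ e (+≤+ z≤n))) , (u , s)
        where
        l₁ : ∀ X → + 0 ℤ.- + 1 ℤ.- X ℤ.+ + 1 ≡ + 0 ℤ.- + 1 ℤ.- (X ℤ.- + 1)
        l₁ = solve-∀
        l₂ : ∀ X M → X ℤ.+ (M ℤ.+ + 0) ℤ.- + 1 ≡ X ℤ.- + 1 ℤ.+ (M ℤ.+ + 0)
        l₂ = solve-∀
        go : + 0 ℤ.≤ gapW n 0 (x , y) ℤ.- + 1 ⊎ gapW n 0 (x , y) ℤ.- + 1 ≡ -[1+ 0 ] → + 0 ℤ.≤ gapW n 0 (x ℤ.- + 1 , y)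
        go (inj₁ p) = subst (+ 0 ℤ.≤_) (l₂ x (+ n)) p
        go (inj₂ p) with () ← trans (sym t) (proj₁ (proj₁ clear) (x ℤ.- + 1 , y) (trans (sym (l₂ x (+ n))) p) u s)
      move-in right (x , y) ((w , e) , (u , s)) t = (subst (+ 0 ℤ.≤_) (l₁ x (+ n)) (0≤+ w (+≤+ z≤n)) , go (edge _ e)) , (u , s)
        where
        l₁ : ∀ X M → X ℤ.+ (M ℤ.+ + 0) ℤ.+ + 1 ≡ X ℤ.+ + 1 ℤ.+ (M ℤ.+ + 0)
        l₁ = solve-∀
        l₂ : ∀ X → + 0 ℤ.- + 1 ℤ.- X ℤ.- + 1 ≡ + 0 ℤ.- + 1 ℤ.- (X ℤ.+ + 1)
        l₂ = solve-∀
        go : + 0 ℤ.≤ gapE n 0 (x , y) ℤ.- + 1 ⊎ gapE n 0 (x , y) ℤ.- + 1 ≡ -[1+ 0 ] → + 0 ℤ.≤ gapE n 0 (x ℤ.+ + 1 , y)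
        go (inj₁ p) = subst (+ 0 ℤ.≤_) (l₂ x) p
        go (inj₂ p) with () ← trans (sym t) (proj₂ (proj₁ clear) (x ℤ.+ + 1 , y) (trans (sym (l₂ x)) p) u s)

      follow : ∀ {u v xs} → Walk u v xs → All (_∈ P) xs → InQ n m (from ψ u) → InQ n m (from ψ v)
      follow here _ i = i
      follow {u} (there (d , refl) w) (_ ∷ all) i =
        follow w all (subst (InQ n m) (sym (from-move ψ d u)) (move-in (unact ψ d) (from ψ u) i
          (trans (cong (gridOf P) (trans (cong (to ψ) (sym (from-move ψ d u))) (to-from ψ _))) (gridOf⁺ (first∈ w all)))))
        where
        first∈ : ∀ {u v xs} → Walk u v xs → All (_∈ P) xs → u ∈ P
        first∈ here (i ∷ _) = i
        first∈ (there _ _) (i ∷ _) = i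

    contained : ∀ {p} → p ∈ P → InQ n m (from ψ p)
    contained {p} p∈ with home
    ... | q , t , i with Polyomino.connected poly (gridOf⁻ t) p∈
    ...   | _ , walk , all = follow walk all (subst (InQ n m) (sym (from-to ψ q)) i)

    private
      slack : ∀ {a b k} → + 0 ℤ.≤ a → a ℤ.+ + k ≡ b → b ≡ + 0 → k ≡ 0
      slack {+ a} _ refl e = ℕP.m+n≡0⇒n≡0 a (ℤP.+-injective e)

    -- Each side of the bounding rectangle carries a tile, and by `contained` that tile lies in the
    -- grown rectangle, so no gap remains.
    tight : (L ≡ 0 × R ≡ 0) × (T ≡ 0 × B ≡ 0)
    tight = let ((w , e) , (u , s)) = touch in (tw w , te e) , (tn u , ts s)
      where
      l₁ : ∀ X N L → X ℤ.+ (N ℤ.+ + 0) ℤ.+ L ≡ X ℤ.+ (N ℤ.+ L)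
      l₁ = solve-∀
      l₂ : ∀ X R → + 0 ℤ.- + 1 ℤ.- X ℤ.+ R ≡ R ℤ.- + 1 ℤ.- X
      l₂ = solve-∀
      l₃ : ∀ Y T → Y ℤ.- + 1 ℤ.+ + 0 ℤ.+ T ≡ Y ℤ.- + 1 ℤ.+ T
      l₃ = solve-∀
      l₄ : ∀ Y M B → M ℤ.+ + 0 ℤ.- Y ℤ.+ B ≡ M ℤ.+ B ℤ.- Y
      l₄ = solve-∀
      at : ∀ {f : Pixel → ℤ} {g : Pixel → ℤ} {p} → (∀ q → f (to ψ q) ≡ g q) → f p ≡ + 0 → g (from ψ p) ≡ + 0
      at {f} {p = p} e z = trans (sym (e (from ψ p))) (trans (cong f (to-from ψ p)) z)
      tw : (∃ λ p → p ∈ P × Placed.west placed p ≡ + 0) → L ≡ 0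
      tw (p , p∈ , z) = slack (proj₁ (proj₁ (contained p∈))) (l₁ (proj₁ (from ψ p)) (+ n) (+ L)) (at west≡ z)
      te : (∃ λ p → p ∈ P × Placed.east placed p ≡ + 0) → R ≡ 0
      te (p , p∈ , z) = slack (proj₂ (proj₁ (contained p∈))) (l₂ (proj₁ (from ψ p)) (+ R)) (at east≡ z)
      tn : (∃ λ p → p ∈ P × Placed.north placed p ≡ + 0) → T ≡ 0
      tn (p , p∈ , z) = slack (proj₁ (proj₂ (contained p∈))) (l₃ (proj₂ (from ψ p)) (+ T)) (at north≡ z)
      ts : (∃ λ p → p ∈ P × Placed.south placed p ≡ + 0) → B ≡ 0
      ts (p , p∈ , z) = slack (proj₂ (proj₂ (contained p∈))) (l₄ (proj₂ (from ψ p)) (+ m) (+ B)) (at south≡ z)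

  -- 77 = 1 + 4 + 4 · 18: the step `enter`, the turns, and the 18 steps of each lap outside the 5
  -- per column of the rectangle. The four laps pass 2S such columns, whence 10S.
  conclude : ∀ {c} → Settled S c → Ev Success (77 + 10 * S) c
  conclude {c} (n , m , L , R , T , B , F , eq) with tight F
  ... | (refl , refl) , (refl , refl) = ev-weaken cost (ev-bind {k′ = 0} (circuit (painting
          (Site.sees (Finished.stand F)) (λ q → refl))) λ c z → now (
        Complete.halt z , Complete.inside z ,
        (ring , ring-isBoundingBox , λ q → mk⇔ (λ t → target⁻ (trans (sym (Complete.drawn z q)) t))
          (λ i → trans (Complete.drawn z q) (target⁺ i))) ,
        (ring , ℕP.≤-trans ring-length (ℕP.≤-trans (ℕP.m≤n+m _ 16) room) ,
          λ q t → target⁻ (trans (sym (Complete.drawn z q)) t))))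
    where
    open Finished F using (ψ; placed)
    sum : n + m ≡ S
    sum = trans (cong₂ ℕ._+_ (sym (trans (ℕP.+-identityʳ (n + 0)) (ℕP.+-identityʳ n)))
      (sym (trans (ℕP.+-identityʳ (m + 0)) (ℕP.+-identityʳ m)))) eq
    room : 16 + 4 * (4 + (n + m)) ≤ N
    room = ℕP.≤-reflexive (cong (λ z → 16 + 4 * (4 + z)) sum)
    open Ring P x0 x1 y0 y1 N inR ψ n m placed
    open Box P x0 x1 y0 y1 N inR ψ n m placed
    open Build P x0 x1 y0 y1 N inR ψ n m placed (Conf.grid c) (Finished.r F) (Site.marked (Finished.stand F)) room
    open Circuit P x0 x1 y0 y1 N inR ψ n m placed (Conf.grid c) (Finished.r F) (Site.marked (Finished.stand F)) room
    cost : circuitCost + 0 ≤ 77 + 10 * S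
    cost = ℕP.≤-reflexive (trans (ℕP.+-identityʳ circuitCost) (trans
      (trans (cong (11 ℕ.+_) (lapCost≡ n _)) (trans (cong (λ z → 11 + (n * 5 + (19 + z))) (lapCost≡ m _))
        (trans (cong (λ z → 11 + (n * 5 + (19 + (m * 5 + (19 + z))))) (lapCost≡ n _))
          (cong (λ z → 11 + (n * 5 + (19 + (m * 5 + (19 + (n * 5 + (19 + z))))))) (lapCost≡ m 1)))))
      (trans (lem n m) (cong (λ z → 77 + 10 * z) sum))))
      where
      lem : ∀ n m → 11 + (n * 5 + (19 + (m * 5 + (19 + (n * 5 + (19 + (m * 5 + 9))))))) ≡
        77 + 10 * (n + m)
      lem = solveℕ-∀

-- Counting

unique-⊆-length : ∀ {A : Set} {xs ys : List A} → Unique xs → (∀ {q} → q ∈ xs → q ∈ ys) → length xs ≤ length ys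
unique-⊆-length {xs = []} _ _ = z≤n
unique-⊆-length {A} {x ∷ xs} (x∉ ∷ u) sub with ∈-∃++ (sub (here refl))
... | as , bs , refl = ℕP.≤-trans (s≤s (unique-⊆-length u sub′))
    (ℕP.≤-reflexive (trans (cong suc (length-++ as)) (trans (sym (ℕP.+-suc (length as) (length bs))) (sym (length-++ as)))))
  where
  sub′ : ∀ {q} → q ∈ xs → q ∈ as ++ bs
  sub′ {q} q∈ with ∈-++⁻ as (sub (there q∈))
  ... | inj₁ i = ∈-++⁺ˡ i
  ... | inj₂ (there i) = ∈-++⁺ʳ as i
  ... | inj₂ (here refl) = ⊥-elim (All.lookup x∉ q∈ refl)

range : ℤ → ℕ → List ℤ
range a k = applyUpTo (λ i → a ℤ.+ + i) k

length-range : ∀ a k → length (range a k) ≡ k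
length-range a k = length-applyUpTo (λ i → a ℤ.+ + i) k

∈-range : ∀ a k {x} → + 0 ℤ.≤ x ℤ.- a → + 0 ℤ.≤ a ℤ.+ + k ℤ.- + 1 ℤ.- x → x ∈ range a k
∈-range a k {x} p q = go (x ℤ.- a) (l₁ a x) p (subst (+ 0 ℤ.≤_) (l₂ a (+ k) x) q)
  where
  l₁ : ∀ a x → x ≡ a ℤ.+ (x ℤ.- a)
  l₁ = solve-∀
  l₂ : ∀ a k x → a ℤ.+ k ℤ.- + 1 ℤ.- x ≡ k ℤ.- (+ 1 ℤ.+ (x ℤ.- a))
  l₂ = solve-∀
  go : ∀ z → x ≡ a ℤ.+ z → + 0 ℤ.≤ z → + 0 ℤ.≤ + k ℤ.- (+ 1 ℤ.+ z) → x ∈ range a k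
  go (+ i) refl _ lt = ∈-applyUpTo⁺ (λ i → a ℤ.+ + i) (ℤP.drop‿+≤+ (ℤP.0≤i-j⇒j≤i lt))

length-cartesianProduct : ∀ {A B : Set} (xs : List A) (ys : List B) → length (cartesianProduct xs ys) ≡ length xs * length ys
length-cartesianProduct [] ys = refl
length-cartesianProduct (x ∷ xs) ys = trans (length-++ (map (x ,_) ys))
  (cong₂ ℕ._+_ (length-map (x ,_) ys) (length-cartesianProduct xs ys))

extent≡ : ∀ {a b} → a ℤ.≤ b → + extent a b ≡ b ℤ.- a ℤ.+ + 1
extent≡ {a} {b} le = trans (cong (λ z → + 1 ℤ.+ z) (ℤP.0≤i⇒+∣i∣≡i (0≤diff le))) (ℤP.+-comm (+ 1) (b ℤ.- a))

module Margin (P : List Pixel) (x0 x1 y0 y1 : ℤ) (N : ℕ) (x0≤x1 : x0 ℤ.≤ x1) (y0≤y1 : y0 ℤ.≤ y1) where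

  open Run P x0 x1 y0 y1 N using (Within)

  private
    w = extent x0 x1
    h = extent y0 y1
    Xs = range (x0 ℤ.- + 3) (w + 6)
    Ys = range (y0 ℤ.- + 3) (h + 6)
    before after : ℤ → List ℤ
    before a = range (a ℤ.- + 3) 3
    after a = range (a ℤ.+ + 1) 3

  -- Four bands of thickness three that overlap in the corners; the double count there is absorbed
  -- by the constant.
  margin : List Pixel
  margin = (cartesianProduct (before x0) Ys ++ cartesianProduct (after x1) Ys) ++
           (cartesianProduct Xs (before y0) ++ cartesianProduct Xs (after y1))

  private
    k₁ : ∀ X A → X ℤ.- A ℤ.+ + 3 ≡ X ℤ.- (A ℤ.- + 3)
    k₁ = solve-∀
    k₂ : ∀ X A → A ℤ.- (+ 1 ℤ.+ X) ≡ A ℤ.- + 3 ℤ.+ + 3 ℤ.- + 1 ℤ.- X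
    k₂ = solve-∀
    k₃ : ∀ X A → X ℤ.- (+ 1 ℤ.+ A) ≡ X ℤ.- (A ℤ.+ + 1)
    k₃ = solve-∀
    k₄ : ∀ X A → A ℤ.- X ℤ.+ + 3 ≡ A ℤ.+ + 1 ℤ.+ + 3 ℤ.- + 1 ℤ.- X
    k₄ = solve-∀
    k₅ : ∀ A X B → B ℤ.- X ℤ.+ + 3 ≡ A ℤ.- + 3 ℤ.+ (B ℤ.- A ℤ.+ + 1 ℤ.+ + 6) ℤ.- + 1 ℤ.- X
    k₅ = solve-∀

  ∈-before : ∀ {x} a → + 0 ℤ.≤ x ℤ.- a ℤ.+ + 3 → ¬ (a ℤ.≤ x) → x ∈ before a
  ∈-before {x} a p lt = ∈-range (a ℤ.- + 3) 3 (subst (+ 0 ℤ.≤_) (k₁ x a) p)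
    (subst (+ 0 ℤ.≤_) (k₂ x a) (0≤diff (ℤP.i<j⇒suc[i]≤j (ℤP.≰⇒> lt))))

  ∈-after : ∀ {x} a → + 0 ℤ.≤ a ℤ.- x ℤ.+ + 3 → ¬ (x ℤ.≤ a) → x ∈ after a
  ∈-after {x} a p lt = ∈-range (a ℤ.+ + 1) 3 (subst (+ 0 ℤ.≤_) (k₃ x a) (0≤diff (ℤP.i<j⇒suc[i]≤j (ℤP.≰⇒> lt))))
    (subst (+ 0 ℤ.≤_) (k₄ x a) p)

  ∈-whole : ∀ {x} a b → a ℤ.≤ b → + 0 ℤ.≤ x ℤ.- a ℤ.+ + 3 → + 0 ℤ.≤ b ℤ.- x ℤ.+ + 3 →
    x ∈ range (a ℤ.- + 3) (extent a b + 6)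
  ∈-whole {x} a b le p q = ∈-range (a ℤ.- + 3) (extent a b + 6) (subst (+ 0 ℤ.≤_) (k₁ x a) p)
    (subst (+ 0 ℤ.≤_) (trans (k₅ a x b) (cong (λ z → a ℤ.- + 3 ℤ.+ (z ℤ.+ + 6) ℤ.- + 1 ℤ.- x) (sym (extent≡ le)))) q)

  ∈-margin : ∀ {q} → ¬ InRect x0 x1 y0 y1 q → Within 3 q → q ∈ margin
  ∈-margin {x , y} out ((a , b) , (c , d)) with x0 ℤ.≤? x | x ℤ.≤? x1 | y0 ℤ.≤? y | y ℤ.≤? y1
  ... | no p | _ | _ | _ = ∈-++⁺ˡ (∈-++⁺ˡ (∈-cartesianProduct⁺ (∈-before x0 a p) (∈-whole y0 y1 y0≤y1 c d)))
  ... | yes _ | no p | _ | _ = ∈-++⁺ˡ (∈-++⁺ʳ (cartesianProduct (before x0) Ys)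
          (∈-cartesianProduct⁺ (∈-after x1 b p) (∈-whole y0 y1 y0≤y1 c d)))
  ... | yes _ | yes _ | no p | _ = ∈-++⁺ʳ (cartesianProduct (before x0) Ys ++ cartesianProduct (after x1) Ys)
          (∈-++⁺ˡ (∈-cartesianProduct⁺ (∈-whole x0 x1 x0≤x1 a b) (∈-before y0 c p)))
  ... | yes _ | yes _ | yes _ | no p = ∈-++⁺ʳ (cartesianProduct (before x0) Ys ++ cartesianProduct (after x1) Ys)
          (∈-++⁺ʳ (cartesianProduct Xs (before y0)) (∈-cartesianProduct⁺ (∈-whole x0 x1 x0≤x1 a b) (∈-after y1 d p)))
  ... | yes p | yes q | yes r | yes s = ⊥-elim (out ((p , q) , (r , s)))

  margin-length : length margin ≤ 42 * (w + h)
  margin-length = begin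
    length margin ≡⟨ trans (length-++ (cartesianProduct (before x0) Ys ++ cartesianProduct (after x1) Ys))
      (cong₂ ℕ._+_ (trans (length-++ (cartesianProduct (before x0) Ys)) (cong₂ ℕ._+_ (sz (before x0) Ys) (sz (after x1) Ys)))
        (trans (length-++ (cartesianProduct Xs (before y0))) (cong₂ ℕ._+_ (sz Xs (before y0)) (sz Xs (after y1))))) ⟩
    (3 * length Ys + 3 * length Ys) + (length Xs * 3 + length Xs * 3)
      ≡⟨ cong₂ (λ a b → (3 * b + 3 * b) + (a * 3 + a * 3)) (length-range (x0 ℤ.- + 3) (w + 6)) (length-range (y0 ℤ.- + 3) (h + 6)) ⟩
    (3 * (h + 6) + 3 * (h + 6)) + ((w + 6) * 3 + (w + 6) * 3) ≡⟨ l₁ w h ⟩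
    6 * (w + h) + 36 * 2 ≤⟨ ℕP.+-monoʳ-≤ (6 * (w + h)) (ℕP.*-monoʳ-≤ 36 (ℕP.+-mono-≤ {1} {w} {1} {h} (s≤s z≤n) (s≤s z≤n))) ⟩
    6 * (w + h) + 36 * (w + h) ≡⟨ l₂ (w + h) ⟩
    42 * (w + h) ∎
    where
    open ℕP.≤-Reasoning
    sz : ∀ xs ys → length (cartesianProduct {A = ℤ} {B = ℤ} xs ys) ≡ length xs * length ys
    sz = length-cartesianProduct
    l₁ : ∀ w h → (3 * (h + 6) + 3 * (h + 6)) + ((w + 6) * 3 + (w + 6) * 3) ≡ 6 * (w + h) + 36 * 2
    l₁ = solveℕ-∀
    l₂ : ∀ s → 6 * s + 36 * s ≡ 42 * s
    l₂ = solveℕ-∀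

-- Every line of tiles perpendicular to a side of the bounding rectangle contains a boundary tile

module Profile (P : List Pixel) (π ρ : Pixel → ℤ) (d : Dir)
  (π-move : ∀ p → π (move d p) ≡ π p) (ρ-move : ∀ p → ρ (move d p) ≡ ρ p ℤ.+ + 1)
  (π-step : ∀ e p → π (move e p) ℤ.≤ + 1 ℤ.+ π p)
  (top : ℤ) (below : ∀ {p} → p ∈ P → ρ p ℤ.≤ top) where

  -- Discrete intermediate value argument: one step raises `π` by at most one.
  meets : ∀ {p q xs} v → Walk p q xs → All (_∈ P) xs → π p ℤ.≤ v → v ℤ.≤ π q → ∃ λ r → r ∈ P × π r ≡ v
  meets v here (p∈ ∷ _) a b = _ , p∈ , ℤP.≤-antisym a b
  meets {p} v (there (e , refl) w) (p∈ ∷ all) a b with π p ℤ.≟ v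
  ... | yes eq = p , p∈ , eq
  ... | no ne = meets v w all (ℤP.≤-trans (π-step e p) (ℤP.i<j⇒suc[i]≤j (ℤP.≤∧≢⇒< a ne))) b

  -- `k` is fuel: `ρ` grows by one with each step along `d` and is bounded by `top` on P, so the
  -- climb leaves P before the fuel is exhausted.
  climb : ∀ k {p} → p ∈ P → + 0 ℤ.≤ ρ p ℤ.+ + k ℤ.- top → ∃ λ q → q ∈ P × π q ≡ π p × move d q ∉ P
  climb k {p} p∈ le with move d p ∈? P
  ... | no n = p , p∈ , refl , n
  climb zero {p} p∈ le | yes n = ⊥-elim (absurd (ρ p ℤ.+ + 0 ℤ.- top) le
      (subst (+ 0 ℤ.≤_) (trans (cong (λ z → top ℤ.- z) (ρ-move p)) (lem top (ρ p))) (0≤diff (below n))))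
    where
    lem : ∀ t r → t ℤ.- (r ℤ.+ + 1) ≡ ℤ.- (+ 1 ℤ.+ (r ℤ.+ + 0 ℤ.- t))
    lem = solve-∀
    absurd : ∀ z → + 0 ℤ.≤ z → ¬ (+ 0 ℤ.≤ ℤ.- (+ 1 ℤ.+ z))
    absurd (+ z) _ ()
  climb (suc k) {p} p∈ le | yes n =
    let (q , q∈ , e , nq) = climb k n (subst (+ 0 ℤ.≤_)
          (trans (lem (ρ p) (+ k) top) (cong (λ z → z ℤ.+ + k ℤ.- top) (sym (ρ-move p)))) le)
    in q , q∈ , trans e (π-move p) , nq
    where
    lem : ∀ r k t → r ℤ.+ (+ 1 ℤ.+ k) ℤ.- t ≡ r ℤ.+ + 1 ℤ.+ k ℤ.- t
    lem = solve-∀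

  tops : ∀ {v} → (∃ λ r → r ∈ P × π r ≡ v) → ∃ λ q → q ∈ P × π q ≡ v × move d q ∉ P
  tops (r , r∈ , refl) = climb ℤ.∣ top ℤ.- ρ r ∣ r∈
    (ℤP.≤-reflexive (sym (trans (cong (λ z → ρ r ℤ.+ z ℤ.- top) (ℤP.0≤i⇒+∣i∣≡i (0≤diff (below r∈)))) (lem (ρ r) top))))
    where
    lem : ∀ r t → r ℤ.+ (t ℤ.- r) ℤ.- t ≡ + 0
    lem = solve-∀

  -- Distinctness comes from the values of `π`: a new tile has a larger value than all tiles
  -- collected so far, hence the strict bound in the invariant.
  collect : ∀ lo k → (∀ i → i < k → ∃ λ r → r ∈ P × π r ≡ lo ℤ.+ + i) →
    ∃ λ L → length L ≡ k × Unique L × All (λ q → (q ∈ P × move d q ∉ P) × π q ℤ.< lo ℤ.+ + k) L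
  collect lo zero f = [] , refl , [] , []
  collect lo (suc k) f with collect lo k (λ i lt → f i (ℕP.m<n⇒m<1+n lt)) | tops (f k ℕP.≤-refl)
  ... | L , len , u , all | q , q∈ , e , n =
    q ∷ L , cong suc len ,
    All.map (λ { (_ , lt) refl → ℤP.<-irrefl e lt }) all ∷ u ,
    ((q∈ , n) , subst (ℤ._< lo ℤ.+ + suc k) (sym e) up-one) ∷ All.map (λ { (x , lt) → x , ℤP.<-trans lt up-one }) all
    where
    up-one : lo ℤ.+ + k ℤ.< lo ℤ.+ + suc k
    up-one = ℤP.+-monoʳ-< lo (ℤ.+<+ ℕP.≤-refl)

  -- A walk inside P between extremal tiles meets every line in between, and on each line `tops`
  -- finds a tile with an empty neighbour, that is, a boundary tile.
  width≤boundary : ∀ {Bd} → BoundaryList P Bd → Connected P → ∀ {lo hi} → lo ℤ.≤ hi →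
    (∃ λ p → p ∈ P × π p ≡ lo) → (∃ λ p → p ∈ P × π p ≡ hi) → extent lo hi ≤ length Bd
  width≤boundary {Bd} (_ , iff) conn {lo} {hi} le (p , p∈ , refl) (q , q∈ , refl) with
    collect lo (extent lo hi) (λ i i<k → let (_ , walk , all) = conn p∈ q∈ in
      meets (lo ℤ.+ + i) walk all (ℤP.≤-trans (ℤP.≤-reflexive (sym (ℤP.+-identityʳ lo))) (ℤP.+-monoʳ-≤ lo (+≤+ z≤n))) (reach i i<k))
    where
    lem : ∀ a b → a ℤ.+ (b ℤ.- a) ≡ b
    lem = solve-∀
    reach : ∀ i → i < extent lo hi → lo ℤ.+ + i ℤ.≤ hi
    reach i (s≤s i≤) = ℤP.≤-trans (ℤP.+-monoʳ-≤ lo (+≤+ i≤))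
      (ℤP.≤-reflexive (trans (cong (λ z → lo ℤ.+ z) (ℤP.0≤i⇒+∣i∣≡i (0≤diff le))) (lem lo hi)))
  ... | L , len , u , all = ℕP.≤-trans (ℕP.≤-reflexive (sym len)) (unique-⊆-length u λ {r} r∈ →
      let ((r∈P , out) , _) = All.lookup all r∈ in
      Equivalence.from (iff r) (r∈P , move d r , out , inj₁ (d , refl)))

boundary-bounds : ∀ {P x0 x1 y0 y1 Bd} → Polyomino P → BoundingRect P x0 x1 y0 y1 → BoundaryList P Bd →
  (x0 ℤ.≤ x1 × y0 ℤ.≤ y1) × extent x0 x1 ≤ length Bd × extent y0 y1 ≤ length Bd
boundary-bounds {P} {x0} {x1} {y0} {y1} poly (all , w , e , n , s) bl =
  (x≤ , y≤) ,
  Profile.width≤boundary P proj₁ proj₂ up (λ _ → refl) (λ _ → refl) x-step y1 (λ i → proj₂ (proj₂ (All.lookup all i)))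
    bl conn x≤ (find w) (find e) ,
  Profile.width≤boundary P proj₂ proj₁ right (λ _ → refl) (λ _ → refl) y-step x1 (λ i → proj₂ (proj₁ (All.lookup all i)))
    bl conn y≤ (find n) (find s)
  where
  conn = Polyomino.connected poly
  in₀ = All.lookup all (proj₂ (Polyomino.nonempty poly))
  x≤ = ℤP.≤-trans (proj₁ (proj₁ in₀)) (proj₂ (proj₁ in₀))
  y≤ = ℤP.≤-trans (proj₁ (proj₂ in₀)) (proj₂ (proj₂ in₀))
  still : ∀ z → z ℤ.≤ + 1 ℤ.+ z
  still z = ℤP.≤-trans (ℤP.≤-reflexive (sym (ℤP.+-identityˡ z))) (ℤP.+-monoˡ-≤ z (+≤+ z≤n))
  less : ∀ z → z ℤ.- ℤ.1ℤ ℤ.≤ + 1 ℤ.+ z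
  less z = ℤP.≤-trans (ℤP.+-monoʳ-≤ z (-≤+ {0} {1})) (ℤP.≤-reflexive (ℤP.+-comm z (+ 1)))
  x-step : ∀ d p → proj₁ (move d p) ℤ.≤ + 1 ℤ.+ proj₁ p
  x-step up (x , y) = still x
  x-step down (x , y) = still x
  x-step left (x , y) = less x
  x-step right (x , y) = ℤP.≤-reflexive (ℤP.+-comm x (+ 1))
  y-step : ∀ d p → proj₂ (move d p) ℤ.≤ + 1 ℤ.+ proj₂ p
  y-step up (x , y) = ℤP.≤-reflexive (ℤP.+-comm y (+ 1))
  y-step down (x , y) = less y
  y-step left (x , y) = still y
  y-step right (x , y) = still y

-- Time, tiles and space read off a run

run-step : ∀ c t → run robot (step robot c) t ≡ run robot c (suc t)
run-step c zero = refl
run-step c (suc t) = cong (step robot) (run-step c t)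

module Verdict (P : List Pixel) (poly : Polyomino P) (x0 x1 y0 y1 : ℤ) (br : BoundingRect P x0 x1 y0 y1) (S : ℕ) where

  open Conclusion P poly x0 x1 y0 y1 br S

  ev-run : ∀ {Φ K c} → Ev Φ K c → ∃ λ T → T ≤ K × Φ (run robot c T) × (∀ t → t < T → Ok (run robot c t))
  ev-run (now x) = 0 , z≤n , x , λ _ ()
  ev-run {Φ} {c = c} (later o e) with ev-run e
  ... | T , le , x , oks = suc T , s≤s le , subst Φ (run-step c T) x , λ where
    zero _ → o
    (suc t) (s≤s t<T) → subst Ok (run-step c t) (oks t t<T)

  halts : ∀ {c T} → Success (run robot c T) → (∀ t → t < T → Ok (run robot c t)) → HaltsAt robot c T
  halts (h , _) oks = h , λ t lt → Ok.running (oks t lt)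

  private
    throughout : ∀ {c T} {A : Conf robot → Set} → (∀ {c} → Ok c → A c) → (∀ {c} → Success c → A c) →
      Success (run robot c T) → (∀ t → t < T → Ok (run robot c t)) → ∀ t → t ≤ T → A (run robot c t)
    throughout f g s oks t le with ℕP.m≤n⇒m<n∨m≡n le
    ... | inj₁ lt = f (oks t lt)
    ... | inj₂ refl = g s

  tilesBounded : ∀ {c T} → Success (run robot c T) → (∀ t → t < T → Ok (run robot c t)) →
    TilesBounded robot c T (length P) N
  tilesBounded s oks t le L u all with throughout Ok.tiles (λ s → proj₂ (proj₂ (proj₂ s))) s oks t le
  ... | D , len , cover = ℕP.≤-trans
    (unique-⊆-length {ys = P ++ D} u λ {q} q∈ → Data.Sum.[ ∈-++⁺ˡ , ∈-++⁺ʳ P ] (cover q (All.lookup all q∈)))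
    (ℕP.≤-trans (ℕP.≤-reflexive (length-++ P {D})) (ℕP.+-monoʳ-≤ (length P) len))

  spaceBounded : ∀ {c T} → x0 ℤ.≤ x1 → y0 ℤ.≤ y1 → Success (run robot c T) → (∀ t → t < T → Ok (run robot c t)) →
    SpaceBounded robot c T x0 x1 y0 y1 (42 * (extent x0 x1 + extent y0 y1))
  spaceBounded x≤ y≤ s oks L u all = ℕP.≤-trans
    (unique-⊆-length u λ {q} q∈ → let (out , t , le , e) = All.lookup all q∈ in
      Margin.∈-margin P x0 x1 y0 y1 N x≤ y≤ out
        (subst (Within 3) e (throughout Ok.inside (λ s → proj₁ (proj₂ s)) s oks t le)))
    (Margin.margin-length P x0 x1 y0 y1 N x≤ y≤)

module Offsets {P : List Pixel} {x0 x1 y0 y1 : ℤ} (br : BoundingRect P x0 x1 y0 y1) {sx sy : ℤ} (s∈ : (sx , sy) ∈ P) where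

  private
    in₀ = All.lookup (proj₁ br) s∈
    _∸∸_ : ℤ → ℤ → ℕ
    a ∸∸ b = ℤ.∣ a ℤ.- b ∣

  L R T B : ℕ
  L = sx ∸∸ x0
  R = x1 ∸∸ sx
  T = sy ∸∸ y0
  B = y1 ∸∸ sy

  eL : + L ≡ sx ℤ.- x0
  eL = ℤP.0≤i⇒+∣i∣≡i (0≤diff (proj₁ (proj₁ in₀)))
  eR : + R ≡ x1 ℤ.- sx
  eR = ℤP.0≤i⇒+∣i∣≡i (0≤diff (proj₂ (proj₁ in₀)))
  eT : + T ≡ sy ℤ.- y0
  eT = ℤP.0≤i⇒+∣i∣≡i (0≤diff (proj₁ (proj₂ in₀)))
  eB : + B ≡ y1 ℤ.- sy
  eB = ℤP.0≤i⇒+∣i∣≡i (0≤diff (proj₂ (proj₂ in₀)))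

  private
    total : ∀ {a b s l r} → a ℤ.≤ b → + l ≡ s ℤ.- a → + r ≡ b ℤ.- s → 1 + l + r ≡ extent a b
    total {a} {b} {s} {l} {r} le el er = ℤP.+-injective (trans
      (trans (cong (λ z → + 1 ℤ.+ z ℤ.+ + r) el) (trans (cong (λ z → + 1 ℤ.+ (s ℤ.- a) ℤ.+ z) er) (lem a b s)))
      (sym (extent≡ le)))
      where
      lem : ∀ a b s → + 1 ℤ.+ (s ℤ.- a) ℤ.+ (b ℤ.- s) ≡ b ℤ.- a ℤ.+ + 1
      lem = solve-∀

  wide : 1 + L + R ≡ extent x0 x1
  wide = total (ℤP.≤-trans (proj₁ (proj₁ in₀)) (proj₂ (proj₁ in₀))) eL eR
  tall : 1 + T + B ≡ extent y0 y1
  tall = total (ℤP.≤-trans (proj₁ (proj₂ in₀)) (proj₂ (proj₂ in₀))) eT eB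

-- The solid rectangle

brick : ℕ → ℕ → List Pixel
brick w h = cartesianProduct (map +_ (upTo w)) (map +_ (upTo h))

brick⁺ : ∀ w h {a b} → a < w → b < h → (+ a , + b) ∈ brick w h
brick⁺ w h a<w b<h = ∈-cartesianProduct⁺ (∈-map⁺ +_ (∈-upTo⁺ a<w)) (∈-map⁺ +_ (∈-upTo⁺ b<h))

brick⁻ : ∀ w h {x y} → (x , y) ∈ brick w h → ∃ λ a → ∃ λ b → (x ≡ + a × a < w) × (y ≡ + b × b < h)
brick⁻ w h q∈ with ∈-cartesianProduct⁻ (map +_ (upTo w)) (map +_ (upTo h)) q∈
... | x∈ , y∈ with ∈-map⁻ +_ x∈ | ∈-map⁻ +_ y∈
...   | a , a∈ , ea | b , b∈ , eb = a , b , (ea , ∈-upTo⁻ a∈) , (eb , ∈-upTo⁻ b∈)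

Joined : List Pixel → Pixel → Pixel → Set
Joined P p q = ∃ λ xs → Walk p q xs × All (_∈ P) xs

joined-trans : ∀ {P p q r} → Joined P p q → Joined P q r → Joined P p r
joined-trans (_ , here , _) j = j
joined-trans (_ , there a w , p∈ ∷ all) j =
  let (xs , w′ , all′) = joined-trans (_ , w , all) j in _ , there a w′ , p∈ ∷ all′

joined-step : ∀ {P p} d → p ∈ P → move d p ∈ P → Joined P p (move d p)
joined-step d p∈ q∈ = _ , there (d , refl) here , p∈ ∷ q∈ ∷ []

joined-sym : ∀ {P p q} → Joined P p q → Joined P q p
joined-sym (_ , here , all) = _ , here , all
joined-sym {P} {p} (_ , there (d , refl) w , p∈ ∷ all) = joined-trans (joined-sym (_ , w , all))
  (subst (Joined P (move d p)) (sym (move-opp refl))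
    (joined-step (opp d) (first w all) (subst (_∈ P) (move-opp refl) p∈)))
  where
  first : ∀ {u v xs} → Walk u v xs → All (_∈ P) xs → u ∈ P
  first here (i ∷ _) = i
  first (there _ _) (i ∷ _) = i

brick-joined : ∀ {w h} a b → a < w → b < h → Joined (brick w h) (+ a , + b) (+ 0 , + 0)
brick-joined {w} {h} zero zero a< b< = _ , here , brick⁺ w h a< b< ∷ []
brick-joined {w} {h} zero (suc b) a< b< =
  joined-trans (joined-step down (brick⁺ w h a< b<) (brick⁺ w h a< (ℕP.<⇒≤ b<))) (brick-joined zero b a< (ℕP.<⇒≤ b<))
brick-joined {w} {h} (suc a) b a< b< =
  joined-trans (joined-step left (brick⁺ w h a< b<) (brick⁺ w h (ℕP.<⇒≤ a<) b<)) (brick-joined a b (ℕP.<⇒≤ a<) b<)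

brick-polyomino : ∀ w h → Polyomino (brick (suc w) (suc h))
brick-polyomino w h = record
  { unique = UniqueP.cartesianProduct⁺ (UniqueP.map⁺ ℤP.+-injective (UniqueP.upTo⁺ (suc w)))
      (UniqueP.map⁺ ℤP.+-injective (UniqueP.upTo⁺ (suc h)))
  ; nonempty = (+ 0 , + 0) , brick⁺ (suc w) (suc h) (s≤s z≤n) (s≤s z≤n)
  ; connected = λ p∈ q∈ → joined-trans (origin p∈) (joined-sym (origin q∈))
  ; diagonal = λ { p∈ q∈ (d , e , dh , ev , refl) → corner _ d e dh ev p∈ q∈ }
  }
  where
  P = brick (suc w) (suc h)
  origin : ∀ {q} → q ∈ P → Joined P q (+ 0 , + 0)
  origin q∈ with brick⁻ (suc w) (suc h) q∈
  ... | a , b , (refl , a<) , (refl , b<) = brick-joined a b a< b<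
  mixed : ∀ {x y x′ y′} → (x , y) ∈ P → (x′ , y′) ∈ P → (x′ , y) ∈ P
  mixed p∈ q∈ with brick⁻ (suc w) (suc h) p∈ | brick⁻ (suc w) (suc h) q∈
  ... | _ , b , _ , (refl , b<) | a , _ , (refl , a<) , _ = brick⁺ (suc w) (suc h) a< b<
  corner : ∀ p d e → Horizontal d → Vertical e → p ∈ P → move e (move d p) ∈ P →
    ∃ λ r → r ∈ P × Adj4 r p × Adj4 r (move e (move d p))
  corner p left up _ _ p∈ q∈ = move left p , mixed p∈ q∈ , (right , move-opp {left} refl) , (up , refl)
  corner p left down _ _ p∈ q∈ = move left p , mixed p∈ q∈ , (right , move-opp {left} refl) , (down , refl)
  corner p right up _ _ p∈ q∈ = move right p , mixed p∈ q∈ , (left , move-opp {right} refl) , (up , refl)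
  corner p right down _ _ p∈ q∈ = move right p , mixed p∈ q∈ , (left , move-opp {right} refl) , (down , refl)

brick-boundingRect : ∀ w h → BoundingRect (brick (suc w) (suc h)) (+ 0) (+ w) (+ 0) (+ h)
brick-boundingRect w h =
  All.tabulate inside ,
  lose (brick⁺ (suc w) (suc h) {0} {0} (s≤s z≤n) (s≤s z≤n)) refl ,
  lose (brick⁺ (suc w) (suc h) {w} {0} ℕP.≤-refl (s≤s z≤n)) refl ,
  lose (brick⁺ (suc w) (suc h) {0} {0} (s≤s z≤n) (s≤s z≤n)) refl ,
  lose (brick⁺ (suc w) (suc h) {0} {h} (s≤s z≤n) ℕP.≤-refl) refl
  where
  inside : ∀ {q} → q ∈ brick (suc w) (suc h) →
    ((+ 0 ℤ.≤ proj₁ q) × (proj₁ q ℤ.≤ + w)) × ((+ 0 ℤ.≤ proj₂ q) × (proj₂ q ℤ.≤ + h))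
  inside q∈ with brick⁻ (suc w) (suc h) q∈
  ... | a , b , (refl , s≤s a≤) , (refl , s≤s b≤) = (+≤+ z≤n , +≤+ a≤) , (+≤+ z≤n , +≤+ b≤)

brick-solid : ∀ w h N q → Run.Within (brick (suc w) (suc h)) (+ 0) (+ w) (+ 0) (+ h) N 0 q → q ∈ brick (suc w) (suc h)
brick-solid w h N (x , y) ((a , b) , (c , d)) with coordinate x a b | coordinate y c d
  where
  lem : ∀ X W → W ℤ.- X ℤ.+ + 0 ≡ W ℤ.- X
  lem = solve-∀
  coordinate : ∀ {w} x → + 0 ℤ.≤ x ℤ.- + 0 ℤ.+ + 0 → + 0 ℤ.≤ + w ℤ.- x ℤ.+ + 0 → ∃ λ a → x ≡ + a × a ≤ w
  coordinate {w} (+ a) _ q = a , refl , ℤP.drop‿+≤+ (ℤP.0≤i-j⇒j≤i (subst (+ 0 ℤ.≤_) (lem (+ a) (+ w)) q))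
... | a , refl , a≤ | b , refl , b≤ = brick⁺ (suc w) (suc h) (s≤s a≤) (s≤s b≤)

-- Bounds

open ℕP.≤-Reasoning

-- 2000 is one common constant: the estimates give 1756 for the worst time, 439 for the best, 40 for
-- the tiles and 42 for the space.
2000-bound : ∀ {k a} x → k ≤ 2000 → a ≤ k * x → a ≤ 2000 * x
2000-bound x le p = ℕP.≤-trans p (ℕP.*-monoˡ-≤ x le)

-- With `M` the larger side, S ≤ 2M and M ≤ wh, so S² ≤ 4M² ≤ 4M · wh; lower powers of `S` are
-- raised to S² by 1 ≤ S.
worst-time : ∀ w h → 1 ≤ w → 1 ≤ h →
  30 + ((4 * (w + h) + 4) * (39 * (w + h)) + (77 + 10 * (w + h))) ≤ 2000 * ((w ⊔ h) * (w * h))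
worst-time w h 1≤w 1≤h = 2000-bound ((w ⊔ h) * (w * h)) (from-yes (1756 ℕ.≤? 2000)) (begin
  30 + ((4 * S + 4) * (39 * S) + (77 + 10 * S)) ≡⟨ l₁ S ⟩
  156 * (S * S) + 166 * (S * 1) + 107 * (1 * 1)
    ≤⟨ ℕP.+-mono-≤ (ℕP.+-monoʳ-≤ (156 * (S * S)) (ℕP.*-monoʳ-≤ 166 (ℕP.*-monoʳ-≤ S 1≤S))) (ℕP.*-monoʳ-≤ 107 (ℕP.*-mono-≤ 1≤S 1≤S)) ⟩
  156 * (S * S) + 166 * (S * S) + 107 * (S * S) ≡⟨ l₂ (S * S) ⟩
  429 * (S * S) ≤⟨ ℕP.*-monoʳ-≤ 429 (ℕP.*-mono-≤ S≤ S≤) ⟩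
  429 * ((M + M) * (M + M)) ≡⟨ l₃ M ⟩
  1716 * (M * M) ≤⟨ ℕP.*-mono-≤ (from-yes (1716 ℕ.≤? 1756)) (ℕP.*-monoʳ-≤ M M≤) ⟩
  1756 * (M * (w * h)) ∎)
  where
  S = w + h
  M = w ⊔ h
  1≤S : 1 ≤ S
  1≤S = ℕP.≤-trans 1≤w (ℕP.m≤m+n w h)
  S≤ : S ≤ M + M
  S≤ = ℕP.+-mono-≤ (ℕP.m≤m⊔n w h) (ℕP.m≤n⊔m w h)
  M≤ : M ≤ w * h
  M≤ = ℕP.⊔-lub
    (ℕP.≤-trans (ℕP.≤-reflexive (sym (ℕP.*-identityʳ w))) (ℕP.*-monoʳ-≤ w 1≤h))
    (ℕP.≤-trans (ℕP.≤-reflexive (sym (ℕP.*-identityˡ h))) (ℕP.*-monoˡ-≤ h 1≤w))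
  l₁ : ∀ S → 30 + ((4 * S + 4) * (39 * S) + (77 + 10 * S)) ≡
    156 * (S * S) + 166 * (S * 1) + 107 * (1 * 1)
  l₁ = solveℕ-∀
  l₂ : ∀ x → 156 * x + 166 * x + 107 * x ≡ 429 * x
  l₂ = solveℕ-∀
  l₃ : ∀ M → 429 * ((M + M) * (M + M)) ≡ 1716 * (M * M)
  l₃ = solveℕ-∀

-- The eight terms `A` are four phases of extensions and at most four final misses.
best-time : ∀ w h → 1 ≤ w → 1 ≤ h → let A = 39 * (w * h) in
  30 + ((A + (A + (A + (A + 4 * A)))) + (77 + 10 * (w + h))) ≤ 2000 * (w * h)
best-time w h 1≤w 1≤h = 2000-bound (w * h) (from-yes (439 ℕ.≤? 2000)) (begin
  30 + ((A + (A + (A + (A + 4 * A)))) + (77 + 10 * (w + h))) ≡⟨ l₁ (w * h) w h ⟩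
  312 * (w * h) + 10 * (w * 1 + 1 * h) + 107 * (1 * 1)
    ≤⟨ ℕP.+-mono-≤ (ℕP.+-monoʳ-≤ (312 * (w * h)) (ℕP.*-monoʳ-≤ 10 (ℕP.+-mono-≤ (ℕP.*-monoʳ-≤ w 1≤h) (ℕP.*-monoˡ-≤ h 1≤w))))
         (ℕP.*-monoʳ-≤ 107 (ℕP.*-mono-≤ 1≤w 1≤h)) ⟩
  312 * (w * h) + 10 * (w * h + w * h) + 107 * (w * h) ≡⟨ l₂ (w * h) ⟩
  439 * (w * h) ∎)
  where
  A = 39 * (w * h)
  l₁ : ∀ a w h → 30 + ((39 * a + (39 * a + (39 * a + (39 * a + 4 * (39 * a))))) + (77 + 10 * (w + h))) ≡
    312 * a + 10 * (w * 1 + 1 * h) + 107 * (1 * 1)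
  l₁ = solveℕ-∀
  l₂ : ∀ a → 312 * a + 10 * (a + a) + 107 * a ≡ 439 * a
  l₂ = solveℕ-∀

tile-bound : ∀ w h b → 1 ≤ w → w ≤ b → h ≤ b → 16 + 4 * (4 + (w + h)) ≤ 2000 * b
tile-bound w h b 1≤w w≤b h≤b = 2000-bound b (from-yes (40 ℕ.≤? 2000)) (begin
  16 + 4 * (4 + (w + h)) ≡⟨ l₁ w h ⟩
  32 * 1 + 4 * (w + h) ≤⟨ ℕP.+-mono-≤ (ℕP.*-monoʳ-≤ 32 (ℕP.≤-trans 1≤w w≤b)) (ℕP.*-monoʳ-≤ 4 (ℕP.+-mono-≤ w≤b h≤b)) ⟩
  32 * b + 4 * (b + b) ≡⟨ l₂ b ⟩
  40 * b ∎)
  where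
  l₁ : ∀ w h → 16 + 4 * (4 + (w + h)) ≡ 32 * 1 + 4 * (w + h)
  l₁ = solveℕ-∀
  l₂ : ∀ b → 32 * b + 4 * (b + b) ≡ 40 * b
  l₂ = solveℕ-∀

measure-bound : ∀ L R T B → 4 * (L + R + (T + B)) + 3 ≤ 3 + 4 * ((1 + L + R) + (1 + T + B))
measure-bound L R T B = ℕP.≤-trans (ℕP.m≤m+n _ 8) (ℕP.≤-reflexive (lem L R T B))
  where
  lem : ∀ L R T B → 4 * (L + R + (T + B)) + 3 + 8 ≡ 3 + 4 * ((1 + L + R) + (1 + T + B))
  lem = solveℕ-∀

-- The general case and the full rectangle

worst-case : (P : List Pixel) → Polyomino P → (x0 x1 y0 y1 : ℤ) → BoundingRect P x0 x1 y0 y1 →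
  (Bd : List Pixel) → BoundaryList P Bd → (s : Pixel) → s ∈ P →
  Σ ℕ λ T → HaltsAt robot (initial robot P s) T ×
    BuildsBoundingBox P (Conf.grid (run robot (initial robot P s) T)) ×
    T ≤ 2000 * ((extent x0 x1 ⊔ extent y0 y1) * (extent x0 x1 * extent y0 y1)) ×
    TilesBounded robot (initial robot P s) T (length P) (2000 * length Bd) ×
    SpaceBounded robot (initial robot P s) T x0 x1 y0 y1 (2000 * (extent x0 x1 + extent y0 y1))
worst-case P poly x0 x1 y0 y1 br Bd bl (sx , sy) s∈ = deduce (V.ev-run main)
  where
  w h : ℕ
  w = extent x0 x1
  h = extent y0 y1
  module V = Verdict P poly x0 x1 y0 y1 br (w + h)
  open Conclusion P poly x0 x1 y0 y1 br (w + h)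
  open Offsets br s∈
  c₀ = initial robot P (sx , sy)
  bounds = boundary-bounds poly br bl
  time : ℕ
  time = 30 + ((4 + 4 * (w + h)) * (39 * (w + h)) + (77 + 10 * (w + h)))
  main : Ev Success time c₀
  main = ev-bind (setup s∈ eL eR eT eB) λ _ st →
    ev-bind (loop (3 + 4 * (w + h)) st
      (subst₂ (λ a b → measure L R T B 0F ≤ 3 + 4 * (a + b)) wide tall (measure-bound L R T B))
      (cong₂ ℕ._+_ wide tall)) λ _ → conclude
  deduce : (∃ λ T → T ≤ time × Success (run robot c₀ T) × (∀ t → t < T → Ok (run robot c₀ t))) →
    Σ ℕ λ T → HaltsAt robot c₀ T × BuildsBoundingBox P (Conf.grid (run robot c₀ T)) ×
      T ≤ 2000 * ((w ⊔ h) * (w * h)) ×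
      TilesBounded robot c₀ T (length P) (2000 * length Bd) ×
      SpaceBounded robot c₀ T x0 x1 y0 y1 (2000 * (w + h))
  deduce (T , T≤ , s , oks) =
    T , V.halts s oks , proj₁ (proj₂ (proj₂ s)) ,
    ℕP.≤-trans T≤ (ℕP.≤-trans (ℕP.≤-reflexive (cong (λ z → 30 + (z * (39 * (w + h)) + (77 + 10 * (w + h)))) (ℕP.+-comm 4 (4 * (w + h)))))
      (worst-time w h (s≤s z≤n) (s≤s z≤n))) ,
    (λ t le L u all → ℕP.≤-trans (V.tilesBounded s oks t le L u all)
      (ℕP.+-monoʳ-≤ (length P) (tile-bound w h (length Bd) (s≤s z≤n) (proj₁ (proj₂ bounds)) (proj₂ (proj₂ bounds))))) ,
    (λ L u all → ℕP.≤-trans (V.spaceBounded (proj₁ (proj₁ bounds)) (proj₂ (proj₁ bounds)) s oks L u all)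
      (ℕP.*-monoˡ-≤ (w + h) (from-yes (42 ℕ.≤? 2000))))

solid-case : (P : List Pixel) → Polyomino P → (x0 x1 y0 y1 : ℤ) → BoundingRect P x0 x1 y0 y1 →
  (∀ N q → Run.Within P x0 x1 y0 y1 N 0 q → q ∈ P) → (s : Pixel) → s ∈ P →
  Σ ℕ λ T → HaltsAt robot (initial robot P s) T × T ≤ 2000 * (extent x0 x1 * extent y0 y1)
solid-case P poly x0 x1 y0 y1 br solid (sx , sy) s∈ = deduce (V.ev-run main)
  where
  w h : ℕ
  w = extent x0 x1
  h = extent y0 y1
  A = 39 * (w * h)
  module V = Verdict P poly x0 x1 y0 y1 br (w + h)
  open Conclusion P poly x0 x1 y0 y1 br (w + h)
  open Offsets br s∈
  c₀ = initial robot P (sx , sy)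
  time : ℕ
  time = 30 + ((A + (A + (A + (A + 4 * A)))) + (77 + 10 * (w + h)))
  main : Ev Success time c₀
  main = ev-bind (setup s∈ eL eR eT eB) λ _ st →
    ev-bind (solid-loop (solid N) (w + h) (w * h) st (cong₂ ℕ._+_ wide tall , cong₂ ℕ._*_ wide tall)) λ _ → conclude
  deduce : (∃ λ T → T ≤ time × Success (run robot c₀ T) × (∀ t → t < T → Ok (run robot c₀ t))) →
    Σ ℕ λ T → HaltsAt robot c₀ T × T ≤ 2000 * (w * h)
  deduce (T , T≤ , s , oks) = T , V.halts s oks , ℕP.≤-trans T≤ (best-time w h (s≤s z≤n) (s≤s z≤n))

best-case : (w h : ℕ) → 1 ≤ w → 1 ≤ h →
  Σ (List Pixel) λ P → Polyomino P ×
  Σ ℤ λ x0 → Σ ℤ λ x1 → Σ ℤ λ y0 → Σ ℤ λ y1 →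
    BoundingRect P x0 x1 y0 y1 × extent x0 x1 ≡ w × extent y0 y1 ≡ h ×
    Σ Pixel λ s → s ∈ P × Σ ℕ λ T →
      HaltsAt robot (initial robot P s) T × T ≤ 2000 * (w * h)
best-case (suc w) (suc h) _ _ =
  brick (suc w) (suc h) , brick-polyomino w h , + 0 , + w , + 0 , + h , brick-boundingRect w h ,
  ew , eh , (+ 0 , + 0) , s∈ ,
  subst₂ (λ a b → Σ ℕ λ T → HaltsAt robot (initial robot (brick (suc w) (suc h)) (+ 0 , + 0)) T × T ≤ 2000 * (a * b))
    ew eh (solid-case (brick (suc w) (suc h)) (brick-polyomino w h) (+ 0) (+ w) (+ 0) (+ h) (brick-boundingRect w h)
      (brick-solid w h) (+ 0 , + 0) s∈)
  where
  s∈ : (+ 0 , + 0) ∈ brick (suc w) (suc h)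
  s∈ = brick⁺ (suc w) (suc h) (s≤s z≤n) (s≤s z≤n)
  ew : extent (+ 0) (+ w) ≡ suc w
  ew = cong suc (ℕP.+-identityʳ w)
  eh : extent (+ 0) (+ h) ≡ suc h
  eh = cong suc (ℕP.+-identityʳ h)

theorem1 : Σ Robot λ R → Σ ℕ λ C →
  ((P : List Pixel) → Polyomino P →
    (x0 x1 y0 y1 : ℤ) → BoundingRect P x0 x1 y0 y1 →
    (Bd : List Pixel) → BoundaryList P Bd →
    (s : Pixel) → s ∈ P →
    Σ ℕ λ T →
      HaltsAt R (initial R P s) T ×
      BuildsBoundingBox P (Conf.grid (run R (initial R P s) T)) ×
      T ≤ C * ((extent x0 x1 ⊔ extent y0 y1) * (extent x0 x1 * extent y0 y1)) ×
      TilesBounded R (initial R P s) T (length P) (C * length Bd) ×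
      SpaceBounded R (initial R P s) T x0 x1 y0 y1 (C * (extent x0 x1 + extent y0 y1)))
  ×
  ((w h : ℕ) → 1 ≤ w → 1 ≤ h →
    Σ (List Pixel) λ P → Polyomino P ×
    Σ ℤ λ x0 → Σ ℤ λ x1 → Σ ℤ λ y0 → Σ ℤ λ y1 →
      BoundingRect P x0 x1 y0 y1 × extent x0 x1 ≡ w × extent y0 y1 ≡ h ×
      Σ Pixel λ s → s ∈ P × Σ ℕ λ T →
        HaltsAt R (initial R P s) T × T ≤ C * (w * h))
theorem1 = robot , 2000 , worst-case , best-case
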